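{- Let $d,n>1$ be integers with $n\equiv 1 \pmod{2d}$, and let $a$ be an indeterminate. Then, modulo $\Phi_{n}(q)(1-aq^n)(a-q^n)$, \[ \sum_{k=0}^{(n-1)/d}[3dk+1]\frac{(q;q^{2d})_{k}(q^{d-1};q^{d})_{k}(aq,q/a;q^{d})_{k}}{(q^{d};q^{d})_{k}(q^{d+2};q^{2d})_{k}(aq^{2d},q^{2d}/a;q^{2d})_{k}}q^{d(k^{2}+k)/2} \equiv \frac{(q^{d};q^{2d})_{(n-1)/(2d)}}{(q^{d+2};q^{2d})_{(n-1)/(2d)}}[n]\,q^{ -(n-1)(d-1)/(2d)}. \]
   Context: For an indeterminate $q$, $(x;q)_k=(1-x)(1-xq)\cdots(1-xq^{k-1})$ (with $(x;q)_0=1$), and $(x_1,\dots,x_m;q)_k=(x_1;q)_k\cdots(x_m;q)_k$. $[m]=(1-q^m)/(1-q)$ is the $q$-integer and $\Phi_n(q)$ is the $n$-th cyclotomic polynomial. A congruence between rational functions in $q$ and $a$ modulo a polynomial $P(q,a)$ means that the difference is $P(q,a)$ times a rational function in $q,a$ whose denominator is coprime to $P(q,a)$. -}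

module Defs where

open import Data.Nat as ℕ using (ℕ; zero; suc; NonZero)
open import Data.Nat.Divisibility using (_∣?_)
open import Data.Rational as ℚ using (ℚ; 0ℚ; 1ℚ)
open import Data.Rational.Properties using () renaming (_≟_ to _≟ℚ_)
open import Data.List using (List; []; _∷_; length; reverse; _++_; [_])
open import Data.Product using (∃; _×_; _,_)
open import Relation.Nullary using (¬_; yes; no)
open import Relation.Binary.PropositionalEquality using (_≡_)

-- Dense univariate polynomials over a (commutative) ring R, represented
-- as coefficient lists, lowest degree first.  Trailing zeros allowed;
-- equality is always compared coefficientwise (see _≈_ below).

module ListPoly {R : Set} (0# 1# : R) (_⊕_ _⊗_ : R → R → R) (⊖_ : R → R) where

  Poly : Set
  Poly = List R

  _+P_ : Poly → Poly → Poly
  [] +P g = g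
  (x ∷ f) +P [] = x ∷ f
  (x ∷ f) +P (y ∷ g) = (x ⊕ y) ∷ (f +P g)

  scale : R → Poly → Poly
  scale c [] = []
  scale c (x ∷ f) = (c ⊗ x) ∷ scale c f

  _*P_ : Poly → Poly → Poly
  [] *P g = []
  (x ∷ f) *P g = scale x g +P (0# ∷ (f *P g))

  -P_ : Poly → Poly
  -P [] = []
  -P (x ∷ f) = (⊖ x) ∷ (-P f)

  _-P_ : Poly → Poly → Poly
  f -P g = f +P (-P g)

  constP : R → Poly
  constP c = c ∷ []

  oneP : Poly
  oneP = constP 1#

  monoP : ℕ → Poly
  monoP zero = 1# ∷ []
  monoP (suc k) = 0# ∷ monoP k

  _^P_ : Poly → ℕ → Poly
  f ^P zero = oneP
  f ^P suc k = f *P (f ^P k)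

  coeff : Poly → ℕ → R
  coeff [] k = 0#
  coeff (x ∷ f) zero = x
  coeff (x ∷ f) (suc k) = coeff f k

module P1 = ListPoly 0ℚ 1ℚ ℚ._+_ ℚ._*_ ℚ.-_

Poly1 : Set
Poly1 = P1.Poly

-- ℚ[q][a] = ℚ[q,a]: polynomials in a whose coefficients are in ℚ[q]

module P2 = ListPoly [] P1.oneP P1._+P_ P1._*P_ P1.-P_

Poly2 : Set
Poly2 = P2.Poly

open P2 public using () renaming
  (_+P_ to _+₂_; _*P_ to _*₂_; _-P_ to _-₂_; _^P_ to _^₂_; oneP to 1₂)

0₂ : Poly2
0₂ = []

coeff₂ : Poly2 → ℕ → ℕ → ℚ
coeff₂ f i j = P1.coeff (P2.coeff f i) j

infix 4 _≈_
_≈_ : Poly2 → Poly2 → Set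
f ≈ g = ∀ i j → coeff₂ f i j ≡ coeff₂ g i j

qv : Poly2
qv = P1.monoP 1 ∷ []

av : Poly2
av = P2.monoP 1

embed₁ : Poly1 → Poly2
embed₁ p = p ∷ []

-- Cyclotomic polynomials Φ_n(q) ∈ ℚ[q], defined recursively by
--   Φ_n = (q^n - 1) / ∏_{e ∣ n, e < n} Φ_e     (n ≥ 1)
-- using long division by a monic polynomial.

trim : Poly1 → Poly1
trim [] = []
trim (x ∷ f) with trim f
... | g ∷ gs = x ∷ g ∷ gs
... | [] with x ≟ℚ 0ℚ
...   | yes _ = []
...   | no _ = x ∷ []

private
  -- r - c * g, aligned at the front (lists highest degree first)
  subScaled : ℚ → List ℚ → List ℚ → List ℚ
  subScaled c [] r = r
  subScaled c (g ∷ gs) [] = ℚ.- (c ℚ.* g) ∷ subScaled c gs []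
  subScaled c (g ∷ gs) (x ∷ xs) = (x ℚ.- (c ℚ.* g)) ∷ subScaled c gs xs

  -- quotient (highest first) of division by a monic polynomial whose
  -- non-leading coefficients (highest first) are gt
  divH : ℕ → List ℚ → List ℚ → List ℚ
  divH zero r gt = []
  divH (suc f) [] gt = []
  divH (suc f) (c ∷ r) gt = c ∷ divH f (subScaled c gt r) gt

divMonic : Poly1 → Poly1 → Poly1
divMonic f g with reverse (trim f) | reverse (trim g)
... | fr | [] = []
... | fr | (_ ∷ gt) =
  reverse (divH (suc (length fr ℕ.∸ suc (length gt))) fr gt)

private
  prodDiv : ℕ → ℕ → List Poly1 → Poly1
  prodDiv N e [] = P1.oneP
  prodDiv N e (p ∷ ps) with e ∣? N
  ... | yes _ = p P1.*P prodDiv N (suc e) ps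
  ... | no _ = prodDiv N (suc e) ps

  cycTable : ℕ → List Poly1
  cycTable zero = []
  cycTable (suc m) = t ++ [ divMonic (P1.monoP (suc m) P1.-P P1.oneP) (prodDiv (suc m) 1 t) ]
    where t = cycTable m

  lastOr : Poly1 → List Poly1 → Poly1
  lastOr d [] = d
  lastOr d (p ∷ ps) = lastOr p ps

-- Φ_n(q) (Φ_0 is set to 1 by convention; it is never used)
cyclotomic : ℕ → Poly1
cyclotomic n = lastOr P1.oneP (cycTable n)

record Frac : Set where
  constructor _/_
  field
    num : Poly2
    den : Poly2
open Frac public

infixl 6 _+F_
infixl 7 _*F_ _÷F_

_+F_ : Frac → Frac → Frac
(a / b) +F (c / d) = ((a *₂ d) +₂ (c *₂ b)) / (b *₂ d)

_*F_ : Frac → Frac → Frac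
(a / b) *F (c / d) = (a *₂ c) / (b *₂ d)

_÷F_ : Frac → Frac → Frac
(a / b) ÷F (c / d) = (a *₂ d) / (b *₂ c)

poly : Poly2 → Frac
poly p = p / 1₂

0F 1F : Frac
0F = poly 0₂
1F = poly 1₂

_^F_ : Frac → ℕ → Frac
x ^F zero = 1F
x ^F suc k = x *F (x ^F k)

_-F_ : Frac → Frac → Frac
(a / b) -F (c / d) = ((a *₂ d) -₂ (c *₂ b)) / (b *₂ d)

qF aF : Frac
qF = poly qv
aF = poly av

poch : Frac → Frac → ℕ → Frac
poch x r zero = 1F
poch x r (suc k) = poch x r k *F (1F -F (x *F (r ^F k)))

qint : ℕ → Frac
qint m = (1F -F (qF ^F m)) ÷F (1F -F qF)

sumTo : ℕ → (ℕ → Frac) → Frac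
sumTo zero f = f 0
sumTo (suc N) f = sumTo N f +F f (suc N)

_∣₂_ : Poly2 → Poly2 → Set
f ∣₂ g = ∃ λ h → g ≈ f *₂ h

IsUnit₂ : Poly2 → Set
IsUnit₂ f = ∃ λ h → f *₂ h ≈ 1₂

Coprime₂ : Poly2 → Poly2 → Set
Coprime₂ f g = ∀ h → h ∣₂ f → h ∣₂ g → IsUnit₂ h

-- Congruence of rational functions modulo a polynomial P:
--   A/B - C/D = P · (U/V) with V ≠ 0 coprime to P,
-- i.e. (A D - C B) V = P U B D.
_≡F_mod_ : Frac → Frac → Poly2 → Set
(A / B) ≡F (C / D) mod P =
  ∃ λ U → ∃ λ V → (¬ (V ≈ 0₂)) × Coprime₂ V P ×
    ((((A *₂ D) -₂ (C *₂ B)) *₂ V) ≈ (((P *₂ U) *₂ B) *₂ D))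

lhs4 : (d n : ℕ) → .{{NonZero d}} → Frac
lhs4 d n = sumTo ((n ℕ.∸ 1) ℕ./ d) term
  where
  Q : ℕ → Frac
  Q m = qF ^F m
  term : ℕ → Frac
  term k =
    ((qint (3 ℕ.* d ℕ.* k ℕ.+ 1)
      *F poch qF (Q (2 ℕ.* d)) k
      *F poch (Q (d ℕ.∸ 1)) (Q d) k
      *F poch (aF *F qF) (Q d) k
      *F poch (qF ÷F aF) (Q d) k)
     ÷F (poch (Q d) (Q d) k
      *F poch (Q (d ℕ.+ 2)) (Q (2 ℕ.* d)) k
      *F poch (aF *F Q (2 ℕ.* d)) (Q (2 ℕ.* d)) k
      *F poch (Q (2 ℕ.* d) ÷F aF) (Q (2 ℕ.* d)) k))
    *F Q ((d ℕ.* (k ℕ.* k ℕ.+ k)) ℕ./ 2)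

rhs4 : (d n : ℕ) → .{{NonZero d}} → Frac
rhs4 d n =
  (poch (Q d) (Q (2 ℕ.* d)) m ÷F poch (Q (d ℕ.+ 2)) (Q (2 ℕ.* d)) m)
  *F qint n
  *F (1F ÷F Q (((n ℕ.∸ 1) ℕ.* (d ℕ.∸ 1)) ℕ./ d ℕ./ 2))
  where
  Q : ℕ → Frac
  Q j = qF ^F j
  m : ℕ
  m = (n ℕ.∸ 1) ℕ./ d ℕ./ 2

modulus4 : ℕ → Poly2
modulus4 n =
  (embed₁ (cyclotomic n) *₂ (1₂ -₂ (av *₂ (qv ^₂ n)))) *₂ (av -₂ (qv ^₂ n))

{-# OPTIONS --safe #-}

-- Put p = qᵈ and n = 2dm + 1.  The summand is a term (1 − A p³ᵏ) tₖ of a quadratic basic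
-- hypergeometric series with A = q and parameters b = p/q, c = aq, e = q/a, where bce = Ap.
--
-- At a = q^{±n} one of c, e equals p⁻²ᵐ, and the two sides agree exactly: a contiguous relation
-- (c, e) ↦ (c/p², ep²), which telescopes in k, gives the quotient of the sums for m and m + 1.
-- Modulo Φₙ(q) we have A = p⁻²ᵐ, and another telescoping relation, A ↦ A/p², shows by induction
-- on m that the sum vanishes, as does [n].
--
-- For L = Φₙ, 1 − aqⁿ, a − qⁿ these evaluations take place in the ring of fractions whose
-- denominators are regular modulo L, with x/y = x′/y′ meaning L ∣ xy′ − x′y.  All denominators in
-- the statement are regular modulo each L, the three moduli are regular modulo one another, and an
-- element that is regular modulo P is coprime to P.  For Φₙ this rests on Φₙ ∣ qⁿ − 1 and on
-- Φₙ, qⁱ − 1 being comaximal when n ∤ i, which come from Π_{e ∣ n} Φₑ = qⁿ − 1.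

module Submission where

open import Defs hiding (_≈_)
open import Algebra using (CommutativeRing)
import Algebra.Properties.Semiring.Exp
open import Level using (0ℓ)
open import Data.Nat as ℕ using (ℕ; zero; suc; _≤_; _<_; z≤n; s≤s; NonZero)
import Data.Nat.Properties as ℕ
import Data.Nat.DivMod as ℕ
open import Data.Nat.Divisibility as ℕ∣ using () renaming (_∣_ to _∣ℕ_; _∣?_ to _∣ℕ?_)
open import Data.Nat.GCD using (gcd; gcd-GCD; gcd[m,n]∣m; gcd[m,n]∣n; module Bézout)
open import Data.Nat.Induction using (<-rec)
open import Data.Nat.Tactic.RingSolver using () renaming (solve-∀ to solveℕ-∀)
open import Data.Integer as ℤ using (ℤ; +_; -[1+_])
import Data.Integer.Properties as ℤ
open import Data.Integer.Tactic.RingSolver using (solve-∀)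
open import Data.Rational as ℚ using (ℚ; 0ℚ; 1ℚ)
import Data.Rational.Properties as ℚ
open import Data.List using (List; []; _∷_; _++_; [_]; length; reverse)
import Data.List.Properties as List
import Data.Maybe as Maybe
open import Data.Product using (∃; _×_; _,_; proj₁; proj₂)
open import Data.Sum using (inj₁; inj₂)
open import Relation.Nullary using (¬_; yes; no; contradiction)
open import Relation.Nullary.Decidable using (dec⇒maybe)
open import Relation.Binary using (tri<; tri≈; tri>; WeaklyDecidable)
open import Relation.Binary.PropositionalEquality as ≡ using (_≡_; _≢_)
open import Tactic.Cong using (cong!)

-- Algebra in an abstract commutative ring

-- The series is that of Rahman's quadratic summation, needed only where it terminates. Both
-- contiguous relations have one origin: the two neighbouring terms are, up to constants, polynomial
-- multiples of one auxiliary term u, with parameters chosen so that a fixed linear combination of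
-- the weighted multipliers is a multiple of N(k) - W(k). The boundary term N(M) u(M) is zero
-- because a numerator factor vanishes at some index ≤ M. The range 0, ..., M = 2m stays fixed while
-- the parameters move; terms past termination are simply zero.
--
-- Sequences are described by their first-order recurrence and not by a formula, so an induction
-- hypothesis applies to any sequence with the right ratio, and the summand of the statement has to
-- be recognised only once.
--
-- Regularity replaces irreducibility of Φₙ and unique factorisation in ℚ[q,a]: a denominator must
-- only be cancellable modulo L. It is easiest to see modulo a polynomial in q alone, by looking at
-- the constant term in a; moduli involving a are reached by exchanging the two members of a regular
-- sequence.

module IntegerSolver (R : CommutativeRing 0ℓ 0ℓ) where
  open CommutativeRing R
  open import Algebra.Properties.Ring ring
  open import Algebra.Properties.Semiring.Mult.TCOptimised semiring renaming (_×_ to _×ⁿ_)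
  open import Algebra.Solver.Ring.AlmostCommutativeRing
  open import Relation.Binary.Reasoning.Setoid setoid

  -- Integer coefficients are available over every commutative ring, whose own equality need not be
  -- decidable.
  fromℤ : ℤ → Carrier
  fromℤ (+ n) = n ×ⁿ 1#
  fromℤ (-[1+ n ]) = - (suc n ×ⁿ 1#)

  fromℤ-neg : ∀ i → fromℤ (ℤ.- i) ≈ - fromℤ i
  fromℤ-neg (+ zero) = sym -0#≈0#
  fromℤ-neg (+ suc n) = refl
  fromℤ-neg -[1+ n ] = sym (-‿involutive _)

  x+y-[x+z] : ∀ x y z → y - z ≈ (x + y) - (x + z)
  x+y-[x+z] x y z = begin
    y - z      ≈⟨ +-congʳ (sym (+-identityˡ y)) ⟩
    (0# + y) - z      ≈⟨ +-congʳ (+-congʳ (sym (-‿inverseˡ x))) ⟩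
    ((- x + x) + y) - z     ≈⟨ +-congʳ (+-assoc _ _ _) ⟩
    (- x + (x + y)) - z     ≈⟨ +-congʳ (+-comm _ _) ⟩
    ((x + y) - x) - z      ≈⟨ +-assoc _ _ _ ⟩
    (x + y) + (- x - z)     ≈⟨ +-congˡ (-‿+-comm x z) ⟩
    (x + y) - (x + z)       ∎

  fromℤ-⊖ : ∀ m n → fromℤ (m ℤ.⊖ n) ≈ (m ×ⁿ 1#) - (n ×ⁿ 1#)
  fromℤ-⊖ m zero = trans (sym (+-identityʳ _)) (+-congˡ (sym -0#≈0#))
  fromℤ-⊖ zero (suc n) = sym (+-identityˡ _)
  fromℤ-⊖ (suc m) (suc n) rewrite ℤ.[1+m]⊖[1+n]≡m⊖n m n =
    trans (fromℤ-⊖ m n) (trans (x+y-[x+z] 1# _ _) (sym (+-cong (1+× m 1#) (-‿cong (1+× n 1#)))))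

  fromℤ-+ : ∀ i j → fromℤ (i ℤ.+ j) ≈ fromℤ i + fromℤ j
  fromℤ-+ (+ m) (+ n) = ×-homo-+ 1# m n
  fromℤ-+ (+ m) -[1+ n ] = fromℤ-⊖ m (suc n)
  fromℤ-+ -[1+ m ] (+ n) = trans (fromℤ-⊖ n (suc m)) (+-comm _ _)
  fromℤ-+ -[1+ m ] -[1+ n ] = begin
    - (suc (suc (m ℕ.+ n)) ×ⁿ 1#)      ≡⟨ ≡.cong (λ k → - (suc k ×ⁿ 1#)) (≡.sym (ℕ.+-suc m n)) ⟩
    - ((suc m ℕ.+ suc n) ×ⁿ 1#)      ≈⟨ -‿cong (×-homo-+ 1# (suc m) (suc n)) ⟩
    - (suc m ×ⁿ 1# + suc n ×ⁿ 1#)      ≈⟨ sym (-‿+-comm _ _) ⟩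
    - (suc m ×ⁿ 1#) - (suc n ×ⁿ 1#)        ∎

  fromℤ-*⁺ : ∀ m j → fromℤ (+ m ℤ.* j) ≈ (m ×ⁿ 1#) * fromℤ j
  fromℤ-*⁺ m (+ n) rewrite ≡.sym (ℤ.pos-* m n) = ×1-homo-* m n
  fromℤ-*⁺ m -[1+ n ] rewrite ≡.sym (ℤ.neg-distribʳ-* (+ m) (+ suc n)) = begin
    fromℤ (ℤ.- (+ m ℤ.* + suc n))     ≈⟨ fromℤ-neg (+ m ℤ.* + suc n) ⟩
    - fromℤ (+ m ℤ.* + suc n)      ≈⟨ -‿cong (fromℤ-*⁺ m (+ suc n)) ⟩
    - ((m ×ⁿ 1#) * (suc n ×ⁿ 1#))      ≈⟨ -‿distribʳ-* _ _ ⟩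
    (m ×ⁿ 1#) * - (suc n ×ⁿ 1#)         ∎

  fromℤ-* : ∀ i j → fromℤ (i ℤ.* j) ≈ fromℤ i * fromℤ j
  fromℤ-* (+ m) j = fromℤ-*⁺ m j
  fromℤ-* -[1+ m ] j rewrite ≡.sym (ℤ.neg-distribˡ-* (+ suc m) j) = begin
    fromℤ (ℤ.- (+ suc m ℤ.* j))      ≈⟨ fromℤ-neg (+ suc m ℤ.* j) ⟩
    - fromℤ (+ suc m ℤ.* j)      ≈⟨ -‿cong (fromℤ-*⁺ (suc m) j) ⟩
    - ((suc m ×ⁿ 1#) * fromℤ j)      ≈⟨ -‿distribˡ-* _ _ ⟩
    - (suc m ×ⁿ 1#) * fromℤ j          ∎

  morphism : ℤ.+-*-rawRing -Raw-AlmostCommutative⟶ fromCommutativeRing R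
  morphism = record
    { ⟦_⟧ = fromℤ
    ; +-homo = fromℤ-+
    ; *-homo = fromℤ-*
    ; -‿homo = fromℤ-neg
    ; 0-homo = refl
    ; 1-homo = refl
    }

  coefficient≟ : WeaklyDecidable (Induced-equivalence morphism)
  coefficient≟ i j = Maybe.map (λ i≡j → reflexive (≡.cong fromℤ i≡j)) (dec⇒maybe (i ℤ.≟ j))

  open import Algebra.Solver.Ring ℤ.+-*-rawRing (fromCommutativeRing R) morphism coefficient≟ public
    using (solve; _:=_; _:+_; _:*_; _:-_; :-_; con)

-- Units, finite sums and hypergeometric terms

module Units (R : CommutativeRing 0ℓ 0ℓ) where
  open CommutativeRing R
  open IntegerSolver R
  open import Relation.Binary.Reasoning.Setoid setoid

  Unit : Carrier → Set
  Unit x = ∃ λ y → x * y ≈ 1#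

  unit-cong : ∀ {x y} → x ≈ y → Unit x → Unit y
  unit-cong x≈y (z , xz≈1) = z , trans (*-congʳ (sym x≈y)) xz≈1

  unit-* : ∀ {x y} → Unit x → Unit y → Unit (x * y)
  unit-* {x} {y} (u , xu≈1) (v , yv≈1) = u * v , (begin
    x * y * (u * v)    ≈⟨ solve 4 (λ x y u v → x :* y :* (u :* v) := x :* u :* (y :* v)) refl x y u v ⟩
    x * u * (y * v)    ≈⟨ *-cong xu≈1 yv≈1 ⟩
    1# * 1#      ≈⟨ *-identityˡ 1# ⟩
    1#                 ∎)

  cancel : ∀ {x y z} → Unit x → x * y ≈ x * z → y ≈ z
  cancel {x} {y} {z} (u , xu≈1) xy≈xz = begin
    y      ≈⟨ *-identityˡ y ⟨
    1# * y      ≈⟨ *-congʳ xu≈1 ⟨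
    x * u * y      ≈⟨ solve 3 (λ x u y → x :* u :* y := u :* (x :* y)) refl x u y ⟩
    u * (x * y)    ≈⟨ *-congˡ xy≈xz ⟩
    u * (x * z)    ≈⟨ solve 3 (λ x u y → x :* u :* y := u :* (x :* y)) refl x u z ⟨
    x * u * z      ≈⟨ *-congʳ xu≈1 ⟩
    1# * z      ≈⟨ *-identityˡ z ⟩
    z              ∎

  cancel-zero : ∀ {x y} → Unit x → x * y ≈ 0# → y ≈ 0#
  cancel-zero ux xy≈0 = cancel ux (trans xy≈0 (sym (zeroʳ _)))

  sum : (ℕ → Carrier) → ℕ → Carrier
  sum f zero = f 0
  sum f (suc n) = sum f n + f (suc n)

  sum-cong : ∀ {f g} n → (∀ k → k ≤ n → f k ≈ g k) → sum f n ≈ sum g n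
  sum-cong zero f≈g = f≈g 0 z≤n
  sum-cong (suc n) f≈g =
    +-cong (sum-cong n (λ k k≤n → f≈g k (ℕ.m≤n⇒m≤1+n k≤n))) (f≈g (suc n) ℕ.≤-refl)

  sum-+ : ∀ f g n → sum (λ k → f k + g k) n ≈ sum f n + sum g n
  sum-+ f g zero = refl
  sum-+ f g (suc n) = trans (+-congʳ (sum-+ f g n))
    (solve 4 (λ a b c d → a :+ b :+ (c :+ d) := a :+ c :+ (b :+ d)) refl _ _ _ _)

  sum-* : ∀ c f n → sum (λ k → c * f k) n ≈ c * sum f n
  sum-* c f zero = refl
  sum-* c f (suc n) = trans (+-congʳ (sum-* c f n)) (sym (distribˡ _ _ _))

  sum-tail-zero : ∀ f n → (∀ k → k < n → f (suc k) ≈ 0#) → sum f n ≈ f 0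
  sum-tail-zero f zero _ = refl
  sum-tail-zero f (suc n) h =
    trans (+-cong (sum-tail-zero f n (λ k k<n → h k (ℕ.m<n⇒m<1+n k<n))) (h n ℕ.≤-refl)) (+-identityʳ _)

  -- Each summand is the difference of U(k) u(k) and its predecessor U(k - 1) u(k - 1); `W 0 ≈ 0#`
  -- accounts for the missing predecessor at k = 0.
  telescope : ∀ (U W u : ℕ → Carrier) M → W 0 ≈ 0# →
    (∀ k → k < M → W (suc k) * u (suc k) ≈ U k * u k) →
    sum (λ k → (U k - W k) * u k) M ≈ U M * u M
  telescope U W u zero W0≈0 _ = begin
    (U 0 - W 0) * u 0      ≈⟨ *-congʳ (+-congˡ (-‿cong W0≈0)) ⟩
    (U 0 - 0#) * u 0      ≈⟨ solve 2 (λ a b → (a :- con (+ 0)) :* b := a :* b) refl _ _ ⟩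
    U 0 * u 0              ∎
  telescope U W u (suc M) W0≈0 step = begin
    sum (λ k → (U k - W k) * u k) M + (U (suc M) - W (suc M)) * u (suc M)
      ≈⟨ +-congʳ (telescope U W u M W0≈0 (λ k k<M → step k (ℕ.m<n⇒m<1+n k<M))) ⟩
    U M * u M + (U (suc M) - W (suc M)) * u (suc M)
      ≈⟨ +-congʳ (step M ℕ.≤-refl) ⟨
    W (suc M) * u (suc M) + (U (suc M) - W (suc M)) * u (suc M)
      ≈⟨ solve 3 (λ w U u → w :* u :+ (U :- w) :* u := U :* u) refl _ _ _ ⟩
    U (suc M) * u (suc M) ∎

  -- The recurrence is cross-multiplied and stops at `M`, so that nothing is asked of the
  -- denominators beyond the range of summation.
  record Hypergeometric (N D : ℕ → Carrier) (M : ℕ) (t : ℕ → Carrier) : Set where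
    field
      initial : t 0 ≈ 1#
      ratio : ∀ k → k < M → D k * t (suc k) ≈ N k * t k
  open Hypergeometric public

  hypergeometric : ∀ N D M → (∀ k → k < M → Unit (D k)) → ∃ (Hypergeometric N D M)
  hypergeometric N D M unit = t , record { initial = refl ; ratio = ratio′ }
    where
    D⁻¹ : ℕ → Carrier
    D⁻¹ k with k ℕ.<? M
    ... | yes k<M = proj₁ (unit k k<M)
    -- Beyond the range `D k` need not be invertible; the recurrence never reads this value.
    ... | no _ = 0#
    t : ℕ → Carrier
    t zero = 1#
    t (suc k) = D⁻¹ k * (N k * t k)
    ratio′ : ∀ k → k < M → D k * t (suc k) ≈ N k * t k
    ratio′ k k<M with k ℕ.<? M
    ... | yes k<M′ = trans (sym (*-assoc _ _ _)) (trans (*-congʳ (proj₂ (unit k k<M′))) (*-identityˡ _))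
    ... | no k≮M = contradiction k<M k≮M

  -- The last hypothesis says that g(k + 1)/g(k) is the term ratio of `t` over that of `u`. It is
  -- free of quotients because `N` and `g` may vanish: the terms in question terminate.
  compare : ∀ {N D N′ D′ M u t} (g : ℕ → Carrier) →
    Hypergeometric N D M u → Hypergeometric N′ D′ M t →
    (∀ k → k < M → Unit (D k)) → (∀ k → k < M → Unit (D′ k)) →
    (∀ k → g (suc k) * N k * D′ k ≈ g k * N′ k * D k) →
    ∀ k → k ≤ M → g 0 * t k ≈ g k * u k
  compare g hu ht uD uD′ cross zero _ = *-congˡ (trans (initial ht) (sym (initial hu)))
  compare {N} {D} {N′} {D′} {M} {u} {t} g hu ht uD uD′ cross (suc k) k<M =
    cancel (unit-* (uD k k<M) (uD′ k k<M)) (begin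
      D k * D′ k * (g 0 * t (suc k))
        ≈⟨ solve 4 (λ D E g t → D :* E :* (g :* t) := D :* g :* (E :* t)) refl _ _ _ _ ⟩
      D k * g 0 * (D′ k * t (suc k))
        ≈⟨ *-congˡ (ratio ht k k<M) ⟩
      D k * g 0 * (N′ k * t k)
        ≈⟨ solve 4 (λ D g N t → D :* g :* (N :* t) := D :* N :* (g :* t)) refl _ _ _ _ ⟩
      D k * N′ k * (g 0 * t k)
        ≈⟨ *-congˡ (compare g hu ht uD uD′ cross k (ℕ.<⇒≤ k<M)) ⟩
      D k * N′ k * (g k * u k)
        ≈⟨ solve 4 (λ D N g u → D :* N :* (g :* u) := g :* N :* D :* u) refl _ _ _ _ ⟩
      g k * N′ k * D k * u k
        ≈⟨ *-congʳ (cross k) ⟨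
      g (suc k) * N k * D′ k * u k
        ≈⟨ solve 4 (λ g N D u → g :* N :* D :* u := g :* D :* (N :* u)) refl _ _ _ _ ⟩
      g (suc k) * D′ k * (N k * u k)
        ≈⟨ *-congˡ (ratio hu k k<M) ⟨
      g (suc k) * D′ k * (D k * u (suc k))
        ≈⟨ solve 4 (λ D E g t → g :* E :* (D :* t) := D :* E :* (g :* t)) refl _ _ _ _ ⟩
      D k * D′ k * (g (suc k) * u (suc k)) ∎)

  vanish : ∀ {N D M u} → Hypergeometric N D M u → (∀ k → k < M → Unit (D k)) →
    ∀ r → N r ≈ 0# → ∀ k → k ≤ M → r < k → u k ≈ 0#
  vanish hu uD r Nr≈0 (suc k) k<M (s≤s r≤k) with ℕ.m≤n⇒m<n∨m≡n r≤k
  ... | inj₁ r<k = cancel-zero (uD k k<M) (trans (ratio hu k k<M)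
                     (trans (*-congˡ (vanish hu uD r Nr≈0 k (ℕ.<⇒≤ k<M) r<k)) (zeroʳ _)))
  ... | inj₂ ≡.refl = cancel-zero (uD k k<M) (trans (ratio hu k k<M)
                     (trans (*-congʳ Nr≈0) (zeroˡ _)))

  -- This disposes of the boundary term of `telescope`: a zero of `N` before `M` has already killed
  -- `u M`, and one at `M` is the factor `N M` itself.
  vanish-last : ∀ {N D M u} → Hypergeometric N D M u → (∀ k → k < M → Unit (D k)) →
    ∀ r → r ≤ M → N r ≈ 0# → N M * u M ≈ 0#
  vanish-last {M = M} hu uD r r≤M Nr≈0 with ℕ.m≤n⇒m<n∨m≡n r≤M
  ... | inj₁ r<M = trans (*-congˡ (vanish hu uD r Nr≈0 M ℕ.≤-refl r<M)) (zeroʳ _)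
  ... | inj₂ ≡.refl = trans (*-congʳ Nr≈0) (zeroˡ _)

-- Contiguous relations for the quadratic series

module Quadratic (R : CommutativeRing 0ℓ 0ℓ) (p : CommutativeRing.Carrier R) where
  open CommutativeRing R
  open IntegerSolver R
  open Units R
  open import Relation.Binary.Reasoning.Setoid setoid

  open import Algebra.Properties.Semiring.Exp semiring using (_^_)

  K : ℕ → Carrier
  K k = p ^ k

  -- The factors 1 − x pᵏ and 1 − x p²ᵏ of (x ; p) and (x ; p²).
  lin quad : Carrier → ℕ → Carrier
  lin x k = 1# - x * K k
  quad x k = 1# - x * (K k * K k)

  lin-suc : ∀ x k → lin x (suc k) ≈ lin (x * p) k
  lin-suc x k = +-congˡ (-‿cong (sym (*-assoc _ _ _)))

  quad-suc : ∀ x k → quad x (suc k) ≈ quad (x * (p * p)) k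
  quad-suc x k = solve 3 (λ x p K → con (+ 1) :- x :* (p :* K :* (p :* K)) := con (+ 1) :- x :* (p :* p) :* (K :* K)) refl x p (K k)

  lin-cong : ∀ {x y} k → x ≈ y → lin x k ≈ lin y k
  lin-cong k x≈y = +-congˡ (-‿cong (*-congʳ x≈y))

  quad-cong : ∀ {x y} k → x ≈ y → quad x k ≈ quad y k
  quad-cong k x≈y = +-congˡ (-‿cong (*-congʳ x≈y))

  -- `numer` over `denom` is the term ratio of (A; p²)ₖ (b, c, e; p)ₖ p^(k(k+1)/2) / ((p; p)ₖ (x, y,
  -- z; p²)ₖ); the factor `p * K k` comes from the power of p. In the series proper x, y, z are
  -- Ap²/b, Ap²/c, Ap²/e in some order.
  numer : (A b c e : Carrier) → ℕ → Carrier
  numer A b c e k = p * K k * quad A k * lin b k * lin c k * lin e k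

  denom : (x y z : Carrier) → ℕ → Carrier
  denom x y z k = lin p k * quad x k * quad y k * quad z k

  weight : Carrier → ℕ → Carrier
  weight A k = 1# - A * (K k * (K k * K k))

  denom-unit : ∀ {x y z} k → Unit (lin p k) → Unit (quad x k) → Unit (quad y k) → Unit (quad z k) →
    Unit (denom x y z k)
  denom-unit k up ux uy uz = unit-* (unit-* (unit-* up ux) uy) uz

  vanishing-lin : ∀ {A b c e} k → (lin c k ≈ 0#) → numer A b c e k ≈ 0#
  vanishing-lin k h = trans (*-congʳ (*-congˡ h))
    (solve 2 (λ a b → a :* con (+ 0) :* b := con (+ 0)) refl _ _)

  vanishing-quad : ∀ {A b c e} k → (quad A k ≈ 0#) → numer A b c e k ≈ 0#
  vanishing-quad k h = trans (*-congʳ (*-congʳ (*-congʳ (*-congˡ h))))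
    (solve 4 (λ a b c d → a :* con (+ 0) :* b :* c :* d := con (+ 0)) refl _ _ _ _)

  -- Zeilberger certificates: with K = pᵏ, both right-hand sides are multiples of N(k) − W(k), where
  -- the auxiliary sequence u of the modules below satisfies N(k) u(k) = W(k + 1) u(k + 1).
  contiguous-id : ∀ b s e K →
    (s - 1#) * ((1# - b * s * e * p * (K * (K * K))) * ((1# - e * K) * (1# - e * p * K) * (1# - b * s * p * (K * K))))
    + (1# - e) * ((1# - b * s * e * p * (K * (K * K))) * ((1# - s * K) * (1# - s * p * K) * (1# - b * e * p * (K * K))))
    ≈ (e - s) * (p * K * (1# - b * s * e * p * (K * K)) * (1# - b * K) * (1# - s * K) * (1# - e * K)
        - (1# - K) * (1# - s * e * p * (K * K)) * (1# - b * e * p * (K * K)) * (1# - b * s * p * (K * K)))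
  contiguous-id b s e K = solve 5 (λ b s e p K → let one = con (+ 1) in
    (s :- one) :* ((one :- b :* s :* e :* p :* (K :* (K :* K))) :* ((one :- e :* K) :* (one :- e :* p :* K) :* (one :- b :* s :* p :* (K :* K))))
    :+ (one :- e) :* ((one :- b :* s :* e :* p :* (K :* (K :* K))) :* ((one :- s :* K) :* (one :- s :* p :* K) :* (one :- b :* e :* p :* (K :* K))))
    := (e :- s) :* (p :* K :* (one :- b :* s :* e :* p :* (K :* K)) :* (one :- b :* K) :* (one :- s :* K) :* (one :- e :* K)
        :- (one :- K) :* (one :- s :* e :* p :* (K :* K)) :* (one :- b :* e :* p :* (K :* K)) :* (one :- b :* s :* p :* (K :* K)))) refl b s e p K

  contiguous-id′ : ∀ b s e K →
    (1# - b * s * e * (p * p) * (K * (K * K))) * ((1# - b * s * e * (K * K)) * (1# - e * K) * (1# - e * p * K))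
    + (e - 1#) * ((1# - b * s * e * (K * (K * K))) * ((1# - s * e * (p * p) * (K * K)) * (1# - b * e * p * (K * K))))
    ≈ - e * (p * K * (1# - b * s * e * (K * K)) * (1# - b * K) * (1# - s * p * K) * (1# - e * K)
      - (1# - K) * (1# - s * e * (p * p) * (K * K)) * (1# - b * e * p * (K * K)) * (1# - b * s * (K * K)))
  contiguous-id′ b s e K = solve 5 (λ b s e p K → let one = con (+ 1) in
    (one :- b :* s :* e :* (p :* p) :* (K :* (K :* K))) :* ((one :- b :* s :* e :* (K :* K)) :* (one :- e :* K) :* (one :- e :* p :* K))
    :+ (e :- one) :* ((one :- b :* s :* e :* (K :* (K :* K))) :* ((one :- s :* e :* (p :* p) :* (K :* K)) :* (one :- b :* e :* p :* (K :* K))))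
    := :- e :* (p :* K :* (one :- b :* s :* e :* (K :* K)) :* (one :- b :* K) :* (one :- s :* p :* K) :* (one :- e :* K)
      :- (one :- K) :* (one :- s :* e :* (p :* p) :* (K :* K)) :* (one :- b :* e :* p :* (K :* K)) :* (one :- b :* s :* (K :* K)))) refl b s e p K

  numer-cong : ∀ {A b c e A′ b′ c′ e′} → A ≈ A′ → b ≈ b′ → c ≈ c′ → e ≈ e′ →
    ∀ k → numer A b c e k ≈ numer A′ b′ c′ e′ k
  numer-cong hA hb hc he k =
    *-cong (*-cong (*-cong (*-congˡ (quad-cong k hA)) (lin-cong k hb)) (lin-cong k hc)) (lin-cong k he)

  denom-cong : ∀ {x y z x′ y′ z′} → x ≈ x′ → y ≈ y′ → z ≈ z′ →
    ∀ k → denom x y z k ≈ denom x′ y′ z′ k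
  denom-cong hx hy hz k = *-cong (*-cong (*-congˡ (quad-cong k hx)) (quad-cong k hy)) (quad-cong k hz)

  hyper-cong : ∀ {N D N′ D′ M t} → (∀ k → N k ≈ N′ k) → (∀ k → D k ≈ D′ k) →
    Hypergeometric N D M t → Hypergeometric N′ D′ M t
  hyper-cong hN hD ht = record
    { initial = initial ht
    ; ratio = λ k k<M → trans (*-congʳ (sym (hD k))) (trans (ratio ht k k<M) (*-congʳ (hN k))) }

  total : Carrier → (ℕ → Carrier) → ℕ → Carrier
  total A t = sum (λ k → weight A k * t k)

  sum-compare : ∀ A c (g t u : ℕ → Carrier) M → (∀ k → k ≤ M → c * t k ≈ g k * u k) →
    sum (λ k → weight A k * g k * u k) M ≈ c * total A t M
  sum-compare A c g t u M h = trans (sum-cong M (λ k k≤M → begin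
      weight A k * g k * u k      ≈⟨ *-assoc _ _ _ ⟩
      weight A k * (g k * u k)    ≈⟨ *-congˡ (h k k≤M) ⟨
      weight A k * (c * t k)      ≈⟨ solve 3 (λ w c t → w :* (c :* t) := c :* (w :* t)) refl _ _ _ ⟩
      c * (weight A k * t k)      ∎))
    (sum-* c _ M)

  module Contiguous (b s e : Carrier) (M : ℕ) where

    A fb : Carrier
    A = b * s * e * p
    fb = s * e * p * (p * p)

    -- The auxiliary term (`N`, `D`) has parameters b, s, e with bse = A/p. Multiplying s or e by p²
    -- restores the balance bce = Ap and gives the two series to be related; `g₁` and `g₂` are the
    -- multipliers that lead from the auxiliary term to them.
    N D N₁ D₁ N₂ D₂ : ℕ → Carrier
    N = numer A b s e
    D = denom fb (b * e * p * (p * p)) (b * s * p * (p * p))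
    N₁ = numer A b (s * (p * p)) e
    D₁ = denom fb (b * e * p) (b * s * p * (p * p))
    N₂ = numer A b s (e * (p * p))
    D₂ = denom fb (b * e * p * (p * p)) (b * s * p)

    g₁ g₂ : ℕ → Carrier
    g₁ k = lin s k * lin (s * p) k * quad (b * e * p) k
    g₂ k = lin e k * lin (e * p) k * quad (b * s * p) k

    cross₁ : ∀ k → g₁ (suc k) * N k * D₁ k ≈ g₁ k * N₁ k * D k
    cross₁ k = begin
      g₁ (suc k) * N k * D₁ k
        ≈⟨ *-congʳ (*-congʳ (*-cong (*-cong (lin-suc s k)
             (trans (lin-suc (s * p) k) (lin-cong k (*-assoc _ _ _)))) (quad-suc (b * e * p) k))) ⟩
      lin (s * p) k * lin (s * (p * p)) k * quad (b * e * p * (p * p)) k * N k * D₁ k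
        ≈⟨ solve 12 (λ pK s₀ s₁ s₂ f x y z A b e l →
             s₁ :* s₂ :* x :* (pK :* A :* b :* s₀ :* e) :* (l :* f :* y :* z)
             := s₀ :* s₁ :* y :* (pK :* A :* b :* s₂ :* e) :* (l :* f :* x :* z)) refl
             (p * K k) (lin s k) (lin (s * p) k) (lin (s * (p * p)) k) (quad fb k)
             (quad (b * e * p * (p * p)) k) (quad (b * e * p) k) (quad (b * s * p * (p * p)) k)
             (quad A k) (lin b k) (lin e k) (lin p k) ⟩
      g₁ k * N₁ k * D k ∎

    cross₂ : ∀ k → g₂ (suc k) * N k * D₂ k ≈ g₂ k * N₂ k * D k
    cross₂ k = begin
      g₂ (suc k) * N k * D₂ k
        ≈⟨ *-congʳ (*-congʳ (*-cong (*-cong (lin-suc e k)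
             (trans (lin-suc (e * p) k) (lin-cong k (*-assoc _ _ _)))) (quad-suc (b * s * p) k))) ⟩
      lin (e * p) k * lin (e * (p * p)) k * quad (b * s * p * (p * p)) k * N k * D₂ k
        ≈⟨ solve 12 (λ pK s₀ s₁ s₂ f x y z A b e l →
             s₁ :* s₂ :* x :* (pK :* A :* b :* e :* s₀) :* (l :* f :* z :* y)
             := s₀ :* s₁ :* y :* (pK :* A :* b :* e :* s₂) :* (l :* f :* z :* x)) refl
             (p * K k) (lin e k) (lin (e * p) k) (lin (e * (p * p)) k) (quad fb k)
             (quad (b * s * p * (p * p)) k) (quad (b * s * p) k) (quad (b * e * p * (p * p)) k)
             (quad A k) (lin b k) (lin s k) (lin p k) ⟩
      g₂ k * N₂ k * D k ∎

    W : ℕ → Carrier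
    W k = (1# - K k) * quad (s * e * p) k * quad (b * e * p) k * quad (b * s * p) k

    -- Passing from pᵏ to pᵏ⁺¹ turns 1 - pᵏ into the factor of (p; p) and multiplies each quadratic
    -- parameter by p².
    W-suc : ∀ k → W (suc k) ≈ D k
    W-suc k = *-cong (*-cong (*-congˡ (quad-suc _ k)) (quad-suc _ k)) (quad-suc _ k)

    -- Summing `contiguous-id` against the auxiliary term leaves only N(M) u(M), which is zero
    -- because s pʳ = 1. Both products that remain contain (1 - s)(1 - e), which is cancelled.
    contiguous : ∀ {t₁ t₂} → Hypergeometric N₁ D₁ M t₁ → Hypergeometric N₂ D₂ M t₂ →
      (∀ k → k < M → Unit (D k)) → (∀ k → k < M → Unit (D₁ k)) → (∀ k → k < M → Unit (D₂ k)) →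
      ∀ r → r ≤ M → lin s r ≈ 0# → Unit (1# - s) → Unit (1# - e) →
      (1# - e * p) * (1# - b * s * p) * total A t₂ M ≈ (1# - s * p) * (1# - b * e * p) * total A t₁ M
    contiguous {t₁} {t₂} h₁ h₂ uD uD₁ uD₂ r r≤M sr≈0 us ue = cancel (unit-* us ue) (begin
      (1# - s) * (1# - e) * ((1# - e * p) * (1# - b * s * p) * total A t₂ M)
        -- The factors `one` after s, e and their multiples are the values of `K 0`: they make the
        -- expressions agree with `g₁ 0` and `g₂ 0` as these unfold.
        ≈⟨ solve 6 (λ b s e p x y → let one = con (+ 1) in
             (one :- s) :* (one :- e) :* ((one :- e :* p) :* (one :- b :* s :* p) :* x)
             := (one :- s) :* (one :- e) :* ((one :- s :* p) :* (one :- b :* e :* p) :* y)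
                :- ((s :- one) :* ((one :- e :* one) :* (one :- e :* p :* one) :* (one :- b :* s :* p :* (one :* one)) :* x)
                   :+ (one :- e) :* ((one :- s :* one) :* (one :- s :* p :* one) :* (one :- b :* e :* p :* (one :* one)) :* y)))
             refl b s e p _ _ ⟩
      (1# - s) * (1# - e) * ((1# - s * p) * (1# - b * e * p) * total A t₁ M)
        - ((s - 1#) * (g₂ 0 * total A t₂ M) + (1# - e) * (g₁ 0 * total A t₁ M))
        ≈⟨ +-congˡ (-‿cong vanishes) ⟩
      (1# - s) * (1# - e) * ((1# - s * p) * (1# - b * e * p) * total A t₁ M) - 0#
        ≈⟨ solve 1 (λ x → x :- con (+ 0) := x) refl _ ⟩
      (1# - s) * (1# - e) * ((1# - s * p) * (1# - b * e * p) * total A t₁ M) ∎)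
      where
      u : ℕ → Carrier
      u = proj₁ (hypergeometric N D M uD)
      hu : Hypergeometric N D M u
      hu = proj₂ (hypergeometric N D M uD)

      vanishes : (s - 1#) * (g₂ 0 * total A t₂ M) + (1# - e) * (g₁ 0 * total A t₁ M) ≈ 0#
      vanishes = begin
        (s - 1#) * (g₂ 0 * total A t₂ M) + (1# - e) * (g₁ 0 * total A t₁ M)
          ≈⟨ +-cong
               (*-congˡ (sum-compare A (g₂ 0) g₂ t₂ u M (compare g₂ hu h₂ uD uD₂ cross₂)))
               (*-congˡ (sum-compare A (g₁ 0) g₁ t₁ u M (compare g₁ hu h₁ uD uD₁ cross₁))) ⟨
        (s - 1#) * sum (λ k → weight A k * g₂ k * u k) M + (1# - e) * sum (λ k → weight A k * g₁ k * u k) M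
          ≈⟨ +-cong (sum-* _ _ M) (sum-* _ _ M) ⟨
        sum (λ k → (s - 1#) * (weight A k * g₂ k * u k)) M + sum (λ k → (1# - e) * (weight A k * g₁ k * u k)) M
          ≈⟨ sum-+ _ _ M ⟨
        sum (λ k → (s - 1#) * (weight A k * g₂ k * u k) + (1# - e) * (weight A k * g₁ k * u k)) M
          ≈⟨ sum-cong M (λ k _ → begin
               (s - 1#) * (weight A k * g₂ k * u k) + (1# - e) * (weight A k * g₁ k * u k)
                 ≈⟨ solve 5 (λ α β x y u → α :* (x :* u) :+ β :* (y :* u) := (α :* x :+ β :* y) :* u) refl _ _ _ _ _ ⟩
               ((s - 1#) * (weight A k * g₂ k) + (1# - e) * (weight A k * g₁ k)) * u k
                 ≈⟨ *-congʳ (contiguous-id b s e (K k)) ⟩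
               (e - s) * (N k - W k) * u k
                 ≈⟨ *-assoc _ _ _ ⟩
               (e - s) * ((N k - W k) * u k) ∎) ⟩
        sum (λ k → (e - s) * ((N k - W k) * u k)) M
          ≈⟨ sum-* _ _ M ⟩
        (e - s) * sum (λ k → (N k - W k) * u k) M
          ≈⟨ *-congˡ (telescope N W u M W0≈0 (λ k k<M → trans (*-congʳ (W-suc k)) (ratio hu k k<M))) ⟩
        (e - s) * (N M * u M)
          ≈⟨ *-congˡ (vanish-last hu uD r r≤M (vanishing-lin r sr≈0)) ⟩
        (e - s) * 0#
          ≈⟨ zeroʳ _ ⟩
        0# ∎
        where
        W0≈0 : W 0 ≈ 0#
        W0≈0 = solve 3 (λ x y z → (con (+ 1) :- con (+ 1)) :* x :* y :* z := con (+ 0)) refl _ _ _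

  module Contiguous′ (b s e : Carrier) (M : ℕ) where

    c A fb fc fe : Carrier
    c = s * p
    A = b * s * e
    fb = s * e * (p * p)
    fc = b * e * p
    fe = b * s * (p * p)

    -- The balance bce = Ap holds here from the start; writing c as sp expresses A without a
    -- division. The auxiliary term takes its numerator from the series for A and its denominator
    -- from the series for Ap², whose other parameters are b, c and ep².
    N D D₁ N₂ : ℕ → Carrier
    N = numer A b c e
    D = denom (fb * (p * p)) (fc * (p * p)) fe
    D₁ = denom fb fc fe
    N₂ = numer (A * (p * p)) b c (e * (p * p))

    g₁ g₂ : ℕ → Carrier
    g₁ k = quad fb k * quad fc k
    g₂ k = quad A k * lin e k * lin (e * p) k

    cross₁ : ∀ k → g₁ (suc k) * N k * D₁ k ≈ g₁ k * N k * D k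
    cross₁ k = begin
      g₁ (suc k) * N k * D₁ k
        ≈⟨ *-congʳ (*-congʳ (*-cong (quad-suc fb k) (quad-suc fc k))) ⟩
      quad (fb * (p * p)) k * quad (fc * (p * p)) k * N k * D₁ k
        ≈⟨ solve 7 (λ x y N l f g h →
             x :* y :* N :* (l :* f :* g :* h) := f :* g :* N :* (l :* x :* y :* h)) refl
             (quad (fb * (p * p)) k) (quad (fc * (p * p)) k) (N k) (lin p k) (quad fb k) (quad fc k) (quad fe k) ⟩
      g₁ k * N k * D k ∎

    cross₂ : ∀ k → g₂ (suc k) * N k * D k ≈ g₂ k * N₂ k * D k
    cross₂ k = *-congʳ (begin
      g₂ (suc k) * N k
        ≈⟨ *-congʳ (*-cong (*-cong (quad-suc A k) (lin-suc e k))
             (trans (lin-suc (e * p) k) (lin-cong k (*-assoc _ _ _)))) ⟩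
      quad (A * (p * p)) k * lin (e * p) k * lin (e * (p * p)) k * N k
        ≈⟨ solve 8 (λ A₁ A₀ e₀ e₁ e₂ pK b c →
             A₁ :* e₁ :* e₂ :* (pK :* A₀ :* b :* c :* e₀) := A₀ :* e₀ :* e₁ :* (pK :* A₁ :* b :* c :* e₂)) refl
             (quad (A * (p * p)) k) (quad A k) (lin e k) (lin (e * p) k) (lin (e * (p * p)) k) (p * K k) (lin b k) (lin c k) ⟩
      g₂ k * N₂ k ∎)

    W : ℕ → Carrier
    W k = (1# - K k) * quad fb k * quad fc k * quad (b * s) k

    W-suc : ∀ k → W (suc k) ≈ D k
    W-suc k = *-cong (*-cong (*-congˡ (quad-suc _ k)) (quad-suc _ k)) (quad-suc _ k)

    -- The certificate combines the two sums with coefficients 1 and e - 1, and A p²ʳ = 1 removes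
    -- the boundary term. So if the sum for Ap² is zero, only (e - 1) g₁(0) times the sum for A
    -- remains.
    contiguous : ∀ {t₁ t₂} → Hypergeometric N D₁ M t₁ → Hypergeometric N₂ D M t₂ →
      (∀ k → k < M → Unit (D k)) → (∀ k → k < M → Unit (D₁ k)) →
      ∀ r → r ≤ M → quad A r ≈ 0# → Unit (e - 1#) → Unit (g₁ 0) →
      total (A * (p * p)) t₂ M ≈ 0# → total A t₁ M ≈ 0#
    contiguous {t₁} {t₂} h₁ h₂ uD uD₁ r r≤M Ar≈0 ue ug S₂≈0 = cancel-zero (unit-* ue ug) (begin
      (e - 1#) * g₁ 0 * total A t₁ M
        ≈⟨ solve 4 (λ α g x y → α :* g :* x := y :* con (+ 0) :+ α :* (g :* x)) refl _ _ _ (g₂ 0) ⟩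
      g₂ 0 * 0# + (e - 1#) * (g₁ 0 * total A t₁ M)
        ≈⟨ +-congʳ (*-congˡ S₂≈0) ⟨
      g₂ 0 * total (A * (p * p)) t₂ M + (e - 1#) * (g₁ 0 * total A t₁ M)
        ≈⟨ +-cong
             (sum-compare (A * (p * p)) (g₂ 0) g₂ t₂ u M (compare g₂ hu h₂ uD uD cross₂))
             (*-congˡ (sum-compare A (g₁ 0) g₁ t₁ u M (compare g₁ hu h₁ uD uD₁ cross₁))) ⟨
      sum (λ k → weight (A * (p * p)) k * g₂ k * u k) M + (e - 1#) * sum (λ k → weight A k * g₁ k * u k) M
        ≈⟨ +-congˡ (sum-* _ _ M) ⟨
      sum (λ k → weight (A * (p * p)) k * g₂ k * u k) M + sum (λ k → (e - 1#) * (weight A k * g₁ k * u k)) M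
        ≈⟨ sum-+ _ _ M ⟨
      sum (λ k → weight (A * (p * p)) k * g₂ k * u k + (e - 1#) * (weight A k * g₁ k * u k)) M
        ≈⟨ sum-cong M (λ k _ → begin
             weight (A * (p * p)) k * g₂ k * u k + (e - 1#) * (weight A k * g₁ k * u k)
               ≈⟨ solve 4 (λ β x y u → x :* u :+ β :* (y :* u) := (x :+ β :* y) :* u) refl _ _ _ _ ⟩
             (weight (A * (p * p)) k * g₂ k + (e - 1#) * (weight A k * g₁ k)) * u k
               ≈⟨ *-congʳ (contiguous-id′ b s e (K k)) ⟩
             - e * (N k - W k) * u k
               ≈⟨ *-assoc _ _ _ ⟩
             - e * ((N k - W k) * u k) ∎) ⟩
      sum (λ k → - e * ((N k - W k) * u k)) M
        ≈⟨ sum-* _ _ M ⟩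
      - e * sum (λ k → (N k - W k) * u k) M
        ≈⟨ *-congˡ (telescope N W u M W0≈0 (λ k k<M → trans (*-congʳ (W-suc k)) (ratio hu k k<M))) ⟩
      - e * (N M * u M)
        ≈⟨ *-congˡ (vanish-last hu uD r r≤M (vanishing-quad r Ar≈0)) ⟩
      - e * 0#
        ≈⟨ zeroʳ _ ⟩
      0# ∎)
      where
      u : ℕ → Carrier
      u = proj₁ (hypergeometric N D M uD)
      hu : Hypergeometric N D M u
      hu = proj₂ (hypergeometric N D M uD)
      W0≈0 : W 0 ≈ 0#
      W0≈0 = solve 3 (λ x y z → (con (+ 1) :- con (+ 1)) :* x :* y :* z := con (+ 0)) refl _ _ _

-- Evaluation of the sums at powers of q

module IntegerPowers (R : CommutativeRing 0ℓ 0ℓ) (q q⁻ : CommutativeRing.Carrier R)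
  (qq⁻≈1 : CommutativeRing._≈_ R (CommutativeRing._*_ R q q⁻) (CommutativeRing.1# R)) where
  open CommutativeRing R
  open IntegerSolver R
  open Units R
  open import Algebra.Properties.Semiring.Exp semiring using (_^_; ^-homo-*)
  open import Relation.Binary.Reasoning.Setoid setoid

  abstract
    -- Opaque outside this block: exponents are handled through `Z-+`, `Z-pos` and equalities of
    -- integers, never by unfolding to powers of `q` and `q⁻`.
    Z : ℤ → Carrier
    Z (+ n) = q ^ n
    Z -[1+ n ] = q⁻ ^ suc n

    Z-⊖ : ∀ m n → Z (m ℤ.⊖ n) ≈ q ^ m * q⁻ ^ n
    Z-⊖ m zero = sym (*-identityʳ _)
    Z-⊖ zero (suc n) = sym (*-identityˡ _)
    Z-⊖ (suc m) (suc n) rewrite ℤ.[1+m]⊖[1+n]≡m⊖n m n = begin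
      Z (m ℤ.⊖ n)      ≈⟨ Z-⊖ m n ⟩
      q ^ m * q⁻ ^ n      ≈⟨ *-identityˡ _ ⟨
      1# * (q ^ m * q⁻ ^ n)      ≈⟨ *-congʳ qq⁻≈1 ⟨
      q * q⁻ * (q ^ m * q⁻ ^ n)      ≈⟨ solve 4 (λ a b c d → a :* b :* (c :* d) := a :* c :* (b :* d)) refl _ _ _ _ ⟩
      q * q ^ m * (q⁻ * q⁻ ^ n)       ∎

    Z-+ : ∀ i j → Z (i ℤ.+ j) ≈ Z i * Z j
    Z-+ (+ m) (+ n) = ^-homo-* q m n
    Z-+ (+ m) -[1+ n ] = Z-⊖ m (suc n)
    Z-+ -[1+ m ] (+ n) = trans (Z-⊖ n (suc m)) (*-comm _ _)
    Z-+ -[1+ m ] -[1+ n ] = trans (reflexive (≡.cong (λ k → q⁻ ^ suc k) (≡.sym (ℕ.+-suc m n)))) (^-homo-* q⁻ (suc m) (suc n))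

    Z-pos : ∀ n → Z (+ n) ≈ q ^ n
    Z-pos n = refl

  Z-0 : Z (+ 0) ≈ 1#
  Z-0 = Z-pos 0

  infixl 7 _⊛_
  _⊛_ : ∀ {x y i j} → x ≈ Z i → y ≈ Z j → x * y ≈ Z (i ℤ.+ j)
  _⊛_ {i = i} {j} x≈ y≈ = trans (*-cong x≈ y≈) (sym (Z-+ i j))

  Z-≡ : ∀ {x i j} → x ≈ Z i → i ≡ j → x ≈ Z j
  Z-≡ x≈ ≡.refl = x≈

  Z-unit : ∀ i → Unit (Z i)
  Z-unit i = Z (ℤ.- i) , trans (sym (Z-+ i (ℤ.- i))) (trans (reflexive (≡.cong Z (ℤ.+-inverseʳ i))) Z-0)

  pochZ : ℤ → ℤ → ℕ → Carrier
  pochZ x r zero = 1#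
  pochZ x r (suc k) = pochZ x r k * (1# - Z (x ℤ.+ r ℤ.* + k))

  module Evaluation (d : ℕ) (1<d : 1 < d) where

    δ : ℤ
    δ = + d

    p : Carrier
    p = Z δ

    open Quadratic R p

    K≈ : ∀ k → K k ≈ Z (δ ℤ.* + k)
    K≈ zero = trans (sym Z-0) (reflexive (≡.cong Z (≡.sym (ℤ.*-zeroʳ δ))))
    K≈ (suc k) = Z-≡ (refl ⊛ K≈ k) (lemma δ (+ k))
      where
      lemma : ∀ δ k → δ ℤ.+ δ ℤ.* k ≡ δ ℤ.* (+ 1 ℤ.+ k)
      lemma = solve-∀

    KK≈ : ∀ k → K k * K k ≈ Z (+ 2 ℤ.* δ ℤ.* + k)
    KK≈ k = Z-≡ (K≈ k ⊛ K≈ k) (lemma δ (+ k))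
      where
      lemma : ∀ δ k → δ ℤ.* k ℤ.+ δ ℤ.* k ≡ + 2 ℤ.* δ ℤ.* k
      lemma = solve-∀

    lin≈ : ∀ {x i} k → x ≈ Z i → lin x k ≈ 1# - Z (i ℤ.+ δ ℤ.* + k)
    lin≈ k x≈ = +-congˡ (-‿cong (x≈ ⊛ K≈ k))

    quad≈ : ∀ {x i} k → x ≈ Z i → quad x k ≈ 1# - Z (i ℤ.+ + 2 ℤ.* δ ℤ.* + k)
    quad≈ k x≈ = +-congˡ (-‿cong (x≈ ⊛ KK≈ k))

    1-Z0≈0 : ∀ {i} → i ≡ + 0 → 1# - Z i ≈ 0#
    1-Z0≈0 ≡.refl = trans (+-congˡ (-‿cong Z-0)) (-‿inverseʳ 1#)

    d≢1 : d ≢ 1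
    d≢1 d≡1 = contradiction 1<d (ℕ.<-irrefl (≡.sym d≡1))

    -- Otherwise d would divide 1.
    -1≢0[d] : ∀ {i} j → i ≡ δ ℤ.* j ℤ.- + 1 → i ≢ + 0
    -1≢0[d] {i} j i≡ i≡0 = d≢1 (ℕ.m*n≡1⇒m≡1 d ℤ.∣ j ∣ (≡.trans (≡.sym (ℤ.abs-* δ j)) (≡.cong ℤ.∣_∣ δj≡1)))
      where
      lemma : ∀ x → x ≡ x ℤ.- + 1 ℤ.+ + 1
      lemma = solve-∀
      δj≡1 : δ ℤ.* j ≡ + 1
      δj≡1 = ≡.trans (lemma (δ ℤ.* j)) (≡.cong (ℤ._+ + 1) (≡.trans (≡.sym i≡) i≡0))

    pos≢0 : ∀ {i} n → i ≡ + suc n → i ≢ + 0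
    pos≢0 n ≡.refl ()

    neg≢0 : ∀ {i} n → i ≡ -[1+ n ] → i ≢ + 0
    neg≢0 n ≡.refl ()

    module Rahman (unit : ∀ i → i ≢ + 0 → Unit (1# - Z i)) (m : ℕ) where

      M : ℕ
      M = 2 ℕ.* m

      A b fb : Carrier
      A = Z (+ 1)
      b = Z (δ ℤ.- + 1)
      fb = Z (δ ℤ.+ + 2)

      -- Exponents of c, e, Ap²/c and Ap²/e at a = q^(-2dj-1), where c = aq = p⁻²ʲ and e = q/a =
      -- q²p²ʲ. The case j = m is a = q⁻ⁿ.
      γ ε φ ψ : ℕ → ℤ
      γ j = ℤ.- (+ 2 ℤ.* δ ℤ.* + j)
      ε j = + 2 ℤ.+ + 2 ℤ.* δ ℤ.* + j
      φ j = + 2 ℤ.* δ ℤ.+ + 2 ℤ.* δ ℤ.* + j ℤ.+ + 1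
      ψ j = + 2 ℤ.* δ ℤ.- + 2 ℤ.* δ ℤ.* + j ℤ.- + 1

      Series : ℕ → (ℕ → Carrier) → Set
      Series j = Hypergeometric (numer A b (Z (γ j)) (Z (ε j))) (denom fb (Z (φ j)) (Z (ψ j))) M

      2δk : ∀ k → + 2 ℤ.* δ ℤ.* + k ≡ + (2 ℕ.* d ℕ.* k)
      2δk k = ≡.sym (≡.trans (ℤ.pos-* (2 ℕ.* d) k) (≡.cong (ℤ._* + k) (ℤ.pos-* 2 d)))

      unit-lin-p : ∀ k → Unit (lin p k)
      unit-lin-p k = unit-cong (sym (lin≈ {i = δ} k refl)) (unit _ (pos≢0 _ eq))
        where
        eq : δ ℤ.+ δ ℤ.* + k ≡ + suc (ℕ.pred d ℕ.+ d ℕ.* k)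
        eq rewrite ≡.sym (ℤ.pos-* d k) =
          ≡.cong (λ x → + (x ℕ.+ d ℕ.* k)) (≡.sym (ℕ.suc-pred d {{ℕ.>-nonZero (ℕ.<-trans (s≤s z≤n) 1<d)}}))

      unit-fb : ∀ {x} k → x ≈ fb → Unit (quad x k)
      unit-fb k x≈ = unit-cong (sym (quad≈ {i = δ ℤ.+ + 2} k x≈)) (unit _ (pos≢0 _ eq))
        where
        eq : δ ℤ.+ + 2 ℤ.+ + 2 ℤ.* δ ℤ.* + k ≡ + suc (d ℕ.+ 1 ℕ.+ 2 ℕ.* d ℕ.* k)
        eq rewrite 2δk k | ℕ.+-suc d 1 = ≡.refl

      unit-φ : ∀ {x} j k → x ≈ Z (φ j) → Unit (quad x k)
      unit-φ j k x≈ = unit-cong (sym (quad≈ {i = φ j} k x≈)) (unit _ (pos≢0 _ (≡.trans (lemma δ (+ j) (+ k)) eq)))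
        where
        lemma : ∀ δ j k → + 2 ℤ.* δ ℤ.+ + 2 ℤ.* δ ℤ.* j ℤ.+ + 1 ℤ.+ + 2 ℤ.* δ ℤ.* k ≡ + 1 ℤ.+ + 2 ℤ.* δ ℤ.* (+ 1 ℤ.+ j ℤ.+ k)
        lemma = solve-∀
        eq : + 1 ℤ.+ + 2 ℤ.* δ ℤ.* + (1 ℕ.+ j ℕ.+ k) ≡ + suc (2 ℕ.* d ℕ.* (1 ℕ.+ j ℕ.+ k))
        eq rewrite 2δk (1 ℕ.+ j ℕ.+ k) = ≡.refl

      -- This exponent can have either sign, but it is -1 modulo d and hence never 0; the exponents
      -- in the other three factors are positive.
      unit-ψ : ∀ {x} j k → x ≈ Z (ψ j) → Unit (quad x k)
      unit-ψ j k x≈ = unit-cong (sym (quad≈ {i = ψ j} k x≈)) (unit _ (-1≢0[d] (+ 2 ℤ.- + 2 ℤ.* + j ℤ.+ + 2 ℤ.* + k) (lemma δ (+ j) (+ k))))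
        where
        lemma : ∀ δ j k → + 2 ℤ.* δ ℤ.- + 2 ℤ.* δ ℤ.* j ℤ.- + 1 ℤ.+ + 2 ℤ.* δ ℤ.* k ≡ δ ℤ.* (+ 2 ℤ.- + 2 ℤ.* j ℤ.+ + 2 ℤ.* k) ℤ.- + 1
        lemma = solve-∀

      unit-den : ∀ j l k {x y z} → x ≈ fb → y ≈ Z (φ j) → z ≈ Z (ψ l) → Unit (denom x y z k)
      unit-den j l k hx hy hz = denom-unit k (unit-lin-p k) (unit-fb k hx) (unit-φ j k hy) (unit-ψ l k hz)

      series : ∀ j → ∃ (Series j)
      series j = hypergeometric _ _ M (λ k _ → unit-den j j k refl refl refl)

      -- Rahman's evaluation T = q^((1-d)j) (p; p²)ⱼ (1 - q^(2dj+1)) / (pq²; p²)ⱼ, cleared of its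
      -- denominator.
      Value : ℕ → Carrier → Set
      Value j T = pochZ (δ ℤ.+ + 2) (+ 2 ℤ.* δ) j * T
        ≈ Z ((+ 1 ℤ.- δ) ℤ.* + j) * pochZ δ (+ 2 ℤ.* δ) j * (1# - Z (+ 1 ℤ.+ + 2 ℤ.* δ ℤ.* + j))

      -- At j = 0 the parameter c is 1, which kills every term after the first and leaves 1 - A = 1
      -- - q.
      value-0 : ∀ {t} → Series 0 t → Value 0 (total A t M)
      value-0 {t} h = begin
        1# * total A t M
          ≈⟨ *-congˡ (sum-tail-zero _ M (λ k k<M → trans (*-congˡ (vanish h (λ k _ → unit-den 0 0 k refl refl refl)
               0 (vanishing-lin 0 (trans (lin≈ {i = γ 0} 0 refl) (1-Z0≈0 (lemma δ)))) (suc k) k<M (s≤s z≤n))) (zeroʳ _))) ⟩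
        1# * (weight A 0 * t 0)
          ≈⟨ *-congˡ (*-congˡ (initial h)) ⟩
        1# * (weight A 0 * 1#)
          ≈⟨ solve 1 (λ A → let one = con (+ 1) in one :* ((one :- A :* (one :* (one :* one))) :* one) := one :* one :* (one :- A)) refl A ⟩
        1# * 1# * (1# - A)
          ≈⟨ *-cong (*-congʳ (trans (sym Z-0) (reflexive (≡.cong Z (lemma₁ δ))))) (+-congˡ (-‿cong (reflexive (≡.cong Z (lemma₂ δ))))) ⟩
        Z ((+ 1 ℤ.- δ) ℤ.* + 0) * 1# * (1# - Z (+ 1 ℤ.+ + 2 ℤ.* δ ℤ.* + 0)) ∎
        where
        lemma : ∀ δ → ℤ.- (+ 2 ℤ.* δ ℤ.* + 0) ℤ.+ δ ℤ.* + 0 ≡ + 0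
        lemma = solve-∀
        lemma₁ : ∀ δ → + 0 ≡ (+ 1 ℤ.- δ) ℤ.* + 0
        lemma₁ = solve-∀
        lemma₂ : ∀ δ → + 1 ≡ + 1 ℤ.+ + 2 ℤ.* δ ℤ.* + 0
        lemma₂ = solve-∀

      contiguous-Z : ∀ j → suc j ≤ m → ∀ {t₁ t₂} → Series j t₁ → Series (suc j) t₂ →
        (1# - Z (δ ℤ.+ + 2 ℤ.+ + 2 ℤ.* δ ℤ.* + j)) * (1# - Z (ℤ.- (+ 1 ℤ.+ + 2 ℤ.* δ ℤ.* + j))) * total A t₂ M
        ≈ (1# - Z (ℤ.- (δ ℤ.+ + 2 ℤ.* δ ℤ.* + j))) * (1# - Z (+ 1 ℤ.+ + 2 ℤ.* δ ℤ.* + suc j)) * total A t₁ M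
      contiguous-Z j j<m {t₁} {t₂} h₁ h₂ = begin
        (1# - Z (δ ℤ.+ + 2 ℤ.+ + 2 ℤ.* δ ℤ.* + j)) * (1# - Z (ℤ.- (+ 1 ℤ.+ + 2 ℤ.* δ ℤ.* + j))) * total A t₂ M
          ≈⟨ *-cong (*-cong (1-cong (Z-≡ (refl ⊛ refl) (l₁ δ J))) (1-cong (Z-≡ (refl ⊛ refl ⊛ refl) (l₂ δ J)))) (total-cong t₂) ⟨
        (1# - e * p) * (1# - b * s * p) * total (b * s * e * p) t₂ M
          ≈⟨ C.contiguous (hyper-cong (numer-cong (sym A≈) refl (sym sp²≈) refl) (denom-cong (sym fb≈) (sym φ≈) (sym ψ≈)) h₁)
               (hyper-cong (numer-cong (sym A≈) refl refl (sym ep²≈)) (denom-cong (sym fb≈) (sym φ′≈) (sym ψ′≈)) h₂)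
               (λ k _ → unit-den (suc j) j k fb≈ φ′≈ ψ≈) (λ k _ → unit-den j j k fb≈ φ≈ ψ≈) (λ k _ → unit-den (suc j) (suc j) k fb≈ φ′≈ ψ′≈)
               -- s = p^(-2(j+1)) ends the auxiliary term at index 2(j + 1), and j < m keeps this
               -- index within M = 2m.
               (2 ℕ.* suc j) (ℕ.*-monoʳ-≤ 2 j<m) (trans (lin≈ {i = γ (suc j)} (2 ℕ.* suc j) refl) (1-Z0≈0 r≡))
               (unit _ (neg≢0 _ s≡)) (unit _ (pos≢0 _ e≡)) ⟩
        (1# - s * p) * (1# - b * e * p) * total (b * s * e * p) t₁ M
          ≈⟨ *-cong (*-cong (1-cong (Z-≡ (refl ⊛ refl) (l₃ δ J))) (1-cong (Z-≡ (refl ⊛ refl ⊛ refl) (l₄ δ J)))) (total-cong t₁) ⟩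
        (1# - Z (ℤ.- (δ ℤ.+ + 2 ℤ.* δ ℤ.* + j))) * (1# - Z (+ 1 ℤ.+ + 2 ℤ.* δ ℤ.* + suc j)) * total A t₁ M ∎
        where
        J : ℤ
        J = + j
        s e : Carrier
        s = Z (γ (suc j))
        e = Z (ε j)
        module C = Contiguous b s e M
        1-cong : ∀ {x y} → x ≈ y → 1# - x ≈ 1# - y
        1-cong h = +-congˡ (-‿cong h)
        a₀ : ∀ δ j → δ ℤ.- + 1 ℤ.+ ℤ.- (+ 2 ℤ.* δ ℤ.* (+ 1 ℤ.+ j)) ℤ.+ (+ 2 ℤ.+ + 2 ℤ.* δ ℤ.* j) ℤ.+ δ ≡ + 1
        a₀ = solve-∀
        A≈ : b * s * e * p ≈ A
        A≈ = Z-≡ (refl ⊛ refl ⊛ refl ⊛ refl) (a₀ δ J)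
        total-cong : ∀ t → total (b * s * e * p) t M ≈ total A t M
        total-cong t = sum-cong M (λ k _ → *-congʳ (+-congˡ (-‿cong (*-congʳ A≈))))
        a₁ : ∀ δ j → ℤ.- (+ 2 ℤ.* δ ℤ.* (+ 1 ℤ.+ j)) ℤ.+ (+ 2 ℤ.+ + 2 ℤ.* δ ℤ.* j) ℤ.+ δ ℤ.+ (δ ℤ.+ δ) ≡ δ ℤ.+ + 2
        a₁ = solve-∀
        fb≈ : s * e * p * (p * p) ≈ fb
        fb≈ = Z-≡ (refl ⊛ refl ⊛ refl ⊛ (refl ⊛ refl)) (a₁ δ J)
        a₂ : ∀ δ j → ℤ.- (+ 2 ℤ.* δ ℤ.* (+ 1 ℤ.+ j)) ℤ.+ (δ ℤ.+ δ) ≡ ℤ.- (+ 2 ℤ.* δ ℤ.* j)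
        a₂ = solve-∀
        sp²≈ : s * (p * p) ≈ Z (γ j)
        sp²≈ = Z-≡ (refl ⊛ (refl ⊛ refl)) (a₂ δ J)
        a₃ : ∀ δ j → + 2 ℤ.+ + 2 ℤ.* δ ℤ.* j ℤ.+ (δ ℤ.+ δ) ≡ + 2 ℤ.+ + 2 ℤ.* δ ℤ.* (+ 1 ℤ.+ j)
        a₃ = solve-∀
        ep²≈ : e * (p * p) ≈ Z (ε (suc j))
        ep²≈ = Z-≡ (refl ⊛ (refl ⊛ refl)) (a₃ δ J)
        a₄ : ∀ δ j → δ ℤ.- + 1 ℤ.+ (+ 2 ℤ.+ + 2 ℤ.* δ ℤ.* j) ℤ.+ δ ≡ + 2 ℤ.* δ ℤ.+ + 2 ℤ.* δ ℤ.* j ℤ.+ + 1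
        a₄ = solve-∀
        φ≈ : b * e * p ≈ Z (φ j)
        φ≈ = Z-≡ (refl ⊛ refl ⊛ refl) (a₄ δ J)
        a₅ : ∀ δ j → + 2 ℤ.* δ ℤ.+ + 2 ℤ.* δ ℤ.* j ℤ.+ + 1 ℤ.+ (δ ℤ.+ δ) ≡ + 2 ℤ.* δ ℤ.+ + 2 ℤ.* δ ℤ.* (+ 1 ℤ.+ j) ℤ.+ + 1
        a₅ = solve-∀
        φ′≈ : b * e * p * (p * p) ≈ Z (φ (suc j))
        φ′≈ = Z-≡ (φ≈ ⊛ (refl ⊛ refl)) (a₅ δ J)
        a₆ : ∀ δ j → δ ℤ.- + 1 ℤ.+ ℤ.- (+ 2 ℤ.* δ ℤ.* (+ 1 ℤ.+ j)) ℤ.+ δ ≡ + 2 ℤ.* δ ℤ.- + 2 ℤ.* δ ℤ.* (+ 1 ℤ.+ j) ℤ.- + 1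
        a₆ = solve-∀
        ψ′≈ : b * s * p ≈ Z (ψ (suc j))
        ψ′≈ = Z-≡ (refl ⊛ refl ⊛ refl) (a₆ δ J)
        a₇ : ∀ δ j → + 2 ℤ.* δ ℤ.- + 2 ℤ.* δ ℤ.* (+ 1 ℤ.+ j) ℤ.- + 1 ℤ.+ (δ ℤ.+ δ) ≡ + 2 ℤ.* δ ℤ.- + 2 ℤ.* δ ℤ.* j ℤ.- + 1
        a₇ = solve-∀
        ψ≈ : b * s * p * (p * p) ≈ Z (ψ j)
        ψ≈ = Z-≡ (ψ′≈ ⊛ (refl ⊛ refl)) (a₇ δ J)
        l₁ : ∀ δ j → + 2 ℤ.+ + 2 ℤ.* δ ℤ.* j ℤ.+ δ ≡ δ ℤ.+ + 2 ℤ.+ + 2 ℤ.* δ ℤ.* j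
        l₁ = solve-∀
        l₂ : ∀ δ j → δ ℤ.- + 1 ℤ.+ ℤ.- (+ 2 ℤ.* δ ℤ.* (+ 1 ℤ.+ j)) ℤ.+ δ ≡ ℤ.- (+ 1 ℤ.+ + 2 ℤ.* δ ℤ.* j)
        l₂ = solve-∀
        l₃ : ∀ δ j → ℤ.- (+ 2 ℤ.* δ ℤ.* (+ 1 ℤ.+ j)) ℤ.+ δ ≡ ℤ.- (δ ℤ.+ + 2 ℤ.* δ ℤ.* j)
        l₃ = solve-∀
        l₄ : ∀ δ j → δ ℤ.- + 1 ℤ.+ (+ 2 ℤ.+ + 2 ℤ.* δ ℤ.* j) ℤ.+ δ ≡ + 1 ℤ.+ + 2 ℤ.* δ ℤ.* (+ 1 ℤ.+ j)
        l₄ = solve-∀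
        r₀ : ∀ δ j → ℤ.- (+ 2 ℤ.* δ ℤ.* j) ℤ.+ δ ℤ.* (+ 2 ℤ.* j) ≡ + 0
        r₀ = solve-∀
        r≡ : γ (suc j) ℤ.+ δ ℤ.* + (2 ℕ.* suc j) ≡ + 0
        r≡ = ≡.trans (≡.cong (λ x → γ (suc j) ℤ.+ δ ℤ.* x) (ℤ.pos-* 2 (suc j))) (r₀ δ (+ suc j))
        s≡ : γ (suc j) ≡ -[1+ ℕ.pred (2 ℕ.* d ℕ.* suc j) ]
        s≡ rewrite 2δk (suc j) = ≡.cong (λ x → ℤ.- (+ x)) (≡.sym (ℕ.suc-pred (2 ℕ.* d ℕ.* suc j)
          {{ℕ.>-nonZero (ℕ.*-mono-< {0} {2 ℕ.* d} {0} {suc j} (ℕ.*-mono-< {0} {2} {0} {d} (s≤s z≤n) (ℕ.<-trans (s≤s z≤n) 1<d)) (s≤s z≤n))}}))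
        e≡ : ε j ≡ + suc (1 ℕ.+ 2 ℕ.* d ℕ.* j)
        e≡ rewrite 2δk j = ≡.refl

      1-Z⁻ : ∀ i → 1# - Z (ℤ.- i) ≈ - Z (ℤ.- i) * (1# - Z i)
      1-Z⁻ i = begin
        1# - Z (ℤ.- i)
          ≈⟨ +-congʳ (trans (sym (Z-+ (ℤ.- i) i)) (trans (reflexive (≡.cong Z (ℤ.+-inverseˡ i))) Z-0)) ⟨
        Z (ℤ.- i) * Z i - Z (ℤ.- i)
          ≈⟨ solve 2 (λ x y → x :* y :- x := :- x :* (con (+ 1) :- y)) refl _ _ ⟩
        - Z (ℤ.- i) * (1# - Z i) ∎

      -- Stated for every `t` with the right recurrence, since the step compares the given series
      -- with the one that `series j` constructs.
      value : ∀ j → j ≤ m → ∀ {t} → Series j t → Value j (total A t M)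
      value zero _ h = value-0 h
      value (suc j) j<m {t} h = cancel (unit _ (pos≢0 _ i₁≡)) (begin
        (1# - Z i₁) * (P * (1# - Z x) * T′)
          ≈⟨ solve 4 (λ a P b T → a :* (P :* b :* T) := P :* (b :* a :* T)) refl _ _ _ _ ⟩
        P * ((1# - Z x) * (1# - Z i₁) * T′)
          ≈⟨ *-congˡ step ⟩
        P * (Z (+ 1 ℤ.- δ) * (1# - Z y) * (1# - Z i₂) * T)
          ≈⟨ solve 5 (λ P z y i T → P :* (z :* y :* i :* T) := z :* y :* i :* (P :* T)) refl _ _ _ _ _ ⟩
        Z (+ 1 ℤ.- δ) * (1# - Z y) * (1# - Z i₂) * (P * T)
          ≈⟨ *-congˡ (value j (ℕ.<⇒≤ j<m) (proj₂ (series j))) ⟩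
        Z (+ 1 ℤ.- δ) * (1# - Z y) * (1# - Z i₂) * (Z ((+ 1 ℤ.- δ) ℤ.* + j) * P′ * (1# - Z i₁))
          ≈⟨ solve 6 (λ z y i z′ P a → z :* y :* i :* (z′ :* P :* a) := a :* (z :* z′ :* (P :* y) :* i)) refl _ _ _ _ _ _ ⟩
        (1# - Z i₁) * (Z (+ 1 ℤ.- δ) * Z ((+ 1 ℤ.- δ) ℤ.* + j) * (P′ * (1# - Z y)) * (1# - Z i₂))
          ≈⟨ *-congˡ (*-congʳ (*-congʳ (Z-≡ (refl ⊛ refl) (l₅ δ (+ j))))) ⟩
        (1# - Z i₁) * (Z ((+ 1 ℤ.- δ) ℤ.* + suc j) * (P′ * (1# - Z y)) * (1# - Z i₂)) ∎)
        where
        x y i₁ i₂ : ℤ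
        x = δ ℤ.+ + 2 ℤ.+ + 2 ℤ.* δ ℤ.* + j
        y = δ ℤ.+ + 2 ℤ.* δ ℤ.* + j
        i₁ = + 1 ℤ.+ + 2 ℤ.* δ ℤ.* + j
        i₂ = + 1 ℤ.+ + 2 ℤ.* δ ℤ.* + suc j
        P P′ T T′ : Carrier
        P = pochZ (δ ℤ.+ + 2) (+ 2 ℤ.* δ) j
        P′ = pochZ δ (+ 2 ℤ.* δ) j
        T = total A (proj₁ (series j)) M
        T′ = total A t M
        i₁≡ : i₁ ≡ + suc (2 ℕ.* d ℕ.* j)
        i₁≡ rewrite 2δk j = ≡.refl
        l₅ : ∀ δ j → + 1 ℤ.- δ ℤ.+ (+ 1 ℤ.- δ) ℤ.* j ≡ (+ 1 ℤ.- δ) ℤ.* (+ 1 ℤ.+ j)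
        l₅ = solve-∀
        l₆ : ∀ δ j → + 1 ℤ.- δ ℤ.+ ℤ.- (+ 1 ℤ.+ + 2 ℤ.* δ ℤ.* j) ≡ ℤ.- (δ ℤ.+ + 2 ℤ.* δ ℤ.* j)
        l₆ = solve-∀
        step : (1# - Z x) * (1# - Z i₁) * T′ ≈ Z (+ 1 ℤ.- δ) * (1# - Z y) * (1# - Z i₂) * T
        -- The contiguous relation contains 1 - q^(-i₁) and 1 - q^(-y). Making their exponents
        -- positive produces q^(-i₁) and q^(-y), whose quotient q^(1-d) is the power gained at each
        -- step of `Value`.
        step = cancel (Z-unit (ℤ.- i₁)) (begin
          Z (ℤ.- i₁) * ((1# - Z x) * (1# - Z i₁) * T′)
            ≈⟨ solve 4 (λ z x i T → z :* (x :* i :* T) := :- (x :* (:- z :* i) :* T)) refl _ _ _ _ ⟩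
          - ((1# - Z x) * (- Z (ℤ.- i₁) * (1# - Z i₁)) * T′)
            ≈⟨ -‿cong (*-congʳ (*-congˡ (1-Z⁻ i₁))) ⟨
          - ((1# - Z x) * (1# - Z (ℤ.- i₁)) * T′)
            ≈⟨ -‿cong (contiguous-Z j j<m (proj₂ (series j)) h) ⟩
          - ((1# - Z (ℤ.- y)) * (1# - Z i₂) * T)
            ≈⟨ -‿cong (*-congʳ (*-congʳ (1-Z⁻ y))) ⟩
          - (- Z (ℤ.- y) * (1# - Z y) * (1# - Z i₂) * T)
            ≈⟨ solve 4 (λ z y i T → :- (:- z :* y :* i :* T) := z :* (y :* i :* T)) refl _ _ _ _ ⟩
          Z (ℤ.- y) * ((1# - Z y) * (1# - Z i₂) * T)
            ≈⟨ *-congʳ (Z-≡ (refl ⊛ refl) (l₆ δ (+ j))) ⟨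
          Z (+ 1 ℤ.- δ) * Z (ℤ.- i₁) * ((1# - Z y) * (1# - Z i₂) * T)
            ≈⟨ solve 5 (λ z w y i T → z :* w :* (y :* i :* T) := w :* (z :* y :* i :* T)) refl _ _ _ _ _ ⟩
          Z (ℤ.- i₁) * (Z (+ 1 ℤ.- δ) * (1# - Z y) * (1# - Z i₂) * T) ∎)

    module Vanishing (α α⁻ : Carrier) (αα⁻≈1 : α * α⁻ ≈ 1#) (M m : ℕ) (m≤M : m ≤ M)
      (unit-p : ∀ k → k < M → Unit (lin p k))
      (unit-fe : ∀ k → k < M → Unit (quad (Z (δ ℤ.+ + 2)) k))
      (unit-α : ∀ i → Unit (1# - α * Z i))
      (unit-α⁻ : ∀ i → Unit (1# - α⁻ * Z i))
      (unit-e : ∀ j → suc j ≤ m → Unit (1# - Z (δ ℤ.- + 2 ℤ.* δ ℤ.* + suc j ℤ.- + 2)))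
      where

      b c s fe : Carrier
      b = α * Z (+ 1)
      c = α⁻ * Z (+ 1)
      s = α⁻ * Z (+ 1 ℤ.- δ)
      fe = Z (δ ℤ.+ + 2)

      -- Now A = p⁻²ʲ moves while b = αq and c = q/α stay. The balance bce = Ap forces the exponent
      -- `ε` of e, and Ap²/b, Ap²/c are q^φ divided and multiplied by α. If qⁿ = 1, the case j = m
      -- has A = q and e = p/q: the last slot holds the parameter that is b in the statement.
      γ ε φ : ℕ → ℤ
      γ j = ℤ.- (+ 2 ℤ.* δ ℤ.* + j)
      ε j = δ ℤ.- + 2 ℤ.* δ ℤ.* + j ℤ.- + 2
      φ j = + 2 ℤ.* δ ℤ.- + 2 ℤ.* δ ℤ.* + j ℤ.- + 1

      Series : ℕ → (ℕ → Carrier) → Set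
      Series j = Hypergeometric (numer (Z (γ j)) b c (Z (ε j))) (denom (α⁻ * Z (φ j)) (α * Z (φ j)) fe) M

      scale : ∀ {x y β i j} → x ≈ β * Z i → y ≈ Z j → x * y ≈ β * Z (i ℤ.+ j)
      scale {i = i} {j} hx hy = trans (*-cong hx hy) (trans (*-assoc _ _ _) (*-congˡ (sym (Z-+ i j))))

      scale-≡ : ∀ {x β i j} → x ≈ β * Z i → i ≡ j → x ≈ β * Z j
      scale-≡ hx ≡.refl = hx

      unit-quad : ∀ {x β} i → (∀ i → Unit (1# - β * Z i)) → x ≈ β * Z i → ∀ k → Unit (quad x k)
      unit-quad i unit-β hx k = unit-cong (sym (+-congˡ (-‿cong (scale hx (KK≈ k))))) (unit-β _)

      unit-den : ∀ i j {x y z} → x ≈ α⁻ * Z i → y ≈ α * Z j → z ≈ fe → ∀ k → k < M → Unit (denom x y z k)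
      unit-den i j hx hy hz k k<M = denom-unit k (unit-p k k<M) (unit-quad i unit-α⁻ hx k)
        (unit-quad j unit-α hy k) (unit-cong (sym (quad-cong k hz)) (unit-fe k k<M))

      series : ∀ j → ∃ (Series j)
      series j = hypergeometric _ _ M (unit-den (φ j) (φ j) refl refl refl)

      -- At A = 1 the weight removes the first term and the numerator all later ones; the contiguous
      -- relation hands the zero on from A to A/p².
      vanishing : ∀ j → j ≤ m → ∀ {t} → Series j t → total (Z (γ j)) t M ≈ 0#
      vanishing zero _ {t} h = begin
        total (Z (γ 0)) t M
          ≈⟨ sum-tail-zero _ M (λ k k<M → trans (*-congˡ (vanish h (unit-den (φ 0) (φ 0) refl refl refl)
               0 (vanishing-quad 0 (trans (quad≈ {i = γ 0} 0 refl) (1-Z0≈0 (lemma δ)))) (suc k) k<M (s≤s z≤n))) (zeroʳ _)) ⟩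
        weight (Z (γ 0)) 0 * t 0
          ≈⟨ *-congʳ (+-congˡ (-‿cong (*-congʳ (trans (reflexive (≡.cong Z (lemma₁ δ))) Z-0)))) ⟩
        (1# - 1# * (1# * (1# * 1#))) * t 0
          ≈⟨ solve 1 (λ t → let one = con (+ 1) in (one :- one :* (one :* (one :* one))) :* t := con (+ 0)) refl _ ⟩
        0# ∎
        where
        lemma : ∀ δ → ℤ.- (+ 2 ℤ.* δ ℤ.* + 0) ℤ.+ + 2 ℤ.* δ ℤ.* + 0 ≡ + 0
        lemma = solve-∀
        lemma₁ : ∀ δ → ℤ.- (+ 2 ℤ.* δ ℤ.* + 0) ≡ + 0
        lemma₁ = solve-∀
      vanishing (suc j) j<m {t} h = trans (sym (total-cong A≈ t))
        (C.contiguous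
          (hyper-cong (numer-cong (sym A≈) refl (sym c≈) refl) (denom-cong (sym fb≈) (sym fc≈) (sym fe≈)) h)
          (hyper-cong (numer-cong (sym Ap²≈) refl (sym c≈) (sym ep²≈)) (denom-cong (sym fbp²≈) (sym fcp²≈) (sym fe≈)) (proj₂ (series j)))
          (unit-den _ _ fbp²≈ fcp²≈ fe≈)
          (unit-den _ _ fb≈ fc≈ fe≈)
          (suc j) (ℕ.≤-trans j<m m≤M)
          (trans (quad≈ {i = γ (suc j)} (suc j) A≈) (1-Z0≈0 (ℤ.+-inverseˡ (+ 2 ℤ.* δ ℤ.* + suc j))))
          (unit-neg (unit-e j j<m))
          (unit-* (unit-quad _ unit-α⁻ fb≈ 0) (unit-quad _ unit-α fc≈ 0))
          (trans (total-cong Ap²≈ _) (vanishing j (ℕ.<⇒≤ j<m) (proj₂ (series j)))))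
        where
        J : ℤ
        J = + j
        e : Carrier
        e = Z (ε (suc j))
        module C = Contiguous′ b s e M
        total-cong : ∀ {A A′} → A ≈ A′ → ∀ t → total A t M ≈ total A′ t M
        total-cong A≈ t = sum-cong M (λ k _ → *-congʳ (+-congˡ (-‿cong (*-congʳ A≈))))
        unit-neg : ∀ {x} → Unit (1# - x) → Unit (x - 1#)
        unit-neg {x} (y , h) = - y , trans (solve 2 (λ x y → (x :- con (+ 1)) :* (:- y) := (con (+ 1) :- x) :* y) refl x y) h
        bs≈ : b * s ≈ Z (+ 1 ℤ.+ (+ 1 ℤ.- δ))
        bs≈ = begin
          α * Z (+ 1) * (α⁻ * Z (+ 1 ℤ.- δ))
            ≈⟨ solve 4 (λ a x b y → a :* x :* (b :* y) := a :* b :* (x :* y)) refl _ _ _ _ ⟩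
          α * α⁻ * (Z (+ 1) * Z (+ 1 ℤ.- δ))
            ≈⟨ *-cong αα⁻≈1 (sym (Z-+ _ _)) ⟩
          1# * Z (+ 1 ℤ.+ (+ 1 ℤ.- δ))
            ≈⟨ *-identityˡ _ ⟩
          Z (+ 1 ℤ.+ (+ 1 ℤ.- δ)) ∎
        p²≈ : p * p ≈ Z (δ ℤ.+ δ)
        p²≈ = refl ⊛ refl
        a₀ : ∀ δ j → + 1 ℤ.+ (+ 1 ℤ.- δ) ℤ.+ (δ ℤ.- + 2 ℤ.* δ ℤ.* (+ 1 ℤ.+ j) ℤ.- + 2) ≡ ℤ.- (+ 2 ℤ.* δ ℤ.* (+ 1 ℤ.+ j))
        a₀ = solve-∀
        A≈ : b * s * e ≈ Z (γ (suc j))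
        A≈ = Z-≡ (bs≈ ⊛ refl) (a₀ δ J)
        a₁ : ∀ δ j → ℤ.- (+ 2 ℤ.* δ ℤ.* (+ 1 ℤ.+ j)) ℤ.+ (δ ℤ.+ δ) ≡ ℤ.- (+ 2 ℤ.* δ ℤ.* j)
        a₁ = solve-∀
        Ap²≈ : b * s * e * (p * p) ≈ Z (γ j)
        Ap²≈ = Z-≡ (A≈ ⊛ p²≈) (a₁ δ J)
        a₂ : ∀ δ → + 1 ℤ.- δ ℤ.+ δ ≡ + 1
        a₂ = solve-∀
        c≈ : s * p ≈ c
        c≈ = scale-≡ (scale refl refl) (a₂ δ)
        a₃ : ∀ δ j → δ ℤ.- + 2 ℤ.* δ ℤ.* (+ 1 ℤ.+ j) ℤ.- + 2 ℤ.+ (δ ℤ.+ δ) ≡ δ ℤ.- + 2 ℤ.* δ ℤ.* j ℤ.- + 2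
        a₃ = solve-∀
        ep²≈ : e * (p * p) ≈ Z (ε j)
        ep²≈ = Z-≡ (refl ⊛ p²≈) (a₃ δ J)
        a₄ : ∀ δ j → + 1 ℤ.- δ ℤ.+ (δ ℤ.- + 2 ℤ.* δ ℤ.* (+ 1 ℤ.+ j) ℤ.- + 2) ℤ.+ (δ ℤ.+ δ) ≡ + 2 ℤ.* δ ℤ.- + 2 ℤ.* δ ℤ.* (+ 1 ℤ.+ j) ℤ.- + 1
        a₄ = solve-∀
        fb≈ : s * e * (p * p) ≈ α⁻ * Z (φ (suc j))
        fb≈ = scale-≡ (scale (scale refl refl) p²≈) (a₄ δ J)
        a₅ : ∀ δ j → + 2 ℤ.* δ ℤ.- + 2 ℤ.* δ ℤ.* (+ 1 ℤ.+ j) ℤ.- + 1 ℤ.+ (δ ℤ.+ δ) ≡ + 2 ℤ.* δ ℤ.- + 2 ℤ.* δ ℤ.* j ℤ.- + 1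
        a₅ = solve-∀
        fbp²≈ : s * e * (p * p) * (p * p) ≈ α⁻ * Z (φ j)
        fbp²≈ = scale-≡ (scale fb≈ p²≈) (a₅ δ J)
        a₆ : ∀ δ j → + 1 ℤ.+ (δ ℤ.- + 2 ℤ.* δ ℤ.* (+ 1 ℤ.+ j) ℤ.- + 2) ℤ.+ δ ≡ + 2 ℤ.* δ ℤ.- + 2 ℤ.* δ ℤ.* (+ 1 ℤ.+ j) ℤ.- + 1
        a₆ = solve-∀
        fc≈ : b * e * p ≈ α * Z (φ (suc j))
        fc≈ = scale-≡ (scale (scale refl refl) refl) (a₆ δ J)
        fcp²≈ : b * e * p * (p * p) ≈ α * Z (φ j)
        fcp²≈ = scale-≡ (scale fc≈ p²≈) (a₅ δ J)
        a₇ : ∀ δ → + 1 ℤ.+ (+ 1 ℤ.- δ) ℤ.+ (δ ℤ.+ δ) ≡ δ ℤ.+ + 2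
        a₇ = solve-∀
        fe≈ : b * s * (p * p) ≈ fe
        fe≈ = Z-≡ (bs≈ ⊛ p²≈) (a₇ δ)

-- Regular elements, fractions and polynomials

module Regularity (R : CommutativeRing 0ℓ 0ℓ) where
  open CommutativeRing R
  open IntegerSolver R
  open import Algebra.Properties.Semiring.Exp semiring using (_^_)
  open import Relation.Binary.Reasoning.Setoid setoid

  infix 4 _∣_
  _∣_ : Carrier → Carrier → Set
  x ∣ y = ∃ λ z → y ≈ x * z

  ∣-resp : ∀ {x y z} → y ≈ z → x ∣ y → x ∣ z
  ∣-resp y≈z (w , h) = w , trans (sym y≈z) h

  ∣-zero : ∀ {x y} → y ≈ 0# → x ∣ y
  ∣-zero {x} h = 0# , trans h (sym (zeroʳ x))

  ∣-+ : ∀ {x y z} → x ∣ y → x ∣ z → x ∣ y + z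
  ∣-+ {x} (v , h) (w , k) = v + w , trans (+-cong h k) (sym (distribˡ x v w))

  ∣-* : ∀ {x y} z → x ∣ y → x ∣ z * y
  ∣-* {x} z (w , h) = z * w , trans (*-congˡ h) (solve 3 (λ z x w → z :* (x :* w) := x :* (z :* w)) refl z x w)

  ∣-multiple : ∀ x z → x ∣ z * x
  ∣-multiple x z = z , *-comm z x

  ∣-trans : ∀ {x y z} → x ∣ y → y ∣ z → x ∣ z
  ∣-trans {x} (v , h) (w , k) = v * w , trans k (trans (*-congʳ h) (*-assoc x v w))

  -- A non-zero-divisor of R/L, or of R itself when `L` is `0#`.
  Regular : Carrier → Carrier → Set
  Regular L s = ∀ x → L ∣ s * x → L ∣ x

  regular-cong : ∀ {L s t} → s ≈ t → Regular L s → Regular L t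
  regular-cong s≈t h x tx = h x (∣-resp (*-congʳ (sym s≈t)) tx)

  regular-modulus : ∀ {L L′ s} → L ≈ L′ → Regular L s → Regular L′ s
  regular-modulus L≈L′ h x (y , eq) = conv (h x (y , trans eq (*-congʳ (sym L≈L′))))
    where
    conv : _ ∣ x → _ ∣ x
    conv (z , eq) = z , trans eq (*-congʳ L≈L′)

  regular-1 : ∀ {L} → Regular L 1#
  regular-1 x = ∣-resp (*-identityˡ x)

  regular-* : ∀ {L s t} → Regular L s → Regular L t → Regular L (s * t)
  regular-* {L} {s} {t} hs ht x h = ht x (hs (t * x) (∣-resp (*-assoc s t x) h))

  regular-^ : ∀ {L s} k → Regular L s → Regular L (s ^ k)
  regular-^ zero h = regular-1
  regular-^ (suc k) h = regular-* h (regular-^ k h)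

  regular-neg : ∀ {L s} → Regular L s → Regular L (- s)
  regular-neg {L} {s} h x hx = h x (∣-resp (solve 2 (λ s x → :- con (+ 1) :* (:- s :* x) := s :* x) refl s x) (∣-* (- 1#) hx))

  -- Modulo `L` the element `s` is a factor of `r`, and a factor of a non-zero-divisor is one.
  regular-combination : ∀ {L s r} u w → r ≈ u * s + w * L → Regular L r → Regular L s
  regular-combination {L} {s} {r} u w r≈ h x hx = h x (∣-resp (sym (begin
      r * x      ≈⟨ *-congʳ r≈ ⟩
      (u * s + w * L) * x      ≈⟨ solve 5 (λ u s w L x → (u :* s :+ w :* L) :* x := u :* (s :* x) :+ w :* x :* L) refl u s w L x ⟩
      u * (s * x) + w * x * L    ∎)) (∣-+ (∣-* u hx) (∣-multiple L (w * x))))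

  regular-factor : ∀ {L s r} u → r ≈ u * s → Regular L r → Regular L s
  regular-factor {L} {s} u r≈ = regular-combination u 0# (trans r≈
    (solve 3 (λ u s L → u :* s := u :* s :+ con (+ 0) :* L) refl u s L))

  zero-difference : ∀ {x y} → 0# ∣ x - y → x ≈ y
  zero-difference {x} {y} (z , h) = begin
    x      ≈⟨ solve 2 (λ x y → x := x :- y :+ y) refl x y ⟩
    x - y + y  ≈⟨ +-congʳ (trans h (zeroˡ z)) ⟩
    0# + y     ≈⟨ +-identityˡ y ⟩
    y          ∎

  regular-cancel : ∀ {s x y} → Regular 0# s → s * x ≈ s * y → x ≈ y
  regular-cancel {s} {x} {y} h sx≈sy = zero-difference (h _ (∣-zero (begin
    s * (x - y)      ≈⟨ solve 3 (λ s x y → s :* (x :- y) := s :* x :- s :* y) refl s x y ⟩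
    s * x - s * y    ≈⟨ +-congʳ sx≈sy ⟩
    s * y - s * y    ≈⟨ -‿inverseʳ _ ⟩
    0#               ∎)))

  -- Exchange in a regular sequence: if sx = Lz, then s divides z, and cancelling s exhibits x as a
  -- multiple of L.
  regular-swap : ∀ {L s} → Regular 0# s → Regular s L → Regular L s
  regular-swap {L} {s} h₀ h x (z , sx≈Lz) = step (h z (x , sym sx≈Lz))
    where
    step : s ∣ z → L ∣ x
    step (w , z≈sw) = w , regular-cancel h₀ (begin
      s * x      ≈⟨ sx≈Lz ⟩
      L * z      ≈⟨ *-congˡ z≈sw ⟩
      L * (s * w)    ≈⟨ solve 3 (λ L s w → L :* (s :* w) := s :* (L :* w)) refl L s w ⟩
      s * (L * w)    ∎)

  product-divides : ∀ {F G x} → Regular G F → F ∣ x → G ∣ x → F * G ∣ x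
  product-divides {F} {G} {x} h (y , x≈Fy) Gx = step (h y (∣-resp x≈Fy Gx))
    where
    step : G ∣ y → F * G ∣ x
    step (w , y≈Gw) = w , trans x≈Fy (trans (*-congˡ y≈Gw) (sym (*-assoc F G w)))

  -- If FG divides sx, then x = Fy; cancelling F leaves G dividing sy, hence y.
  regular-product : ∀ {F G s} → Regular 0# F → Regular F s → Regular G s → Regular (F * G) s
  regular-product {F} {G} {s} h₀ hF hG x (z , sx≈FGz) =
    step (hF x (G * z , trans sx≈FGz (*-assoc F G z)))
    where
    step′ : ∀ {y} → x ≈ F * y → G ∣ y → F * G ∣ x
    step′ x≈Fy (w , y≈Gw) = w , trans x≈Fy (trans (*-congˡ y≈Gw) (sym (*-assoc F G w)))
    step : F ∣ x → F * G ∣ x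
    step (y , x≈Fy) = step′ x≈Fy (hG y (z , regular-cancel h₀ (begin
      F * (s * y)      ≈⟨ solve 3 (λ F s y → F :* (s :* y) := s :* (F :* y)) refl F s y ⟩
      s * (F * y)      ≈⟨ *-congˡ x≈Fy ⟨
      s * x      ≈⟨ sx≈FGz ⟩
      F * G * z      ≈⟨ *-assoc F G z ⟩
      F * (G * z)      ∎)))

  -- If V = h V′ and P = h P′, then P divides V P′, hence P′, so that h is a unit.
  regular⇒coprime : ∀ {P V} → Regular 0# P → Regular P V → ∀ h → h ∣ V → h ∣ P → ∃ λ w → h * w ≈ 1#
  regular⇒coprime {P} {V} h₀ hV h (V′ , V≈) (P′ , P≈) = step (hV P′ (V′ , (begin
      V * P′      ≈⟨ *-congʳ V≈ ⟩
      h * V′ * P′     ≈⟨ solve 3 (λ h v p → h :* v :* p := h :* p :* v) refl h V′ P′ ⟩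
      h * P′ * V′     ≈⟨ *-congʳ P≈ ⟨
      P * V′          ∎)))
    where
    step : P ∣ P′ → ∃ λ w → h * w ≈ 1#
    step (w , P′≈Pw) = w , regular-cancel h₀ (begin
      P * (h * w)    ≈⟨ solve 3 (λ P h w → P :* (h :* w) := h :* (P :* w)) refl P h w ⟩
      h * (P * w)    ≈⟨ *-congˡ P′≈Pw ⟨
      h * P′      ≈⟨ P≈ ⟨
      P      ≈⟨ *-identityʳ P ⟨
      P * 1#         ∎)

-- Fractions with regular denominators modulo L

module Localisation (R : CommutativeRing 0ℓ 0ℓ) (L : CommutativeRing.Carrier R) where
  private module R = CommutativeRing R
  open R using (Carrier; _+_; _*_; _-_; -_; 0#; 1#; _≈_)
  open IntegerSolver R
  open Regularity R

  record Fraction : Set where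
    constructor fraction
    field
      numerator denominator : Carrier
      regular : Regular L denominator
  open Fraction

  infix 4 _≃_
  -- A record and not a bare divisibility, so that a proof determines the two fractions it relates.
  record _≃_ (x y : Fraction) : Set where
    constructor cross
    field divides : L ∣ numerator x * denominator y - numerator y * denominator x
  open _≃_ public

  ≃-refl : ∀ {x} → x ≃ x
  ≃-refl = cross (∣-zero (R.-‿inverseʳ _))

  ≃-sym : ∀ {x y} → x ≃ y → y ≃ x
  ≃-sym {x} {y} (cross h) = cross (∣-resp
    (solve 4 (λ a b c d → :- con (+ 1) :* (a :* d :- c :* b) := c :* b :- a :* d) R.refl
      (numerator x) (denominator x) (numerator y) (denominator y)) (∣-* (- 1#) h))

  -- The two divisibilities combine to one with the middle denominator as an extra factor, which
  -- regularity removes.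
  ≃-trans : ∀ {x y z} → x ≃ y → y ≃ z → x ≃ z
  ≃-trans {x} {y} {z} (cross h) (cross k) = cross (regular y _ (∣-resp
    (solve 6 (λ a b c d e f → f :* (a :* d :- c :* b) :+ b :* (c :* f :- e :* d) := d :* (a :* f :- e :* b)) R.refl
      (numerator x) (denominator x) (numerator y) (denominator y) (numerator z) (denominator z))
    (∣-+ (∣-* (denominator z) h) (∣-* (denominator x) k))))

  ι : Carrier → Fraction
  ι f = fraction f 1# regular-1

  infixl 6 _⊕_
  infixl 7 _⊗_
  _⊕_ _⊗_ : Fraction → Fraction → Fraction
  x ⊕ y = fraction (numerator x * denominator y + numerator y * denominator x) (denominator x * denominator y) (regular-* (regular x) (regular y))
  x ⊗ y = fraction (numerator x * numerator y) (denominator x * denominator y) (regular-* (regular x) (regular y))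

  ⊝_ : Fraction → Fraction
  ⊝ x = fraction (- numerator x) (denominator x) (regular x)

  ⊕-cong : ∀ {x x′ y y′} → x ≃ x′ → y ≃ y′ → x ⊕ y ≃ x′ ⊕ y′
  ⊕-cong {x} {x′} {y} {y′} (cross h) (cross k) = cross (∣-resp
    (solve 8 (λ a b a′ b′ c d c′ d′ →
      d :* d′ :* (a :* b′ :- a′ :* b) :+ b :* b′ :* (c :* d′ :- c′ :* d)
      := (a :* d :+ c :* b) :* (b′ :* d′) :- (a′ :* d′ :+ c′ :* b′) :* (b :* d)) R.refl
      (numerator x) (denominator x) (numerator x′) (denominator x′) (numerator y) (denominator y) (numerator y′) (denominator y′))
    (∣-+ (∣-* _ h) (∣-* _ k)))

  ⊗-cong : ∀ {x x′ y y′} → x ≃ x′ → y ≃ y′ → x ⊗ y ≃ x′ ⊗ y′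
  ⊗-cong {x} {x′} {y} {y′} (cross h) (cross k) = cross (∣-resp
    (solve 8 (λ a b a′ b′ c d c′ d′ →
      c :* d′ :* (a :* b′ :- a′ :* b) :+ a′ :* b :* (c :* d′ :- c′ :* d)
      := (a :* c) :* (b′ :* d′) :- (a′ :* c′) :* (b :* d)) R.refl
      (numerator x) (denominator x) (numerator x′) (denominator x′) (numerator y) (denominator y) (numerator y′) (denominator y′))
    (∣-+ (∣-* _ h) (∣-* _ k)))

  ⊝-cong : ∀ {x y} → x ≃ y → ⊝ x ≃ ⊝ y
  ⊝-cong {x} {y} (cross h) = cross (∣-resp
    (solve 4 (λ a b c d → :- con (+ 1) :* (a :* d :- c :* b) := :- a :* d :- :- c :* b) R.refl
      (numerator x) (denominator x) (numerator y) (denominator y)) (∣-* (- 1#) h))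

  equal : ∀ {x y} → numerator x * denominator y ≈ numerator y * denominator x → x ≃ y
  equal h = cross (∣-zero (R.trans (R.+-congʳ h) (R.-‿inverseʳ _)))

  localisation : CommutativeRing 0ℓ 0ℓ
  localisation = record
    { Carrier = Fraction
    ; _≈_ = _≃_
    ; _+_ = _⊕_
    ; _*_ = _⊗_
    ; -_ = ⊝_
    ; 0# = ι 0#
    ; 1# = ι 1#
    ; isCommutativeRing = record
      { isRing = record
        { +-isAbelianGroup = record
          { isGroup = record
            { isMonoid = record
              { isSemigroup = record
                { isMagma = record
                  { isEquivalence = record { refl = ≃-refl ; sym = ≃-sym ; trans = ≃-trans }
                  ; ∙-cong = ⊕-cong }
                ; assoc = λ x y z → equal (solve 6 (λ a b c d e f →
                    ((a :* d :+ c :* b) :* f :+ e :* (b :* d)) :* (b :* (d :* f))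
                    := (a :* (d :* f) :+ (c :* f :+ e :* d) :* b) :* (b :* d :* f)) R.refl
                    (numerator x) (denominator x) (numerator y) (denominator y) (numerator z) (denominator z)) }
              ; identity = identityˡ , λ x → ≃-trans (comm x (ι 0#)) (identityˡ x) }
            ; inverse = inverseˡ , λ x → ≃-trans (comm x (⊝ x)) (inverseˡ x)
            ; ⁻¹-cong = ⊝-cong }
          ; comm = comm }
        ; *-cong = ⊗-cong
        ; *-assoc = λ x y z → equal (solve 6 (λ a b c d e f →
            (a :* c :* e) :* (b :* (d :* f)) := (a :* (c :* e)) :* (b :* d :* f)) R.refl
            (numerator x) (denominator x) (numerator y) (denominator y) (numerator z) (denominator z))
        ; *-identity = *-identityˡ , λ x → ≃-trans (*-comm x (ι 1#)) (*-identityˡ x)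
        ; distrib = distribˡ , λ x y z → ≃-trans (*-comm (y ⊕ z) x)
            (≃-trans (distribˡ x y z) (⊕-cong (*-comm x y) (*-comm x z))) }
      ; *-comm = *-comm }
    }
    where
    comm : ∀ x y → x ⊕ y ≃ y ⊕ x
    comm x y = equal (solve 4 (λ a b c d → (a :* d :+ c :* b) :* (d :* b) := (c :* b :+ a :* d) :* (b :* d)) R.refl
      (numerator x) (denominator x) (numerator y) (denominator y))
    *-comm : ∀ x y → x ⊗ y ≃ y ⊗ x
    *-comm x y = equal (solve 4 (λ a b c d → (a :* c) :* (d :* b) := (c :* a) :* (b :* d)) R.refl
      (numerator x) (denominator x) (numerator y) (denominator y))
    identityˡ : ∀ x → ι 0# ⊕ x ≃ x
    identityˡ x = equal (solve 2 (λ a b → (con (+ 0) :* b :+ a :* con (+ 1)) :* b := a :* (con (+ 1) :* b)) R.refl (numerator x) (denominator x))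
    inverseˡ : ∀ x → ⊝ x ⊕ x ≃ ι 0#
    inverseˡ x = equal (solve 2 (λ a b → (:- a :* b :+ a :* b) :* con (+ 1) := con (+ 0) :* (b :* b)) R.refl (numerator x) (denominator x))
    *-identityˡ : ∀ x → ι 1# ⊗ x ≃ x
    *-identityˡ x = equal (solve 2 (λ a b → (con (+ 1) :* a) :* b := a :* (con (+ 1) :* b)) R.refl (numerator x) (denominator x))
    distribˡ : ∀ x y z → x ⊗ (y ⊕ z) ≃ x ⊗ y ⊕ x ⊗ z
    distribˡ x y z = equal (solve 6 (λ a b c d e f →
      (a :* (c :* f :+ e :* d)) :* (b :* d :* (b :* f)) := (a :* c :* (b :* f) :+ a :* e :* (b :* d)) :* (b :* (d :* f))) R.refl
      (numerator x) (denominator x) (numerator y) (denominator y) (numerator z) (denominator z))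

  open Units localisation using (Unit)

  ι-+ : ∀ f g → ι (f + g) ≃ ι f ⊕ ι g
  ι-+ f g = equal (solve 2 (λ f g → (f :+ g) :* (con (+ 1) :* con (+ 1)) := (f :* con (+ 1) :+ g :* con (+ 1)) :* con (+ 1)) R.refl f g)

  ι-* : ∀ f g → ι (f * g) ≃ ι f ⊗ ι g
  ι-* f g = equal (solve 2 (λ f g → (f :* g) :* (con (+ 1) :* con (+ 1)) := f :* g :* con (+ 1)) R.refl f g)

  ι-zero : ∀ {f} → L ∣ f → ι f ≃ ι 0#
  ι-zero {f} h = cross (∣-resp (solve 1 (λ f → f := f :* con (+ 1) :- con (+ 0) :* con (+ 1)) R.refl f) h)

  ι-unit : ∀ {f} → Regular L f → Unit (ι f)
  ι-unit {f} h = fraction 1# f h ,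
    equal (solve 1 (λ f → f :* con (+ 1) :* con (+ 1) := con (+ 1) :* (con (+ 1) :* f)) R.refl f)

  -- For x = a/b with inverse c/d, L divides ac - bd. If L divides az, it therefore divides bdz, and
  -- b and d are regular.
  unit-regular : ∀ {x} → Unit x → Regular L (numerator x)
  unit-regular {x} (y , cross xy≃1) z hz = regular-* (regular x) (regular y) z (∣-resp
    (solve 5 (λ a b c d z → c :* (a :* z) :- (a :* c :* con (+ 1) :- con (+ 1) :* (b :* d)) :* z := b :* d :* z) R.refl
      (numerator x) (denominator x) (numerator y) (denominator y) z)
    (∣-+ (∣-* (numerator y) hz) (∣-resp (R.-‿cong (R.*-comm _ _))
      (∣-resp (solve 2 (λ u v → :- con (+ 1) :* (u :* v) := :- (u :* v)) R.refl _ _) (∣-* (- 1#) (∣-* z xy≃1))))))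

  minus-≃ : ∀ x y r → fraction (numerator x * denominator y - numerator y * denominator x) (denominator x * denominator y) r ≃ x ⊕ ⊝ y
  minus-≃ x y r = equal (solve 4 (λ a b c d → (a :* d :- c :* b) :* (b :* d) := (a :* d :+ :- c :* b) :* (b :* d)) R.refl
    (numerator x) (denominator x) (numerator y) (denominator y))

  reciprocal-≃ : ∀ {y s s⁻} r → y ≃ s → s ⊗ s⁻ ≃ ι 1# → fraction (denominator y) (numerator y) r ≃ s⁻
  reciprocal-≃ {y} {s} {s⁻} r y≃s ss⁻≃1 = Λ.cancel {s} {y⁻} {s⁻} (s⁻ , ss⁻≃1)
    (≃-trans {s ⊗ y⁻} {y ⊗ y⁻} (⊗-cong {s} {y} {y⁻} {y⁻} (≃-sym {y} {s} y≃s) (≃-refl {y⁻}))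
    (≃-trans {y ⊗ y⁻} {ι 1#}
      (equal (solve 2 (λ c d → c :* d :* con (+ 1) := con (+ 1) :* (d :* c)) R.refl (numerator y) (denominator y)))
      (≃-sym {s ⊗ s⁻} {ι 1#} ss⁻≃1)))
    where
    module Λ = Units localisation
    y⁻ : Fraction
    y⁻ = fraction (denominator y) (numerator y) r

  -- A pair of numerator and denominator comes without conditions, so regularity of the denominator
  -- is part of having a value.
  record Represents (x y : Carrier) (r : Fraction) : Set where
    constructor represents
    field
      regular-denominator : Regular L y
      represented : fraction x y regular-denominator ≃ r
  open Represents public

  represents-cong : ∀ {x y r s} → r ≃ s → Represents x y r → Represents x y s
  represents-cong h (represents ry hx) = represents ry (≃-trans hx h)

  represents-ι : ∀ x → Represents x 1# (ι x)
  represents-ι x = represents regular-1 ≃-refl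

  represents-+ : ∀ {x y x′ y′ r s} → Represents x y r → Represents x′ y′ s → Represents (x * y′ + x′ * y) (y * y′) (r ⊕ s)
  represents-+ {x} {y} {x′} {y′} {r} {s} (represents h k) (represents h′ k′) =
    represents (regular-* h h′) (⊕-cong {fraction x y h} {r} {fraction x′ y′ h′} {s} k k′)

  represents-* : ∀ {x y x′ y′ r s} → Represents x y r → Represents x′ y′ s → Represents (x * x′) (y * y′) (r ⊗ s)
  represents-* {x} {y} {x′} {y′} {r} {s} (represents h k) (represents h′ k′) =
    represents (regular-* h h′) (⊗-cong {fraction x y h} {r} {fraction x′ y′ h′} {s} k k′)

  represents-- : ∀ {x y x′ y′ r s} → Represents x y r → Represents x′ y′ s → Represents (x * y′ - x′ * y) (y * y′) (r ⊕ (⊝ s))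
  represents-- {x} {y} {x′} {y′} {r} {s} (represents h k) (represents h′ k′) =
    represents (regular-* h h′) (≃-trans (minus-≃ (fraction x y h) (fraction x′ y′ h′) (regular-* h h′))
      (⊕-cong {fraction x y h} {r} {⊝ fraction x′ y′ h′} {⊝ s} k (⊝-cong {fraction x′ y′ h′} {s} k′)))

  -- The numerator x′ of the divisor moves into the denominator; invertibility of the value `s`
  -- makes it regular.
  represents-÷ : ∀ {x y x′ y′ r s s⁻} → s ⊗ s⁻ ≃ ι 1# → Represents x y r → Represents x′ y′ s → Represents (x * y′) (y * x′) (r ⊗ s⁻)
  represents-÷ {x} {y} {x′} {y′} {r} {s} {s⁻} ss⁻≃1 (represents h k) (represents h′ k′) =
    represents (regular-* h hn) (⊗-cong {fraction x y h} {r} {fraction y′ x′ hn} {s⁻} k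
      (reciprocal-≃ {fraction x′ y′ h′} {s} {s⁻} hn k′ ss⁻≃1))
    where
    hn : Regular L x′
    hn = unit-regular {fraction x′ y′ h′} (s⁻ , ≃-trans (⊗-cong {fraction x′ y′ h′} {s} {s⁻} {s⁻} k′ ≃-refl) ss⁻≃1)

  represents-difference : ∀ {x y x′ y′ r s} → Represents x y r → Represents x′ y′ s → r ≃ s → L ∣ x * y′ - x′ * y
  represents-difference (represents _ h) (represents _ h′) r≃s = divides (≃-trans h (≃-trans r≃s (≃-sym h′)))

-- Coefficient lists as a commutative ring

module PolynomialRing (R : CommutativeRing 0ℓ 0ℓ) where
  open CommutativeRing R
  open IntegerSolver R
  open ListPoly 0# 1# _+_ _*_ -_ public
  open import Algebra.Properties.Ring ring using (-0#≈0#)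

  infix 4 _≋_
  record _≋_ (f g : Poly) : Set where
    constructor coeffs
    field at : ∀ i → coeff f i ≈ coeff g i
  open _≋_ public

  ≋-refl : ∀ {f} → f ≋ f
  ≋-refl .at i = refl

  ≋-sym : ∀ {f g} → f ≋ g → g ≋ f
  ≋-sym h .at i = sym (h .at i)

  ≋-trans : ∀ {f g h} → f ≋ g → g ≋ h → f ≋ h
  ≋-trans h₁ h₂ .at i = trans (h₁ .at i) (h₂ .at i)

  ∷-cong : ∀ {x y f g} → x ≈ y → f ≋ g → x ∷ f ≋ y ∷ g
  ∷-cong h₁ h₂ .at zero = h₁
  ∷-cong h₁ h₂ .at (suc i) = h₂ .at i

  zero∷zero : 0# ∷ [] ≋ []
  zero∷zero .at zero = refl
  zero∷zero .at (suc i) = refl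

  coeff-+ : ∀ f g i → coeff (f +P g) i ≈ coeff f i + coeff g i
  coeff-+ [] g i = sym (+-identityˡ _)
  coeff-+ (x ∷ f) [] i = sym (+-identityʳ _)
  coeff-+ (x ∷ f) (y ∷ g) zero = refl
  coeff-+ (x ∷ f) (y ∷ g) (suc i) = coeff-+ f g i

  coeff-neg : ∀ f i → coeff (-P f) i ≈ - coeff f i
  coeff-neg [] i = sym -0#≈0#
  coeff-neg (x ∷ f) zero = refl
  coeff-neg (x ∷ f) (suc i) = coeff-neg f i

  coeff-scale : ∀ c f i → coeff (scale c f) i ≈ c * coeff f i
  coeff-scale c [] i = sym (zeroʳ c)
  coeff-scale c (x ∷ f) zero = refl
  coeff-scale c (x ∷ f) (suc i) = coeff-scale c f i

  +P-cong : ∀ {f f′ g g′} → f ≋ f′ → g ≋ g′ → f +P g ≋ f′ +P g′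
  +P-cong {f} {f′} {g} {g′} h₁ h₂ .at i =
    trans (coeff-+ f g i) (trans (+-cong (h₁ .at i) (h₂ .at i)) (sym (coeff-+ f′ g′ i)))

  neg-cong : ∀ {f g} → f ≋ g → -P f ≋ -P g
  neg-cong {f} {g} h .at i = trans (coeff-neg f i) (trans (-‿cong (h .at i)) (sym (coeff-neg g i)))

  scale-cong : ∀ {c d f g} → c ≈ d → f ≋ g → scale c f ≋ scale d g
  scale-cong {c} {d} {f} {g} h₁ h₂ .at i =
    trans (coeff-scale c f i) (trans (*-cong h₁ (h₂ .at i)) (sym (coeff-scale d g i)))

  +P-assoc : ∀ f g h → (f +P g) +P h ≋ f +P (g +P h)
  +P-assoc f g h .at i = trans (coeff-+ (f +P g) h i) (trans (+-congʳ (coeff-+ f g i))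
    (trans (+-assoc _ _ _) (sym (trans (coeff-+ f (g +P h) i) (+-congˡ (coeff-+ g h i))))))

  +P-comm : ∀ f g → f +P g ≋ g +P f
  +P-comm f g .at i = trans (coeff-+ f g i) (trans (+-comm _ _) (sym (coeff-+ g f i)))

  +P-identityˡ : ∀ f → [] +P f ≋ f
  +P-identityˡ f = ≋-refl

  +P-identityʳ : ∀ f → f +P [] ≋ f
  +P-identityʳ f = ≋-trans (+P-comm f []) ≋-refl

  +P-inverseʳ : ∀ f → f +P (-P f) ≋ []
  +P-inverseʳ f .at i = trans (coeff-+ f (-P f) i) (trans (+-congˡ (coeff-neg f i)) (-‿inverseʳ _))

  +P-inverseˡ : ∀ f → (-P f) +P f ≋ []
  +P-inverseˡ f = ≋-trans (+P-comm (-P f) f) (+P-inverseʳ f)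

  +P-middle : ∀ f g h k → (f +P g) +P (h +P k) ≋ (f +P h) +P (g +P k)
  +P-middle f g h k .at i =
    trans (trans (coeff-+ (f +P g) (h +P k) i) (+-cong (coeff-+ f g i) (coeff-+ h k i)))
    (trans (solve 4 (λ a b c d → a :+ b :+ (c :+ d) := a :+ c :+ (b :+ d)) refl _ _ _ _)
    (sym (trans (coeff-+ (f +P h) (g +P k) i) (+-cong (coeff-+ f h i) (coeff-+ g k i)))))

  scale-distrib-+ : ∀ c f g → scale c (f +P g) ≋ scale c f +P scale c g
  scale-distrib-+ c f g .at i = trans (coeff-scale c (f +P g) i) (trans (*-congˡ (coeff-+ f g i))
    (trans (distribˡ _ _ _) (sym (trans (coeff-+ (scale c f) (scale c g) i) (+-cong (coeff-scale c f i) (coeff-scale c g i))))))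

  scale-scale : ∀ c d f → scale c (scale d f) ≋ scale (c * d) f
  scale-scale c d f .at i = trans (coeff-scale c (scale d f) i) (trans (*-congˡ (coeff-scale d f i))
    (trans (sym (*-assoc _ _ _)) (sym (coeff-scale (c * d) f i))))

  scale-0 : ∀ f → scale 0# f ≋ []
  scale-0 f .at i = trans (coeff-scale 0# f i) (zeroˡ _)

  scale-1 : ∀ f → scale 1# f ≋ f
  scale-1 f .at i = trans (coeff-scale 1# f i) (*-identityˡ _)

  0∷-distrib-+ : ∀ f g → 0# ∷ (f +P g) ≋ (0# ∷ f) +P (0# ∷ g)
  0∷-distrib-+ f g = ∷-cong (sym (+-identityˡ 0#)) ≋-refl

  scale-0∷ : ∀ c f → scale c (0# ∷ f) ≋ 0# ∷ scale c f
  scale-0∷ c f = ∷-cong (zeroʳ c) ≋-refl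

  *P-congˡ : ∀ f {g g′} → g ≋ g′ → f *P g ≋ f *P g′
  *P-congˡ [] h = ≋-refl
  *P-congˡ (x ∷ f) h = +P-cong (scale-cong refl h) (∷-cong refl (*P-congˡ f h))

  *P-zeroʳ : ∀ f → f *P [] ≋ []
  *P-zeroʳ [] = ≋-refl
  *P-zeroʳ (x ∷ f) = ≋-trans (∷-cong refl (*P-zeroʳ f)) zero∷zero

  *P-∷ : ∀ f y g → f *P (y ∷ g) ≋ scale y f +P (0# ∷ (f *P g))
  *P-∷ [] y g = ≋-sym zero∷zero
  *P-∷ (x ∷ f) y g = ∷-cong (+-congʳ (*-comm x y))
    (≋-trans (+P-cong ≋-refl (*P-∷ f y g))
    (≋-trans (≋-sym (+P-assoc (scale x g) (scale y f) (0# ∷ (f *P g))))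
    (≋-trans (+P-cong (+P-comm (scale x g) (scale y f)) ≋-refl)
    (+P-assoc (scale y f) (scale x g) (0# ∷ (f *P g))))))

  *P-comm : ∀ f g → f *P g ≋ g *P f
  *P-comm [] g = ≋-sym (*P-zeroʳ g)
  *P-comm (x ∷ f) g = ≋-trans (+P-cong ≋-refl (∷-cong refl (*P-comm f g))) (≋-sym (*P-∷ g x f))

  *P-cong : ∀ {f f′ g g′} → f ≋ f′ → g ≋ g′ → f *P g ≋ f′ *P g′
  *P-cong {f} {f′} {g} {g′} h₁ h₂ = ≋-trans (*P-congˡ f h₂)
    (≋-trans (*P-comm f g′) (≋-trans (*P-congˡ g′ h₁) (*P-comm g′ f′)))

  *P-distribˡ : ∀ f g h → f *P (g +P h) ≋ (f *P g) +P (f *P h)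
  *P-distribˡ [] g h = ≋-refl
  *P-distribˡ (x ∷ f) g h =
    ≋-trans (+P-cong (scale-distrib-+ x g h) (≋-trans (∷-cong refl (*P-distribˡ f g h)) (0∷-distrib-+ (f *P g) (f *P h))))
    (+P-middle (scale x g) (scale x h) (0# ∷ (f *P g)) (0# ∷ (f *P h)))

  *P-distribʳ : ∀ h f g → (f +P g) *P h ≋ (f *P h) +P (g *P h)
  *P-distribʳ h f g = ≋-trans (*P-comm (f +P g) h)
    (≋-trans (*P-distribˡ h f g) (+P-cong (*P-comm h f) (*P-comm h g)))

  scale-*P : ∀ c f g → scale c f *P g ≋ scale c (f *P g)
  scale-*P c [] g = ≋-refl
  scale-*P c (x ∷ f) g = ≋-sym
    (≋-trans (scale-distrib-+ c (scale x g) (0# ∷ (f *P g)))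
    (+P-cong (scale-scale c x g) (≋-trans (scale-0∷ c (f *P g)) (∷-cong refl (≋-sym (scale-*P c f g))))))

  0∷-*P : ∀ f g → (0# ∷ f) *P g ≋ 0# ∷ (f *P g)
  0∷-*P f g = +P-cong (scale-0 g) ≋-refl

  *P-assoc : ∀ f g h → (f *P g) *P h ≋ f *P (g *P h)
  *P-assoc [] g h = ≋-refl
  *P-assoc (x ∷ f) g h =
    ≋-trans (*P-distribʳ h (scale x g) (0# ∷ (f *P g)))
    (+P-cong (scale-*P x g h) (≋-trans (0∷-*P (f *P g) h) (∷-cong refl (*P-assoc f g h))))

  *P-identityˡ : ∀ f → oneP *P f ≋ f
  *P-identityˡ f = ≋-trans (+P-cong (scale-1 f) zero∷zero) (+P-identityʳ f)

  constP-* : ∀ c f → constP c *P f ≋ scale c f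
  constP-* c f = ≋-trans (+P-cong ≋-refl zero∷zero) (+P-identityʳ (scale c f))

  var*≋ : ∀ f → monoP 1 *P f ≋ 0# ∷ f
  var*≋ f = ≋-trans (0∷-*P (1# ∷ []) f) (∷-cong refl (*P-identityˡ f))

  polynomialRing : CommutativeRing 0ℓ 0ℓ
  polynomialRing = record
    { Carrier = Poly
    ; _≈_ = _≋_
    ; _+_ = _+P_
    ; _*_ = _*P_
    ; -_ = -P_
    ; 0# = []
    ; 1# = oneP
    ; isCommutativeRing = record
      { isRing = record
        { +-isAbelianGroup = record
          { isGroup = record
            { isMonoid = record
              { isSemigroup = record
                { isMagma = record
                  { isEquivalence = record { refl = ≋-refl ; sym = ≋-sym ; trans = ≋-trans }
                  ; ∙-cong = +P-cong }
                ; assoc = +P-assoc }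
              ; identity = +P-identityˡ , +P-identityʳ }
            ; inverse = +P-inverseˡ , +P-inverseʳ
            ; ⁻¹-cong = neg-cong }
          ; comm = +P-comm }
        ; *-cong = *P-cong
        ; *-assoc = *P-assoc
        ; *-identity = *P-identityˡ , λ f → ≋-trans (*P-comm f oneP) (*P-identityˡ f)
        ; distrib = *P-distribˡ , *P-distribʳ }
      ; *-comm = *P-comm }
    }

-- Cyclotomic polynomials

module Cyclotomy (R : CommutativeRing 0ℓ 0ℓ) (x : CommutativeRing.Carrier R) (Φ : ℕ → CommutativeRing.Carrier R) where
  open CommutativeRing R
  open IntegerSolver R
  open Units R
  open Regularity R
  open import Algebra.Properties.Semiring.Exp semiring using (_^_; ^-homo-*; ^-assocʳ)
  open import Relation.Binary.Reasoning.Setoid setoid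

  infix 4 _∈⟨_,_⟩
  _∈⟨_,_⟩ : Carrier → Carrier → Carrier → Set
  w ∈⟨ u , v ⟩ = ∃ λ r → ∃ λ s → w ≈ r * u + s * v

  ∈-resp : ∀ {u v w w′} → w ≈ w′ → w ∈⟨ u , v ⟩ → w′ ∈⟨ u , v ⟩
  ∈-resp w≈w′ (r , s , h) = r , s , trans (sym w≈w′) h

  ∈-left : ∀ {u v w} → u ∣ w → w ∈⟨ u , v ⟩
  ∈-left {u} {v} (z , h) = z , 0# , trans h (solve 3 (λ u z v → u :* z := z :* u :+ con (+ 0) :* v) refl u z v)

  ∈-right : ∀ {u v w} → v ∣ w → w ∈⟨ u , v ⟩
  ∈-right {u} {v} (z , h) = 0# , z , trans h (solve 3 (λ u z v → v :* z := con (+ 0) :* u :+ z :* v) refl u z v)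

  ∈-combine : ∀ {u v y z} b c → y ∈⟨ u , v ⟩ → z ∈⟨ u , v ⟩ → b * y + c * z ∈⟨ u , v ⟩
  ∈-combine {u} {v} b c (r , s , h) (r′ , s′ , h′) = b * r + c * r′ , b * s + c * s′ ,
    trans (+-cong (*-congˡ h) (*-congˡ h′))
      (solve 8 (λ b c r s r′ s′ u v → b :* (r :* u :+ s :* v) :+ c :* (r′ :* u :+ s′ :* v)
        := (b :* r :+ c :* r′) :* u :+ (b :* s :+ c :* s′) :* v) refl b c r s r′ s′ u v)

  Comaximal : Carrier → Carrier → Set
  Comaximal u v = 1# ∈⟨ u , v ⟩

  comaximal-regular : ∀ {u v} → Comaximal u v → Regular v u
  comaximal-regular (r , s , h) = regular-combination r s h regular-1

  comaximal-sym : ∀ {u v} → Comaximal u v → Comaximal v u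
  comaximal-sym (r , s , h) = s , r , trans h (+-comm _ _)

  comaximal-divisor : ∀ {u v w} → w ∣ v → Comaximal u v → Comaximal u w
  comaximal-divisor {u} {v} {w} (z , v≈wz) (r , s , h) = r , s * z ,
    trans h (+-congˡ (trans (*-congˡ v≈wz) (solve 3 (λ s w z → s :* (w :* z) := s :* z :* w) refl s w z)))

  comaximal-* : ∀ {u v w} → Comaximal u w → Comaximal v w → Comaximal (u * v) w
  comaximal-* {u} {v} {w} (r , s , h) (r′ , s′ , h′) = r * r′ , r * u * s′ + s , (begin
    1#      ≈⟨ h ⟩
    r * u + s * w      ≈⟨ +-congʳ (*-identityʳ _) ⟨
    r * u * 1# + s * w      ≈⟨ +-congʳ (*-congˡ h′) ⟩
    r * u * (r′ * v + s′ * w) + s * w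
      ≈⟨ solve 7 (λ r s u w r′ s′ v → r :* u :* (r′ :* v :+ s′ :* w) :+ s :* w
           := r :* r′ :* (u :* v) :+ (r :* u :* s′ :+ s) :* w) refl r s u w r′ s′ v ⟩
    r * r′ * (u * v) + (r * u * s′ + s) * w  ∎)

  nat : ℕ → Carrier
  nat zero = 0#
  nat (suc k) = 1# + nat k

  -- `G` is 1 + y + ... + y^(k-1), which takes the value k at y = 1.
  geometric : ∀ y k → ∃ λ G → (y ^ k - 1# ≈ (y - 1#) * G) × (y - 1# ∣ G - nat k)
  geometric y zero = 0# , trans (-‿inverseʳ 1#) (sym (zeroʳ _)) , ∣-zero (-‿inverseʳ 0#)
  geometric y (suc k) = extend (geometric y k)
    where
    extend : (∃ λ G → (y ^ k - 1# ≈ (y - 1#) * G) × (y - 1# ∣ G - nat k)) → _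
    extend (G , h , (H , h′)) = y * G + 1# ,
      (begin
        y * y ^ k - 1#      ≈⟨ solve 2 (λ y z → y :* z :- con (+ 1) := y :* (z :- con (+ 1)) :+ (y :- con (+ 1))) refl y (y ^ k) ⟩
        y * (y ^ k - 1#) + (y - 1#)     ≈⟨ +-congʳ (*-congˡ h) ⟩
        y * ((y - 1#) * G) + (y - 1#)   ≈⟨ solve 2 (λ y G → y :* ((y :- con (+ 1)) :* G) :+ (y :- con (+ 1)) := (y :- con (+ 1)) :* (y :* G :+ con (+ 1))) refl y G ⟩
        (y - 1#) * (y * G + 1#)         ∎) ,
      y * H + nat k , (begin
        y * G + 1# - (1# + nat k)      ≈⟨ solve 3 (λ y G n → y :* G :+ con (+ 1) :- (con (+ 1) :+ n) := y :* (G :- n) :+ (y :- con (+ 1)) :* n) refl y G (nat k) ⟩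
        y * (G - nat k) + (y - 1#) * nat k    ≈⟨ +-congʳ (*-congˡ h′) ⟩
        y * ((y - 1#) * H) + (y - 1#) * nat k ≈⟨ solve 3 (λ y H n → y :* ((y :- con (+ 1)) :* H) :+ (y :- con (+ 1)) :* n := (y :- con (+ 1)) :* (y :* H :+ n)) refl y H (nat k) ⟩
        (y - 1#) * (y * H + nat k)            ∎)

  power-∣ : ∀ i k → x ^ i - 1# ∣ x ^ (k ℕ.* i) - 1#
  power-∣ i k = proj₁ (geometric (x ^ i) k) , trans (+-congʳ eq) (proj₁ (proj₂ (geometric (x ^ i) k)))
    where
    eq : x ^ (k ℕ.* i) ≈ (x ^ i) ^ k
    eq = trans (reflexive (≡.cong (x ^_) (ℕ.*-comm k i))) (sym (^-assocʳ x i k))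

  -- A Bézout identity g + jn = im gives x^g - 1 = (x^(im) - 1) - x^g (x^(jn) - 1).
  gcd-∈ : ∀ m n → x ^ gcd m n - 1# ∈⟨ x ^ m - 1# , x ^ n - 1# ⟩
  gcd-∈ m n = step (Bézout.identity (gcd-GCD m n))
    where
    g : ℕ
    g = gcd m n
    shift : ∀ {y z} → g ℕ.+ y ≡ z → (x ^ z - 1#) + - x ^ g * (x ^ y - 1#) ≈ x ^ g - 1#
    shift {y} {z} eq = begin
      (x ^ z - 1#) + - x ^ g * (x ^ y - 1#)
        ≈⟨ +-congʳ (+-congʳ (trans (reflexive (≡.cong (x ^_) (≡.sym eq))) (^-homo-* x g y))) ⟩
      (x ^ g * x ^ y - 1#) + - x ^ g * (x ^ y - 1#)
        ≈⟨ solve 2 (λ g y → (g :* y :- con (+ 1)) :+ :- g :* (y :- con (+ 1)) := g :- con (+ 1)) refl (x ^ g) (x ^ y) ⟩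
      x ^ g - 1# ∎
    step : Bézout.Identity g m n → x ^ g - 1# ∈⟨ x ^ m - 1# , x ^ n - 1# ⟩
    step (Bézout.+- i j eq) = ∈-resp (trans (+-congʳ (*-identityˡ _)) (shift eq))
      (∈-combine 1# (- x ^ g) (∈-left (power-∣ m i)) (∈-right (power-∣ n j)))
    step (Bézout.-+ i j eq) = ∈-resp (trans (+-congʳ (*-identityˡ _)) (shift eq))
      (∈-combine 1# (- x ^ g) (∈-right (power-∣ n j)) (∈-left (power-∣ m i)))

  -- The bound is separate from N: N - 1 gives the divisor in the recursion for Φ_N, and N gives
  -- what should be x^N - 1.
  properProduct : ℕ → ℕ → Carrier
  properProduct N zero = 1#
  properProduct N (suc m) with suc m ∣ℕ? N
  ... | yes _ = properProduct N m * Φ (suc m)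
  ... | no _ = properProduct N m

  properProduct-yes : ∀ N m → suc m ∣ℕ N → properProduct N (suc m) ≡ properProduct N m * Φ (suc m)
  properProduct-yes N m h with suc m ∣ℕ? N
  ... | yes _ = ≡.refl
  ... | no ¬h = contradiction h ¬h

  ∣-refl : ∀ {y} → y ∣ y
  ∣-refl {y} = 1# , sym (*-identityʳ y)

  properProduct-mono : ∀ N {m m′} → m ≤ m′ → properProduct N m ∣ properProduct N m′
  properProduct-mono N {m} {m′} m≤m′ with ℕ.m≤n⇒m<n∨m≡n m≤m′
  ... | inj₂ ≡.refl = ∣-refl
  properProduct-mono N {m} {suc m′} _ | inj₁ (s≤s m≤m′) with suc m′ ∣ℕ? N
  ... | yes _ = ∣-trans (properProduct-mono N m≤m′) (Φ (suc m′) , refl)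
  ... | no _ = properProduct-mono N m≤m′

  properProduct-∣ : ∀ {g N} → g ∣ℕ N → ∀ m → properProduct g m ∣ properProduct N m
  properProduct-∣ g∣N zero = ∣-refl
  properProduct-∣ {g} {N} g∣N (suc m) with suc m ∣ℕ? g | suc m ∣ℕ? N | properProduct-∣ g∣N m
  ... | yes h | no ¬h | _ = contradiction (ℕ∣.∣-trans h g∣N) ¬h
  ... | no _ | no _ | ih = ih
  ... | no _ | yes _ | ih = ∣-trans ih (Φ (suc m) , refl)
  ... | yes _ | yes _ | (z , h) = z , trans (*-congʳ h)
    (solve 3 (λ a z f → a :* z :* f := a :* f :* z) refl _ _ _)

  Factored : ℕ → Set
  Factored n = properProduct n n ≈ x ^ n - 1#

  module _
    (quotient : ∀ n → properProduct (suc n) n ∣ x ^ suc n - 1# →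
      properProduct (suc n) n * Φ (suc n) ≈ x ^ suc n - 1#)
    (regular : ∀ i → Regular 0# (x ^ suc i - 1#))
    (nat-unit : ∀ k → Unit (nat (suc k)))
    where

    factored-last : ∀ n → Factored (suc n) → properProduct (suc n) n * Φ (suc n) ≈ x ^ suc n - 1#
    factored-last n h = trans (reflexive (≡.sym (properProduct-yes (suc n) n ℕ∣.∣-refl))) h

    Φ-∣ : ∀ n → Factored (suc n) → Φ (suc n) ∣ x ^ suc n - 1#
    Φ-∣ n h = properProduct (suc n) n , trans (sym (factored-last n h)) (*-comm _ _)

    -- Let g = gcd(N, i) < N and G = (x^N - 1)/(x^g - 1). Since x^g - 1 divides the product of the
    -- Φₑ with e ∣ N, e < N, the remaining factor Φ_N divides G. Since G is N/g modulo x^g - 1 and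
    -- N/g is invertible, G and x^g - 1 generate 1. The factorisations are arguments because the
    -- induction that proves them uses this lemma.
    Φ-comaximal : ∀ n → (∀ e → e < suc n → 0 < e → Factored e) → Factored (suc n) →
      ∀ i → ¬ (suc n ∣ℕ i) → Comaximal (Φ (suc n)) (x ^ i - 1#)
    Φ-comaximal n earlier now i n∤i = conclude (geometric (x ^ g) k)
      where
      N g : ℕ
      N = suc n
      g = gcd N i
      g≢N : g ≢ N
      g≢N g≡N = n∤i (≡.subst (_∣ℕ i) g≡N (gcd[m,n]∣n N i))
      k : ℕ
      k = ℕ∣.quotient (gcd[m,n]∣m N i)
      N≡kg : N ≡ k ℕ.* g
      N≡kg = ℕ∣.m∣n⇒n≡quotient*m (gcd[m,n]∣m N i)
      g<N : g < N
      g<N = ℕ.≤∧≢⇒< (ℕ∣.∣⇒≤ (gcd[m,n]∣m N i)) g≢N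
      0<g : 0 < g
      0<g with g in eq
      ... | zero = contradiction (≡.trans N≡kg (≡.trans (≡.cong (k ℕ.*_) eq) (ℕ.*-zeroʳ k))) λ ()
      ... | suc _ = s≤s z≤n
      x^g-1∈ : x ^ g - 1# ∈⟨ Φ N , x ^ i - 1# ⟩
      x^g-1∈ = enlarge (gcd-∈ N i) (Φ-∣ n now)
        where
        enlarge : ∀ {w u u′ v} → w ∈⟨ u , v ⟩ → u′ ∣ u → w ∈⟨ u′ , v ⟩
        enlarge {u′ = u′} (r , s , h) (z , h′) = r * z , s ,
          trans h (+-congʳ (trans (*-congˡ h′) (solve 3 (λ r u z → r :* (u :* z) := r :* z :* u) refl r u′ z)))
      cofactor : x ^ g - 1# ∣ properProduct N n
      cofactor = ∣-trans (1# , trans (earlier g g<N 0<g) (sym (*-identityʳ _)) ) (∣-trans (properProduct-∣ (gcd[m,n]∣m N i) g) (properProduct-mono N (ℕ.≤-pred g<N)))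
      regular-g : Regular 0# (x ^ g - 1#)
      regular-g with g | 0<g
      ... | suc g′ | _ = regular g′
      Φ∣G : ∀ {G} → (x ^ g) ^ k - 1# ≈ (x ^ g - 1#) * G → Φ N ∣ G
      Φ∣G {G} h = use cofactor
        where
        use : x ^ g - 1# ∣ properProduct N n → Φ N ∣ G
        use (W , h′) = W , regular-cancel regular-g (begin
          (x ^ g - 1#) * G      ≈⟨ h ⟨
          (x ^ g) ^ k - 1#      ≈⟨ +-congʳ (trans (^-assocʳ x g k) (reflexive (≡.cong (x ^_) (≡.trans (ℕ.*-comm g k) (≡.sym N≡kg))))) ⟩
          x ^ N - 1#      ≈⟨ factored-last n now ⟨
          properProduct N n * Φ N     ≈⟨ *-congʳ h′ ⟩
          (x ^ g - 1#) * W * Φ N      ≈⟨ solve 3 (λ a W F → a :* W :* F := a :* (F :* W)) refl _ _ _ ⟩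
          (x ^ g - 1#) * (Φ N * W)    ∎)
      unit-k : Unit (nat k)
      unit-k with k | N≡kg
      ... | suc k′ | _ = nat-unit k′
      conclude : (∃ λ G → ((x ^ g) ^ k - 1# ≈ (x ^ g - 1#) * G) × (x ^ g - 1# ∣ G - nat k)) → Comaximal (Φ N) (x ^ i - 1#)
      conclude (G , h , (H , h′)) = ∈-resp eq (∈-combine κ (- (κ * H)) (∈-left (Φ∣G h)) x^g-1∈)
        where
        κ : Carrier
        κ = proj₁ unit-k
        eq : κ * G + - (κ * H) * (x ^ g - 1#) ≈ 1#
        eq = begin
          κ * G + - (κ * H) * (x ^ g - 1#)      ≈⟨ solve 4 (λ κ G H y → κ :* G :+ :- (κ :* H) :* y := κ :* (G :- y :* H)) refl κ G H (x ^ g - 1#) ⟩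
          κ * (G - (x ^ g - 1#) * H)      ≈⟨ *-congˡ (+-congˡ (-‿cong h′)) ⟨
          κ * (G - (G - nat k))      ≈⟨ solve 3 (λ κ G n → κ :* (G :- (G :- n)) := n :* κ) refl κ G (nat k) ⟩
          nat k * κ      ≈⟨ proj₂ unit-k ⟩
          1#                                    ∎

    -- The Φₑ with e < N are pairwise comaximal, and those with e ∣ N divide x^N - 1. Hence so does
    -- their product, and the division that defines Φ_N is exact.
    factored : ∀ n → 0 < n → Factored n
    factored = <-rec _ step
      where
      step : ∀ n → (∀ {e} → e < n → 0 < e → Factored e) → 0 < n → Factored n
      step (suc n) earlier _ = trans (reflexive (properProduct-yes (suc n) n ℕ∣.∣-refl))
        (quotient n (divides-upto n ℕ.≤-refl))
        where
        comaximal-Φ : ∀ {f} → suc f < suc n → ∀ e → 0 < e → e ≤ f → Comaximal (Φ (suc f)) (Φ e)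
        comaximal-Φ {f} f<n (suc e) _ e<f = comaximal-divisor
          (Φ-∣ e (earlier (ℕ.≤-<-trans e<f (ℕ.<-trans ℕ.≤-refl f<n)) (s≤s z≤n)))
          (Φ-comaximal f (λ e e<f → earlier (ℕ.<-trans e<f f<n)) (earlier f<n (s≤s z≤n))
            (suc e) (λ h → ℕ.<-irrefl ≡.refl (ℕ.≤-trans (ℕ∣.∣⇒≤ h) e<f)))
        comaximal-product : ∀ {f} → suc f < suc n → ∀ m → m ≤ f → Comaximal (properProduct (suc n) m) (Φ (suc f))
        comaximal-product f<n zero _ = ∈-left (1# , sym (*-identityˡ 1#))
        comaximal-product f<n (suc m) m<f with suc m ∣ℕ? suc n
        ... | no _ = comaximal-product f<n m (ℕ.<⇒≤ m<f)
        ... | yes _ = comaximal-* (comaximal-product f<n m (ℕ.<⇒≤ m<f)) (comaximal-sym (comaximal-Φ f<n (suc m) (s≤s z≤n) m<f))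
        divides-upto : ∀ m → m ≤ n → properProduct (suc n) m ∣ x ^ suc n - 1#
        divides-upto zero _ = x ^ suc n - 1# , sym (*-identityˡ _)
        divides-upto (suc m) m<n with suc m ∣ℕ? suc n
        ... | no _ = divides-upto m (ℕ.<⇒≤ m<n)
        ... | yes (ℕ∣.divides c eq) = product-divides
          (comaximal-regular (comaximal-product (s≤s m<n) m ℕ.≤-refl))
          (divides-upto m (ℕ.<⇒≤ m<n))
          (∣-trans (Φ-∣ m (earlier (s≤s m<n) (s≤s z≤n)))
            (∣-resp (+-congʳ (reflexive (≡.cong (x ^_) (≡.sym eq)))) (power-∣ (suc m) c)))

    Φ-divides : ∀ n → Φ (suc n) ∣ x ^ suc n - 1#
    Φ-divides n = Φ-∣ n (factored (suc n) (s≤s z≤n))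

    Φ-comaximal-power : ∀ n i → ¬ (suc n ∣ℕ i) → Comaximal (Φ (suc n)) (x ^ i - 1#)
    Φ-comaximal-power n = Φ-comaximal n (λ e _ 0<e → factored e 0<e) (factored (suc n) (s≤s z≤n))

-- The functions out of which cyclotomic and divMonic are built are private to Defs.  Each of them
-- is recovered as the solution of a unification problem: with-abstraction exposes the normal form
-- of a goal, and an application of cong! records the function under which two terms differ.
module DefsInternals where

  -- The solution is an index of the type: written as an underscore, it is inferred when the clause
  -- for `holds` is checked.
  record Solves {A : Set} (P : A → Set) (x : A) : Set where
    field holds : P x
  open Solves public

  solution : ∀ {A} {P : A → Set} {x} → Solves P x → A
  solution {x = x} _ = x

  -- Typing `is-cong` at an equality made by `cong!` forces `f` to be the function that the macro
  -- abstracted.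
  data IsCong {A B : Set} (f : A → B) {x y : A} (e : x ≡ y) : {u v : B} → u ≡ v → Set where
    is-cong : IsCong f e (≡.cong f e)

  -- At n = m = 0 both sides are closed, but the goal that cong! inspects still shows
  -- lastOr applied to two different lists.
  lastOr-cong : (n m : ℕ) → n ≡ 0 → m ≡ 0 → [] ≡ [ cyclotomic 1 ] → cyclotomic n ≡ cyclotomic (suc m)
  lastOr-cong n m n≡0 m≡0 e with suc m
  lastOr-cong zero zero ≡.refl ≡.refl e | _ = cong! e

  lastOr-1 : Solves (λ (f : List Poly1 → Poly1) → ∀ e → IsCong f e (lastOr-cong 0 0 ≡.refl ≡.refl e)) _
  lastOr-1 .holds e = is-cong

  lastOr-∷ : Solves (λ (f : Poly1 → List Poly1 → Poly1) → ∀ x xs → solution lastOr-1 (x ∷ xs) ≡ f x xs) _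
  lastOr-∷ .holds x xs = ≡.refl

  lastOr : Poly1 → List Poly1 → Poly1
  lastOr = solution lastOr-∷

  cyclotomic≡ : Solves (λ (t : ℕ → List Poly1) → ∀ n → cyclotomic n ≡ lastOr P1.oneP (t n)) _
  cyclotomic≡ .holds n with lastOr
  ... | _ = ≡.refl

  cycTable : ℕ → List Poly1
  cycTable = solution cyclotomic≡

  cycTable-suc : Solves (λ (f : ℕ → Poly1) → ∀ n → cycTable (suc n) ≡
    cycTable n ++ [ divMonic (P1.monoP (suc n) P1.-P P1.oneP) (f n) ]) _
  cycTable-suc .holds n with reverse {A = ℚ} | trim
  ... | _ | _ = ≡.refl

  prodDiv-1 : Solves (λ (f : ℕ → List Poly1 → Poly1) → ∀ n → solution cycTable-suc n ≡ f n (cycTable n)) _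
  prodDiv-1 .holds n with cycTable n
  ... | _ = ≡.refl

  prodDiv-2 : Solves (λ (f : ℕ → List Poly1 → Poly1) → ∀ n p ps → ¬ (1 ∣ℕ suc n) → solution prodDiv-1 n (p ∷ ps) ≡ f n ps) _
  prodDiv-2 .holds n p ps 1∤ with 1 ∣ℕ? suc n
  ... | yes 1∣ = contradiction 1∣ 1∤
  ... | no _ = ≡.refl

  -- The fictitious equation 1 ≡ 2 between the two start indices makes the index the place where
  -- `cong!` sees the sides differ, which turns it into a variable.
  prodDiv-cong : ∀ n ps → 1 ≡ 2 → solution prodDiv-1 n ps ≡ solution prodDiv-2 n ps
  prodDiv-cong n ps e with suc n
  ... | _ = cong! e

  prodDiv-suc : Solves (λ (f : ℕ → ℕ → List Poly1 → Poly1) → ∀ n ps e → IsCong (λ k → f n k ps) e (prodDiv-cong n ps e)) _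
  prodDiv-suc .holds n ps e = is-cong

  -- prodDiv n is the private function at suc n.
  prodDiv : ℕ → ℕ → List Poly1 → Poly1
  prodDiv = solution prodDiv-suc

  divMonic≡ : Solves (λ (f : List ℚ → List ℚ → List ℚ) → ∀ F G x gt → reverse (trim G) ≡ x ∷ gt →
    divMonic F G ≡ reverse (f (reverse (trim F)) gt)) _
  divMonic≡ .holds F G x gt e with reverse (trim F) | reverse (trim G)
  divMonic≡ .holds F G x gt ≡.refl | _ | _ ∷ _ with reverse {A = ℚ}
  ... | _ = ≡.refl

  divH-∷ : Solves (λ (f : ℚ → List ℚ → List ℚ → List ℚ) → ∀ c r gt → solution divMonic≡ (c ∷ r) gt ≡ c ∷ f c r gt) _
  divH-∷ .holds c r gt = ≡.refl

  divH-fuel : Solves (λ (f : ℕ → ℚ → List ℚ → List ℚ → List ℚ) → ∀ c r gt → solution divH-∷ c r gt ≡ f (length r ℕ.∸ length gt) c r gt) _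
  divH-fuel .holds c r gt with length r ℕ.∸ length gt
  ... | _ = ≡.refl

  subScaled-cong : Solves (λ (s : ℚ → ℚ → List ℚ → List ℚ → List ℚ) → ∀ k c g gs r → (∀ {r r′} → r ≡ r′ → s c g gs r ≡ s c g gs r′) → r ≡ [] →
    solution divH-fuel k c r (g ∷ gs) ≡ solution divH-fuel k c [] (g ∷ gs)) _
  subScaled-cong .holds k c g gs r s-cong r≡[] with k
  ... | _ = cong! (s-cong r≡[])

  subScaled-∷ : Solves (λ (s : ℚ → List ℚ → List ℚ → List ℚ) → ∀ c g gs y ys → solution subScaled-cong c g gs (y ∷ ys) ≡ (y ℚ.- c ℚ.* g) ∷ s c gs ys) _
  subScaled-∷ .holds c g gs y ys = ≡.refl

  subScaled : ℚ → List ℚ → List ℚ → List ℚ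
  subScaled = solution subScaled-∷

  divH-subScaled : Solves (λ (f : ℕ → List ℚ → List ℚ → List ℚ) → ∀ k c r gt → solution divH-fuel k c r gt ≡ f k (subScaled c gt r) gt) _
  divH-subScaled .holds k c r gt with subScaled c gt r
  ... | _ = ≡.refl

  divH : ℕ → List ℚ → List ℚ → List ℚ
  divH = solution divH-subScaled

-- Long division by monic polynomials and the recursion for Φₙ

module CyclotomicPolynomials where
  open DefsInternals
  ℚring : CommutativeRing 0ℓ 0ℓ
  ℚring = ℚ.+-*-commutativeRing

  module ℚ[q] = PolynomialRing ℚring

  ℚ[q]-ring : CommutativeRing 0ℓ 0ℓ
  ℚ[q]-ring = ℚ[q].polynomialRing

  open CommutativeRing ℚ[q]-ring
  open IntegerSolver ℚ[q]-ring
  open Units ℚ[q]-ring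
  open Regularity ℚ[q]-ring
  open ℚ[q] using (coeff; coeffs; at; constP; monoP; scale; ∷-cong; coeff-+; coeff-scale; *P-∷; *P-zeroʳ; zero∷zero; var*≋)
  open import Algebra.Properties.Semiring.Exp semiring using (_^_; ^-homo-*)
  open import Relation.Binary.Reasoning.Setoid setoid

  X : Poly1
  X = monoP 1

  monoP≈ : ∀ n → monoP n ≈ X ^ n
  monoP≈ zero = refl
  monoP≈ (suc n) = trans (∷-cong ≡.refl (monoP≈ n)) (sym (var*≋ (X ^ n)))

  ∷≈ : ∀ c f → c ∷ f ≈ constP c + X * f
  ∷≈ c f = sym (trans (+-congˡ {constP c} (var*≋ f)) (∷-cong (ℚ.+-identityʳ c) refl))

  snoc≈ : ∀ l c → l ++ [ c ] ≈ l + constP c * X ^ length l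
  snoc≈ [] c = sym (*-identityʳ (constP c))
  snoc≈ (x ∷ l) c = begin
    x ∷ (l ++ [ c ])      ≈⟨ ∷≈ x (l ++ [ c ]) ⟩
    constP x + X * (l ++ [ c ])      ≈⟨ +-congˡ {constP x} (*-congˡ {X} (snoc≈ l c)) ⟩
    constP x + X * (l + constP c * X ^ length l)      ≈⟨ solve 5 (λ x X l c p → x :+ X :* (l :+ c :* p) := x :+ X :* l :+ c :* (X :* p)) refl (constP x) X l (constP c) (X ^ length l) ⟩
    constP x + X * l + constP c * (X * X ^ length l)      ≈⟨ +-congʳ {constP c * (X * X ^ length l)} (∷≈ x l) ⟨
    (x ∷ l) + constP c * (X * X ^ length l)               ∎

  highFirst : List ℚ → Poly1
  highFirst [] = []
  highFirst (c ∷ l) = highFirst l + constP c * X ^ length l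

  reverse≈ : ∀ l → reverse l ≈ highFirst l
  reverse≈ [] = refl
  reverse≈ (c ∷ l) = begin
    reverse (c ∷ l)      ≡⟨ List.unfold-reverse c l ⟩
    reverse l ++ [ c ]      ≈⟨ snoc≈ (reverse l) c ⟩
    reverse l + constP c * X ^ length (reverse l)      ≈⟨ +-cong (reverse≈ l) (reflexive (≡.cong (λ n → constP c * X ^ n) (List.length-reverse l))) ⟩
    highFirst l + constP c * X ^ length l                 ∎

  divMonic-divH : ∀ f g c r y gt → reverse (trim f) ≡ c ∷ r → reverse (trim g) ≡ y ∷ gt →
    divMonic f g ≡ reverse (divH (suc (length r ℕ.∸ length gt)) (c ∷ r) gt)
  divMonic-divH f g c r y gt ef eg rewrite divMonic≡ .holds f g y gt eg | ef = ≡.refl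

  length-subScaled : ∀ c gt r → length gt ≤ length r → length (subScaled c gt r) ≡ length r
  length-subScaled c [] r _ = ≡.refl
  length-subScaled c (g ∷ gs) (y ∷ ys) (s≤s h) = ≡.cong suc (length-subScaled c gs ys h)

  -- `gt` is aligned with the front of `r`, which is k entries longer; hence the shift by Xᵏ.
  highFirst-subScaled : ∀ k c gt r → length r ≡ k ℕ.+ length gt →
    highFirst r ≈ highFirst (subScaled c gt r) + constP c * X ^ k * highFirst gt
  highFirst-subScaled k c [] r _ = sym (trans (+-congˡ (zeroʳ (constP c * X ^ k))) (+-identityʳ _))
  highFirst-subScaled k c (g ∷ gs) [] eq = contradiction (≡.trans eq (ℕ.+-suc k (length gs))) λ ()
  highFirst-subScaled k c (g ∷ gs) (y ∷ ys) eq = begin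
    highFirst ys + constP y * X ^ length ys
      ≈⟨ +-cong (highFirst-subScaled k c gs ys eq′) (*-congˡ {constP y} power) ⟩
    (hs + constP c * X ^ k * highFirst gs) + constP y * (X ^ k * X ^ length gs)
      ≈⟨ solve 7 (λ hs c xk hg y xg g → (hs :+ c :* xk :* hg) :+ y :* (xk :* xg)
           := hs :+ (y :- c :* g) :* (xk :* xg) :+ c :* xk :* (hg :+ g :* xg)) refl
           hs (constP c) (X ^ k) (highFirst gs) (constP y) (X ^ length gs) (constP g) ⟩
    hs + (constP y - constP c * constP g) * (X ^ k * X ^ length gs) + constP c * X ^ k * (highFirst gs + constP g * X ^ length gs)
      ≈⟨ +-congʳ {constP c * X ^ k * (highFirst gs + constP g * X ^ length gs)} (+-congˡ {hs} (*-cong constant power′)) ⟩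
    hs + constP (y ℚ.- c ℚ.* g) * X ^ length (subScaled c gs ys) + constP c * X ^ k * (highFirst gs + constP g * X ^ length gs) ∎
    where
    hs : Poly1
    hs = highFirst (subScaled c gs ys)
    eq′ : length ys ≡ k ℕ.+ length gs
    eq′ = ℕ.suc-injective (≡.trans eq (ℕ.+-suc k (length gs)))
    power : X ^ length ys ≈ X ^ k * X ^ length gs
    power = trans (reflexive (≡.cong (X ^_) eq′)) (^-homo-* X k (length gs))
    power′ : X ^ k * X ^ length gs ≈ X ^ length (subScaled c gs ys)
    power′ = trans (sym power) (reflexive (≡.cong (X ^_)
      (≡.sym (length-subScaled c gs ys (≡.subst (length gs ≤_) (≡.sym eq′) (ℕ.m≤n+m (length gs) k))))))
    constant : constP y - constP c * constP g ≈ constP (y ℚ.- c ℚ.* g)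
    constant = ∷-cong (≡.cong (λ z → y ℚ.- z) (ℚ.+-identityʳ (c ℚ.* g))) refl

  -- Every step removes one leading coefficient. After k steps `length gt` entries are left, so the
  -- remainder has degree below that of the divisor.
  division : ∀ k gt l → length l ≡ k ℕ.+ length gt →
    (length (divH k l gt) ≡ k) × ∃ λ rem → (length rem ≡ length gt) ×
    (highFirst l ≈ highFirst (1ℚ ∷ gt) * highFirst (divH k l gt) + highFirst rem)
  division zero gt l eq =
    ≡.refl , l , eq , sym (+-congʳ {highFirst l} (zeroʳ (highFirst (1ℚ ∷ gt))))
  division (suc k) gt (c ∷ r) eq = step (division k gt (subScaled c gt r) eq′)
    where
    eqr : length r ≡ k ℕ.+ length gt
    eqr = ℕ.suc-injective eq
    eq′ : length (subScaled c gt r) ≡ k ℕ.+ length gt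
    eq′ = ≡.trans (length-subScaled c gt r (≡.subst (length gt ≤_) (≡.sym eqr) (ℕ.m≤n+m (length gt) k))) eqr
    step : _ → _
    step (len , rem , len-rem , h) = ≡.cong suc len , rem , len-rem , (begin
      highFirst r + constP c * X ^ length r
        ≈⟨ +-cong (highFirst-subScaled k c gt r eqr) (*-congˡ {constP c} (trans (reflexive (≡.cong (X ^_) eqr)) (^-homo-* X k (length gt)))) ⟩
      (highFirst (subScaled c gt r) + constP c * X ^ k * highFirst gt) + constP c * (X ^ k * X ^ length gt)
        ≈⟨ +-congʳ {constP c * (X ^ k * X ^ length gt)} (+-congʳ {constP c * X ^ k * highFirst gt} h) ⟩
      ((hg * Q + highFirst rem) + constP c * X ^ k * highFirst gt) + constP c * (X ^ k * X ^ length gt)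
        ≈⟨ solve 6 (λ Q rem c xk gt xg → (((gt :+ con (+ 1) :* xg) :* Q :+ rem) :+ c :* xk :* gt) :+ c :* (xk :* xg)
             := (gt :+ con (+ 1) :* xg) :* (Q :+ c :* xk) :+ rem) refl Q (highFirst rem) (constP c) (X ^ k) (highFirst gt) (X ^ length gt) ⟩
      hg * (Q + constP c * X ^ k) + highFirst rem
        ≈⟨ +-congʳ {highFirst rem} (*-congˡ {hg} (+-congˡ {Q} (*-congˡ {constP c} (reflexive (≡.cong (X ^_) (≡.sym len)))))) ⟩
      hg * (Q + constP c * X ^ length (divH k (subScaled c gt r) gt)) + highFirst rem ∎)
      where
      hg Q : Poly1
      hg = highFirst (1ℚ ∷ gt)
      Q = highFirst (divH k (subScaled c gt r) gt)

  record Monic (f : Poly1) (n : ℕ) : Set where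
    constructor monic
    field
      top : coeff f n ≡ 1ℚ
      above : ∀ i → n < i → coeff f i ≡ 0ℚ
  open Monic

  1≢0 : 1ℚ ≢ 0ℚ
  1≢0 ()

  monic-cong : ∀ {f g n} → f ≈ g → Monic f n → Monic g n
  monic-cong f≈g (monic h h′) = monic (≡.trans (≡.sym (at f≈g _)) h) λ i n<i → ≡.trans (≡.sym (at f≈g i)) (h′ i n<i)

  monic-tail : ∀ {x f n} → Monic (x ∷ f) (suc n) → Monic f n
  monic-tail (monic h h′) = monic h λ i n<i → h′ (suc i) (s≤s n<i)

  coeff-*-∷ : ∀ f z g i → coeff (f * (z ∷ g)) (suc i) ≡ z ℚ.* coeff f (suc i) ℚ.+ coeff (f * g) i
  coeff-*-∷ f z g i = ≡.trans (at (*P-∷ f z g) (suc i)) (≡.trans (coeff-+ (scale z f) (0ℚ ∷ (f * g)) (suc i)) (≡.cong (ℚ._+ _) (coeff-scale z f (suc i))))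

  monic-* : ∀ g {f m n} → Monic f m → Monic g n → Monic (f * g) (m ℕ.+ n)
  monic-* [] _ (monic h _) = contradiction (≡.sym h) 1≢0
  monic-* (z ∷ g) {f} {m} {zero} hf (monic k k′) rewrite ℕ.+-identityʳ m = monic-cong (sym f*≈f) hf
    where
    f*≈f : f * (z ∷ g) ≈ f
    f*≈f = trans (*-congˡ {f} (coeffs λ { zero → k ; (suc i) → k′ (suc i) (s≤s z≤n) })) (*-identityʳ f)
  monic-* (z ∷ g) {f} {m} {suc n} hf hg rewrite ℕ.+-suc m n = monic top′ above′
    where
    ih : Monic (f * g) (m ℕ.+ n)
    ih = monic-* g hf (monic-tail hg)
    reduce : ∀ i → m ≤ i → coeff (f * (z ∷ g)) (suc i) ≡ coeff (f * g) i
    reduce i m≤i = ≡.trans (coeff-*-∷ f z g i)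
      (≡.trans (≡.cong (ℚ._+ _) (≡.trans (≡.cong (z ℚ.*_) (above hf (suc i) (s≤s m≤i))) (ℚ.*-zeroʳ z))) (ℚ.+-identityˡ _))
    top′ : coeff (f * (z ∷ g)) (suc (m ℕ.+ n)) ≡ 1ℚ
    top′ = ≡.trans (reduce (m ℕ.+ n) (ℕ.m≤m+n m n)) (top ih)
    above′ : ∀ i → suc (m ℕ.+ n) < i → coeff (f * (z ∷ g)) i ≡ 0ℚ
    above′ (suc i) (s≤s m+n<i) = ≡.trans (reduce i (ℕ.≤-trans (ℕ.m≤m+n m n) (ℕ.<⇒≤ m+n<i))) (above ih i m+n<i)

  monic-snoc : ∀ l → Monic (l ++ [ 1ℚ ]) (length l)
  monic-snoc [] = monic ≡.refl λ { (suc i) _ → ≡.refl }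
  monic-snoc (x ∷ l) = monic (top (monic-snoc l)) λ { (suc i) (s≤s h) → above (monic-snoc l) i h }

  -- Nonzero multiples of `G` have degree at least n. As lists may end in zeros, no leading
  -- coefficient of `Z` is at hand; the tail of `Z` is shown to vanish before its head.
  monic-low : ∀ {G n} → Monic G n → ∀ Z → (∀ i → n ≤ i → coeff (G * Z) i ≡ 0ℚ) → Z ≈ 0#
  monic-low hG [] _ = refl
  monic-low {G} {n} hG (z ∷ Z) low = trans (∷-cong z≡0 Z≈0) zero∷zero
    where
    Z≈0 : Z ≈ 0#
    Z≈0 = monic-low hG Z (λ i n≤i → ≡.trans (≡.sym (≡.trans (coeff-*-∷ G z Z i)
      (≡.trans (≡.cong (ℚ._+ _) (≡.trans (≡.cong (z ℚ.*_) (above hG (suc i) (s≤s n≤i))) (ℚ.*-zeroʳ z))) (ℚ.+-identityˡ _))))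
      (low (suc i) (ℕ.m≤n⇒m≤1+n n≤i)))
    G*≈ : G * (z ∷ Z) ≈ scale z G
    G*≈ = trans (*P-∷ G z Z) (trans (+-congˡ (trans (∷-cong ≡.refl (trans (*-congˡ {G} Z≈0) (*P-zeroʳ G))) zero∷zero)) (+-identityʳ _))
    z≡0 : z ≡ 0ℚ
    z≡0 = ≡.trans (≡.sym (≡.trans (≡.cong (z ℚ.*_) (top hG)) (ℚ.*-identityʳ z)))
      (≡.trans (≡.sym (≡.trans (at G*≈ n) (coeff-scale z G n))) (low n ℕ.≤-refl))

  trim-zero : ∀ f → f ≈ 0# → trim f ≡ []
  trim-zero [] _ = ≡.refl
  trim-zero (x ∷ f) h with trim f | trim-zero f (coeffs λ i → at h (suc i))
  ... | [] | _ with x ℚ.≟ 0ℚ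
  ...   | yes _ = ≡.refl
  ...   | no x≢0 = contradiction (at h 0) x≢0

  trim≈ : ∀ f → trim f ≈ f
  trim≈ [] = refl
  trim≈ (x ∷ f) with trim f | trim≈ f
  ... | g ∷ gs | ih = ∷-cong ≡.refl ih
  ... | [] | ih with x ℚ.≟ 0ℚ
  ...   | yes x≡0 = coeffs λ { zero → ≡.sym x≡0 ; (suc i) → at ih i }
  ...   | no _ = ∷-cong ≡.refl ih

  trim-monic : ∀ f {n} → Monic f n → ∃ λ l → (trim f ≡ l ++ [ 1ℚ ]) × (length l ≡ n)
  trim-monic [] (monic h _) = contradiction (≡.sym h) 1≢0
  trim-monic (x ∷ f) {zero} (monic h h′) with trim f | trim-zero f (coeffs λ i → h′ (suc i) (s≤s z≤n))
  ... | [] | _ with x ℚ.≟ 0ℚ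
  ...   | yes x≡0 = contradiction (≡.trans (≡.sym h) x≡0) 1≢0
  ...   | no _ = [] , ≡.cong [_] h , ≡.refl
  trim-monic (x ∷ f) {suc n} hf with trim f | trim-monic f (monic-tail hf)
  ... | .([] ++ [ 1ℚ ]) | [] , ≡.refl , len = x ∷ [] , ≡.refl , ≡.cong suc len
  ... | .((y ∷ l) ++ [ 1ℚ ]) | y ∷ l , ≡.refl , len = x ∷ y ∷ l , ≡.refl , ≡.cong suc len

  reverse-trim-monic : ∀ f {n} → Monic f n → ∃ λ l → (reverse (trim f) ≡ 1ℚ ∷ l) × (length l ≡ n)
  reverse-trim-monic f hf with trim f | trim-monic f hf
  ... | .(l ++ [ 1ℚ ]) | l , ≡.refl , len = reverse l , List.reverse-++ l [ 1ℚ ] , ≡.trans (List.length-reverse l) len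

  highFirst-trim : ∀ f l → reverse (trim f) ≡ l → highFirst l ≈ f
  highFirst-trim f l eq = begin
    highFirst l      ≈⟨ reverse≈ l ⟨
    reverse l      ≡⟨ ≡.cong reverse (≡.sym eq) ⟩
    reverse (reverse (trim f)) ≡⟨ List.reverse-involutive (trim f) ⟩
    trim f      ≈⟨ trim≈ f ⟩
    f                          ∎

  coeff-highFirst : ∀ l i → length l ≤ i → coeff (highFirst l) i ≡ 0ℚ
  coeff-highFirst l i h = ≡.trans (≡.sym (at (reverse≈ l) i)) (beyond (reverse l) i (≡.subst (_≤ i) (≡.sym (List.length-reverse l)) h))
    where
    beyond : ∀ l i → length l ≤ i → coeff l i ≡ 0ℚ
    beyond [] i _ = ≡.refl
    beyond (x ∷ l) (suc i) (s≤s h) = beyond l i h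

  -- Ensures that the truncated subtraction in the number of division steps is a true one.
  monic-≤ : ∀ {F G m n} → Monic F m → Monic G n → G ∣ F → n ≤ m
  monic-≤ {F} {G} {m} {n} (monic h h′) hG (H , F≈GH) with n ℕ.≤? m
  ... | yes n≤m = n≤m
  ... | no n≰m = contradiction (≡.trans (≡.sym h) (at F≈0 m)) 1≢0
    where
    F≈0 : F ≈ 0#
    F≈0 = trans F≈GH (trans (*-congˡ {G} (monic-low hG H λ i n≤i →
      ≡.trans (≡.sym (at F≈GH i)) (h′ i (ℕ.<-≤-trans (ℕ.≰⇒> n≰m) n≤i)))) (zeroʳ G))

  -- If F = GH and Q is the computed quotient, G(H - Q) is the remainder, of degree below n, so that
  -- H = Q by `monic-low`.
  divMonic-exact : ∀ {F G m n} → Monic F m → Monic G n → G ∣ F → G * divMonic F G ≈ F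
  divMonic-exact {F} {G} {m} {n} hF hG G∣F = step (reverse-trim-monic F hF) (reverse-trim-monic G hG)
    where
    step : (∃ λ l → (reverse (trim F) ≡ 1ℚ ∷ l) × (length l ≡ m)) → (∃ λ l → (reverse (trim G) ≡ 1ℚ ∷ l) × (length l ≡ n)) →
      G * divMonic F G ≈ F
    step (r , er , lr) (gt , eg , lg) = finish (proj₂ (division k gt (1ℚ ∷ r) len)) G∣F
      where
      k : ℕ
      k = suc (length r ℕ.∸ length gt)
      len : length (1ℚ ∷ r) ≡ k ℕ.+ length gt
      len = ≡.cong suc (≡.sym (ℕ.m∸n+n≡m (≡.subst₂ _≤_ (≡.sym lg) (≡.sym lr) (monic-≤ hF hG G∣F))))
      Q : Poly1
      Q = highFirst (divH k (1ℚ ∷ r) gt)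
      Q≈ : divMonic F G ≈ Q
      Q≈ = trans (reflexive (divMonic-divH F G 1ℚ r 1ℚ gt er eg)) (reverse≈ (divH k (1ℚ ∷ r) gt))
      finish : (∃ λ rem → (length rem ≡ length gt) × (highFirst (1ℚ ∷ r) ≈ highFirst (1ℚ ∷ gt) * Q + highFirst rem)) →
        G ∣ F → G * divMonic F G ≈ F
      finish (rem , lrem , h) (H , F≈GH) = begin
        G * divMonic F G    ≈⟨ *-congˡ {G} Q≈ ⟩
        G * Q      ≈⟨ solve 3 (λ G Q H → G :* Q := G :* H :- G :* (H :- Q)) refl G Q H ⟩
        G * H - G * (H - Q) ≈⟨ +-cong {y = F} (sym F≈GH) (-‿cong {G * (H - Q)} {G * 0#} (*-congˡ {G} H-Q≈0)) ⟩
        F - G * 0#      ≈⟨ solve 2 (λ F G → F :- G :* con (+ 0) := F) refl F G ⟩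
        F                   ∎
        where
        GH-Q : G * (H - Q) ≈ highFirst rem
        GH-Q = begin
          G * (H - Q)      ≈⟨ solve 3 (λ G H Q → G :* (H :- Q) := G :* H :- G :* Q) refl G H Q ⟩
          G * H - G * Q      ≈⟨ +-congʳ { - (G * Q)} F≈GH ⟨
          F - G * Q      ≈⟨ +-cong (sym (highFirst-trim F _ er)) (-‿cong {G * Q} {hg * Q} (*-congʳ {Q} (sym (highFirst-trim G _ eg)))) ⟩
          highFirst (1ℚ ∷ r) - hg * Q      ≈⟨ +-congʳ { - (hg * Q)} h ⟩
          hg * Q + highFirst rem - hg * Q  ≈⟨ solve 2 (λ x y → x :+ y :- x := y) refl (hg * Q) (highFirst rem) ⟩
          highFirst rem                    ∎
          where
          hg : Poly1
          hg = highFirst (1ℚ ∷ gt)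
        H-Q≈0 : H - Q ≈ 0#
        H-Q≈0 = monic-low hG (H - Q) λ i n≤i → ≡.trans (at GH-Q i)
          (coeff-highFirst rem i (≡.subst (_≤ i) (≡.sym (≡.trans lrem lg)) n≤i))

  divMonic-monic : ∀ {F G m n} → Monic F m → Monic G n → ∃ (Monic (divMonic F G))
  divMonic-monic {F} {G} hF hG = step (reverse-trim-monic F hF) (reverse-trim-monic G hG)
    where
    step : (∃ λ l → (reverse (trim F) ≡ 1ℚ ∷ l) × _) → (∃ λ l → (reverse (trim G) ≡ 1ℚ ∷ l) × _) → ∃ (Monic (divMonic F G))
    step (r , er , lr) (gt , eg , lg) = length (reverse l) , ≡.subst (λ f → Monic f (length (reverse l))) (≡.sym eq) (monic-snoc (reverse l))
      where
      l : List ℚ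
      l = divH (length r ℕ.∸ length gt) (subScaled 1ℚ gt r) gt
      eq : divMonic F G ≡ reverse l ++ [ 1ℚ ]
      eq = ≡.trans (divMonic-divH F G 1ℚ r 1ℚ gt er eg)
        (List.unfold-reverse 1ℚ l)

  monic-monoP : ∀ n → Monic (monoP n) n
  monic-monoP zero = monic ≡.refl λ { (suc i) _ → ≡.refl }
  monic-monoP (suc n) = monic (top (monic-monoP n)) λ { (suc i) (s≤s h) → above (monic-monoP n) i h }

  Xⁿ⁺¹-1 : ℕ → Poly1
  Xⁿ⁺¹-1 n = monoP (suc n) P1.-P P1.oneP

  monic-Xⁿ⁺¹-1 : ∀ n → Monic (Xⁿ⁺¹-1 n) (suc n)
  monic-Xⁿ⁺¹-1 n = monic (≡.trans (same n) (top (monic-monoP (suc n))))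
    λ { (suc i) h → ≡.trans (same i) (above (monic-monoP (suc n)) (suc i) h) }
    where
    same : ∀ i → coeff (Xⁿ⁺¹-1 n) (suc i) ≡ coeff (monoP (suc n)) (suc i)
    same i = ≡.trans (coeff-+ (monoP (suc n)) (P1.-P_ P1.oneP) (suc i)) (ℚ.+-identityʳ _)

  Φ : ℕ → Poly1
  Φ = cyclotomic

  open Cyclotomy ℚ[q]-ring X Φ

  cyclotomic-suc : ∀ n → cyclotomic (suc n) ≡ divMonic (Xⁿ⁺¹-1 n) (prodDiv n 1 (cycTable n))
  cyclotomic-suc n = ≡.trans (cyclotomic≡ .holds (suc n)) (last (cycTable n) P1.oneP)
    where
    last : ∀ l x {y} → lastOr x (l ++ [ y ]) ≡ y
    last [] x = ≡.refl
    last (z ∷ l) x = last l z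

  length-cycTable : ∀ n → length (cycTable n) ≡ n
  length-cycTable zero = ≡.refl
  length-cycTable (suc n) = ≡.trans (List.length-++ (cycTable n)) (≡.trans (ℕ.+-comm _ 1) (≡.cong suc (length-cycTable n)))

  prodDiv-yes : ∀ N e ps y → e ℕ.+ length ps ∣ℕ suc N → prodDiv N e (ps ++ [ y ]) ≈ prodDiv N e ps * y
  prodDiv-yes N e [] y h rewrite ℕ.+-identityʳ e with e ∣ℕ? suc N
  ... | yes _ = *-comm y P1.oneP
  ... | no ¬h = contradiction h ¬h
  prodDiv-yes N e (p ∷ ps) y h rewrite ℕ.+-suc e (length ps) with e ∣ℕ? suc N
  ... | yes _ = trans (*-congˡ {p} (prodDiv-yes N (suc e) ps y h)) (sym (*-assoc p (prodDiv N (suc e) ps) y))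
  ... | no _ = prodDiv-yes N (suc e) ps y h

  prodDiv-no : ∀ N e ps y → ¬ (e ℕ.+ length ps ∣ℕ suc N) → prodDiv N e (ps ++ [ y ]) ≈ prodDiv N e ps
  prodDiv-no N e [] y h rewrite ℕ.+-identityʳ e with e ∣ℕ? suc N
  ... | yes h′ = contradiction h′ h
  ... | no _ = refl
  prodDiv-no N e (p ∷ ps) y h rewrite ℕ.+-suc e (length ps) with e ∣ℕ? suc N
  ... | yes _ = *-congˡ {p} (prodDiv-no N (suc e) ps y h)
  ... | no _ = prodDiv-no N (suc e) ps y h

  -- The two products consume the table from opposite ends: `prodDiv` from the smallest index,
  -- `properProduct` from the largest.
  prodDiv≈ : ∀ N m → prodDiv N 1 (cycTable m) ≈ properProduct (suc N) m
  prodDiv≈ N zero = refl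
  prodDiv≈ N (suc m) with suc m ∣ℕ? suc N
  ... | yes h = trans (prodDiv-yes N 1 (cycTable m) _ (≡.subst (λ k → suc k ∣ℕ suc N) (≡.sym (length-cycTable m)) h))
                  (*-cong (prodDiv≈ N m) (reflexive (≡.sym (cyclotomic-suc m))))
  ... | no h = trans (prodDiv-no N 1 (cycTable m) _ (λ h′ → h (≡.subst (λ k → suc k ∣ℕ suc N) (length-cycTable m) h′))) (prodDiv≈ N m)

  monic-properProduct : ∀ N m → (∀ e → 0 < e → e ≤ m → ∃ (Monic (Φ e))) → ∃ (Monic (properProduct N m))
  monic-properProduct N zero _ = 0 , monic ≡.refl λ { (suc i) _ → ≡.refl }
  monic-properProduct N (suc m) h with suc m ∣ℕ? N
  ... | no _ = monic-properProduct N m (λ e 0<e e≤m → h e 0<e (ℕ.m≤n⇒m≤1+n e≤m))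
  ... | yes _ = _ , monic-* (Φ (suc m)) (proj₂ (monic-properProduct N m (λ e 0<e e≤m → h e 0<e (ℕ.m≤n⇒m≤1+n e≤m)))) (proj₂ (h (suc m) (s≤s z≤n) ℕ.≤-refl))

  monic-Φ : ∀ n → 0 < n → ∃ (Monic (Φ n))
  monic-Φ = <-rec _ step
    where
    step : ∀ n → (∀ {e} → e < n → 0 < e → ∃ (Monic (Φ e))) → 0 < n → ∃ (Monic (Φ n))
    step (suc n) earlier _ = ≡.subst (λ f → ∃ (Monic f)) (≡.sym (cyclotomic-suc n))
      (divMonic-monic {Xⁿ⁺¹-1 n} {prodDiv n 1 (cycTable n)} (monic-Xⁿ⁺¹-1 n) (monic-cong (sym (prodDiv≈ n n))
        (proj₂ (monic-properProduct (suc n) n (λ e 0<e e≤n → earlier (s≤s e≤n) 0<e)))))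

  quotient : ∀ n → properProduct (suc n) n ∣ X ^ suc n - 1# → properProduct (suc n) n * Φ (suc n) ≈ X ^ suc n - 1#
  quotient n h = begin
    properProduct (suc n) n * Φ (suc n)
      ≈⟨ *-cong (sym (prodDiv≈ n n)) (reflexive (cyclotomic-suc n)) ⟩
    G * divMonic F G
      ≈⟨ divMonic-exact {F} {G} (monic-Xⁿ⁺¹-1 n) (monic-cong (sym (prodDiv≈ n n)) (proj₂ (monic-properProduct (suc n) n (λ e 0<e _ → monic-Φ e 0<e)))) (G∣F h) ⟩
    F ≈⟨ F≈ ⟩
    X ^ suc n - 1# ∎
    where
    F G : Poly1
    F = Xⁿ⁺¹-1 n
    G = prodDiv n 1 (cycTable n)
    F≈ : F ≈ X ^ suc n - 1#
    F≈ = +-congʳ (monoP≈ (suc n))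
    G∣F : properProduct (suc n) n ∣ X ^ suc n - 1# → G ∣ F
    G∣F (H , eq) = H , trans F≈ (trans eq (*-congʳ {H} (sym (prodDiv≈ n n))))

open CyclotomicPolynomials using (ℚring; ℚ[q]-ring; X; quotient; 1≢0; module ℚ[q])

-- Regularity modulo constant polynomials

module PolynomialRegularity (R : CommutativeRing 0ℓ 0ℓ) where
  private module R = CommutativeRing R
  open IntegerSolver R
  open PolynomialRing R
  open CommutativeRing polynomialRing using (_≈_; _*_; sym; trans)
  private
    module ∣R = Regularity R
    module ∣P = Regularity polynomialRing
  open import Relation.Binary.Reasoning.Setoid R.setoid

  const-∣⇒ : ∀ {c f} → constP c ∣P.∣ f → ∀ i → c ∣R.∣ coeff f i
  const-∣⇒ {c} {f} (g , h) i = coeff g i , R.trans (at h i) (R.trans (at (constP-* c g) i) (coeff-scale c g i))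

  const-∣⇐ : ∀ {c} f → (∀ i → c ∣R.∣ coeff f i) → constP c ∣P.∣ f
  const-∣⇐ [] h = [] , ≋-sym zero∷zero
  const-∣⇐ {c} (x ∷ f) h = extend (h 0) (const-∣⇐ f (λ i → h (suc i)))
    where
    extend : c ∣R.∣ x → constP c ∣P.∣ f → constP c ∣P.∣ x ∷ f
    extend (y , x≈cy) (g , f≈cg) = y ∷ g , trans (∷-cong x≈cy (trans f≈cg (constP-* c g))) (sym (constP-* c (y ∷ g)))

  -- If c divides all coefficients of gz, it divides g₀z₀ and hence z₀; removing the contribution of
  -- z₀ leaves the same situation for the tail of z.
  regular-constant-term : ∀ {c} g → ∣R.Regular c (coeff g 0) → ∣P.Regular (constP c) g
  regular-constant-term {c} g h z hz = const-∣⇐ z (divides z (const-∣⇒ hz))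
    where
    divides : ∀ z → (∀ i → c ∣R.∣ coeff (g * z) i) → ∀ i → c ∣R.∣ coeff z i
    divides [] _ i = ∣R.∣-zero R.refl
    divides (z₀ ∷ z) hz = λ { zero → c∣z₀ ; (suc i) → divides z later i }
      where
      c∣z₀ : c ∣R.∣ z₀
      c∣z₀ = h z₀ (∣R.∣-resp (begin
        coeff (g * (z₀ ∷ z)) 0      ≈⟨ at (*P-∷ g z₀ z) 0 ⟩
        coeff (scale z₀ g +P (R.0# ∷ (g *P z))) 0      ≈⟨ coeff-+ (scale z₀ g) (R.0# ∷ (g *P z)) 0 ⟩
        coeff (scale z₀ g) 0 R.+ R.0#      ≈⟨ R.+-identityʳ _ ⟩
        coeff (scale z₀ g) 0      ≈⟨ coeff-scale z₀ g 0 ⟩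
        z₀ R.* coeff g 0      ≈⟨ R.*-comm _ _ ⟩
        coeff g 0 R.* z₀                                       ∎) (hz 0))
      later : ∀ i → c ∣R.∣ coeff (g * z) i
      later i = ∣R.∣-resp (begin
        coeff (g * (z₀ ∷ z)) (suc i) R.+ R.- coeff g (suc i) R.* z₀
          ≈⟨ R.+-congʳ (R.trans (at (*P-∷ g z₀ z) (suc i)) (R.trans (coeff-+ (scale z₀ g) (R.0# ∷ (g *P z)) (suc i)) (R.+-congʳ (coeff-scale z₀ g (suc i))))) ⟩
        (z₀ R.* coeff g (suc i) R.+ coeff (g * z) i) R.+ R.- coeff g (suc i) R.* z₀
          ≈⟨ solve 3 (λ z g x → (z :* g :+ x) :+ :- g :* z := x) R.refl z₀ (coeff g (suc i)) (coeff (g * z) i) ⟩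
        coeff (g * z) i ∎)
        (∣R.∣-+ (hz (suc i)) (∣R.∣-* _ c∣z₀))

  regular-var : ∀ {c} → ∣P.Regular (constP c) (monoP 1)
  regular-var z hz = const-∣⇐ z (λ i → ∣R.∣-resp (at (var*≋ z) (suc i)) (const-∣⇒ hz (suc i)))

module ℚ[q]Regularity where
  open CommutativeRing ℚ[q]-ring
  open IntegerSolver ℚ[q]-ring
  open Units ℚ[q]-ring
  open Regularity ℚ[q]-ring
  open PolynomialRegularity ℚring
  open PolynomialRing ℚring using (∷-cong; zero∷zero; constP; constP-*; var*≋)
  open import Algebra.Properties.Semiring.Exp semiring using (_^_)
  open Cyclotomy ℚ[q]-ring X cyclotomic

  -- The constant term is -1; to use it, the modulus 0 is read as the constant polynomial 0.
  regular-Xⁿ-1 : ∀ i → Regular 0# (X ^ suc i - 1#)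
  regular-Xⁿ-1 i = regular-cong {0#} {(0ℚ ∷ (X ^ i)) - 1#} {X ^ suc i - 1#} (sym (+-congʳ { - 1#} (var*≋ (X ^ i))))
    (regular-modulus {constP 0ℚ} {0#} {(0ℚ ∷ (X ^ i)) - 1#} zero∷zero
      (regular-constant-term ((0ℚ ∷ (X ^ i)) - 1#) (ℚ∣.regular-neg {0ℚ} {1ℚ} (ℚ∣.regular-1 {0ℚ}))))
    where module ℚ∣ = Regularity ℚring

  regular-X : Regular 0# X
  regular-X = regular-modulus {constP 0ℚ} {0#} {X} zero∷zero (regular-var {0ℚ})

  natℚ : ℕ → ℚ
  natℚ zero = 0ℚ
  natℚ (suc k) = 1ℚ ℚ.+ natℚ k

  nat≈ : ∀ k → nat k ≈ constP (natℚ k)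
  nat≈ zero = sym zero∷zero
  nat≈ (suc k) = +-congˡ {1#} (nat≈ k)

  natℚ-nonNegative : ∀ k → 0ℚ ℚ.≤ natℚ k
  natℚ-nonNegative zero = ℚ.≤-refl
  natℚ-nonNegative (suc k) = ℚ.+-mono-≤ {0ℚ} {1ℚ} (ℚ.*≤* (ℤ.+≤+ z≤n)) (natℚ-nonNegative k)

  nat-unit : ∀ k → Unit (nat (suc k))
  nat-unit k = constP (ℚ.1/ c) , trans (*-congʳ {constP (ℚ.1/ c)} (nat≈ (suc k)))
    (trans (constP-* c (constP (ℚ.1/ c))) (∷-cong (ℚ.*-inverseʳ c) refl))
    where
    c : ℚ
    c = natℚ (suc k)
    positive : 0ℚ ℚ.< c
    positive = ℚ.<-≤-trans {0ℚ} {1ℚ} (ℚ.*<* (ℤ.+<+ (s≤s z≤n))) (ℚ.+-monoʳ-≤ 1ℚ (natℚ-nonNegative k))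
    instance
      c≢0 : ℚ.NonZero c
      c≢0 = ℚ.>-nonZero positive

  Φ-∣-Xⁿ-1 : ∀ n → cyclotomic (suc n) ∣ X ^ suc n - 1#
  Φ-∣-Xⁿ-1 = Φ-divides quotient regular-Xⁿ-1 nat-unit

  regular-Φ-Xⁱ-1 : ∀ n i → ¬ (suc n ∣ℕ i) → Regular (cyclotomic (suc n)) (X ^ i - 1#)
  regular-Φ-Xⁱ-1 n i h = comaximal-regular (comaximal-sym (Φ-comaximal-power quotient regular-Xⁿ-1 nat-unit n i h))

-- Regularity modulo 1 - aqⁿ and a - qⁿ

module Moduli (B : CommutativeRing 0ℓ 0ℓ) (q a : CommutativeRing.Carrier B) (n : ℕ) where
  open CommutativeRing B
  open IntegerSolver B
  open Regularity B
  open import Algebra.Properties.Semiring.Exp semiring using (_^_; ^-homo-*)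
  open import Relation.Binary.Reasoning.Setoid setoid

  L₁ L₂ : Carrier
  L₁ = 1# - a * q ^ n
  L₂ = a - q ^ n

  -- The factors from which the denominators of both sides are built. At s = n the last two would be
  -- `L₁` and `L₂` themselves.
  record Denominators (L : Carrier) : Set where
    field
      reg-q : Regular L q
      reg-a : Regular L a
      reg-power : ∀ i → ¬ (n ∣ℕ i) → Regular L (1# - q ^ i)
      reg-1-aq : ∀ s → s ≢ n → Regular L (1# - a * q ^ s)
      reg-a-q : ∀ s → s ≢ n → Regular L (a - q ^ s)

  power-difference : ∀ {L} → Regular L q → (∀ i → Regular L (1# - q ^ suc i)) →
    ∀ {r s} → r < s → Regular L (q ^ r - q ^ s)
  power-difference hq h {r} {s} r<s = regular-cong (begin
      q ^ r * (1# - q ^ suc k)      ≈⟨ solve 2 (λ x y → x :* (con (+ 1) :- y) := x :- x :* y) refl _ _ ⟩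
      q ^ r - q ^ r * q ^ suc k      ≈⟨ +-congˡ (-‿cong (^-homo-* q r (suc k))) ⟨
      q ^ r - q ^ (r ℕ.+ suc k)      ≡⟨ ≡.cong (λ j → q ^ r - q ^ j) (≡.trans (ℕ.+-suc r k) (ℕ.m+[n∸m]≡n r<s)) ⟩
      q ^ r - q ^ s                  ∎)
    (regular-* (regular-^ r hq) (h k))
    where
    k : ℕ
    k = s ℕ.∸ suc r

  power-distinct : ∀ {L} → Regular L q → (∀ i → Regular L (1# - q ^ suc i)) →
    ∀ {r s} → r ≢ s → Regular L (q ^ r - q ^ s)
  power-distinct hq h {r} {s} r≢s with ℕ.<-cmp r s
  ... | tri< r<s _ _ = power-difference hq h r<s
  ... | tri≈ _ r≡s _ = contradiction r≡s r≢s
  ... | tri> _ _ s<r = regular-cong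
    (solve 2 (λ x y → :- (x :- y) := y :- x) refl _ _) (regular-neg (power-difference hq h s<r))

  nonmultiple : ∀ {i} → ¬ (n ∣ℕ i) → ∃ λ j → i ≡ suc j
  nonmultiple {zero} h = contradiction (n ℕ∣.∣0) h
  nonmultiple {suc j} _ = j , ≡.refl

  positive-power : ∀ {L} → (∀ i → Regular L (1# - q ^ suc i)) → ∀ i → ¬ (n ∣ℕ i) → Regular L (1# - q ^ i)
  positive-power h i n∤i with nonmultiple n∤i
  ... | j , ≡.refl = h j

  module _
    (q-0 : Regular 0# q)
    (power-0 : ∀ i → Regular 0# (1# - q ^ suc i))
    (q-L₁ : Regular q L₁)
    (q-a : Regular q a)
    (power-L₁ : ∀ i → Regular (1# - q ^ suc i) L₁)
    (power-L₂ : ∀ i → Regular (1# - q ^ suc i) L₂)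
    (0<n : 0 < n)
    where

    q-L₂ : Regular q L₂
    q-L₂ = regular-combination 1# (q ^ ℕ.pred n) (begin
      a      ≈⟨ solve 2 (λ a y → a := con (+ 1) :* (a :- y) :+ y) refl a (q ^ n) ⟩
      1# * (a - q ^ n) + q ^ n      ≡⟨ ≡.cong (λ m → 1# * (a - q ^ n) + q ^ m) (≡.sym (ℕ.suc-pred n {{ℕ.>-nonZero 0<n}})) ⟩
      1# * (a - q ^ n) + q * q ^ ℕ.pred n    ≈⟨ +-congˡ (*-comm _ _) ⟩
      1# * (a - q ^ n) + q ^ ℕ.pred n * q    ∎) q-a

    q-regular₁ : Regular L₁ q
    q-regular₁ = regular-swap q-0 q-L₁

    q-regular₂ : Regular L₂ q
    q-regular₂ = regular-swap q-0 q-L₂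

    power-regular₁ : ∀ i → Regular L₁ (1# - q ^ suc i)
    power-regular₁ i = regular-swap (power-0 i) (power-L₁ i)

    power-regular₂ : ∀ i → Regular L₂ (1# - q ^ suc i)
    power-regular₂ i = regular-swap (power-0 i) (power-L₂ i)

    power-sum : ∀ {L} → (∀ i → Regular L (1# - q ^ suc i)) → ∀ s → Regular L (1# - q ^ n * q ^ s)
    power-sum h s = regular-cong (begin
      1# - q ^ suc (ℕ.pred n ℕ.+ s)    ≡⟨ ≡.cong (λ j → 1# - q ^ (j ℕ.+ s)) (ℕ.suc-pred n {{ℕ.>-nonZero 0<n}}) ⟩
      1# - q ^ (n ℕ.+ s)      ≈⟨ +-congˡ (-‿cong (^-homo-* q n s)) ⟩
      1# - q ^ n * q ^ s               ∎) (h (ℕ.pred n ℕ.+ s))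

    -- Setting a = qⁿ gives 1 - q^(n+s), where n + s > 0. The case s = n says that `L₁` is regular
    -- modulo `L₂`.
    1-aq-regular₂ : ∀ s → Regular L₂ (1# - a * q ^ s)
    1-aq-regular₂ s = regular-combination 1# (q ^ s)
      (solve 3 (λ a x y → con (+ 1) :- x :* y := con (+ 1) :* (con (+ 1) :- a :* y) :+ y :* (a :- x)) refl a (q ^ n) (q ^ s))
      (power-sum power-regular₂ s)

    denominators₁ : Denominators L₁
    denominators₁ = record
      { reg-q = q-regular₁
      ; reg-a = regular-combination (q ^ n) 1#
          (solve 2 (λ a x → con (+ 1) := x :* a :+ con (+ 1) :* (con (+ 1) :- a :* x)) refl a (q ^ n)) regular-1
      ; reg-power = positive-power power-regular₁
      -- Modulo `L₁` one has aqⁿ = 1, so that qⁿ(1 - aqˢ) becomes qⁿ - qˢ.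
      ; reg-1-aq = λ s s≢n → regular-combination (q ^ n) (- q ^ s)
          (solve 3 (λ a x y → x :- y := x :* (con (+ 1) :- a :* y) :+ :- y :* (con (+ 1) :- a :* x)) refl a (q ^ n) (q ^ s))
          (power-distinct q-regular₁ power-regular₁ (λ n≡s → s≢n (≡.sym n≡s)))
      ; reg-a-q = λ s _ → regular-combination (q ^ n) 1#
          (solve 3 (λ a x y → con (+ 1) :- x :* y := x :* (a :- y) :+ con (+ 1) :* (con (+ 1) :- a :* x)) refl a (q ^ n) (q ^ s))
          (power-sum power-regular₁ s)
      }

    denominators₂ : Denominators L₂
    denominators₂ = record
      { reg-q = q-regular₂
      ; reg-a = regular-combination 1# (- 1#)
          (solve 2 (λ a x → x := con (+ 1) :* a :+ :- con (+ 1) :* (a :- x)) refl a (q ^ n)) (regular-^ n q-regular₂)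
      ; reg-power = positive-power power-regular₂
      ; reg-1-aq = λ s _ → 1-aq-regular₂ s
      ; reg-a-q = λ s s≢n → regular-combination 1# (- 1#)
          (solve 3 (λ a x y → x :- y := con (+ 1) :* (a :- y) :+ :- con (+ 1) :* (a :- x)) refl a (q ^ n) (q ^ s))
          (power-distinct q-regular₂ power-regular₂ (λ n≡s → s≢n (≡.sym n≡s)))
      }

module ℚ[q][a] = PolynomialRing ℚ[q]-ring

-- Applying the construction twice reproduces `P1` and `P2`, so the ring operations are by
-- definition those of the statement.
ℚ[q][a]-ring : CommutativeRing 0ℓ 0ℓ
ℚ[q][a]-ring = ℚ[q][a].polynomialRing

-- Regular elements of ℚ[q,a]

module TwoVariables where
  open CommutativeRing ℚ[q][a]-ring
  open Regularity ℚ[q][a]-ring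
  open PolynomialRegularity ℚ[q]-ring
  open import Algebra.Properties.Semiring.Exp semiring using (_^_)
  open ℚ[q][a] using (constP; ∷-cong; zero∷zero; constP-*; var*≋)
  private
    module A = CommutativeRing ℚ[q]-ring
    module ∣A = Regularity ℚ[q]-ring
    module ^A = Algebra.Properties.Semiring.Exp A.semiring
    open IntegerSolver ℚ[q]-ring using (solve; _:=_; _:+_; _:*_; _:-_; :-_; con)

  qv^≈ : ∀ k → qv ^ k ≈ constP (X ^A.^ k)
  qv^≈ zero = refl
  qv^≈ (suc k) = trans (*-congˡ {qv} (qv^≈ k)) (constP-* X (constP (X ^A.^ k)))

  1-qv^≈ : ∀ k → constP (A.1# A.- X ^A.^ k) ≈ 1# - qv ^ k
  1-qv^≈ k = +-congˡ {1#} (-‿cong (sym (qv^≈ k)))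

  module _ (f : Poly1) where

    embed-regular : ∀ {h} → ∣A.Regular f h → Regular (constP f) (constP h)
    embed-regular {h} = regular-constant-term (constP h)

    power-regular : ∀ k → ∣A.Regular f (A.1# A.- X ^A.^ k) → Regular (constP f) (1# - qv ^ k)
    power-regular k h = regular-cong {constP f} {constP (A.1# A.- X ^A.^ k)} {1# - qv ^ k} (1-qv^≈ k) (embed-regular {A.1# A.- X ^A.^ k} h)

    -- The constant term in a is 1, so any modulus in q alone will do. For a - qˢ it is -qˢ, which
    -- requires q to be regular modulo f.
    1-aq-regular : ∀ s → Regular (constP f) (1# - av * qv ^ s)
    1-aq-regular s = regular-cong {constP f} {1# - ([] ∷ (qv ^ s))} {1# - av * qv ^ s}
      (+-congˡ {1#} (-‿cong (sym (var*≋ (qv ^ s)))))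
      (regular-constant-term (1# - ([] ∷ (qv ^ s))) (∣A.regular-1 {f}))

    a-q-regular : ∣A.Regular f X → ∀ s → Regular (constP f) (av - qv ^ s)
    a-q-regular h s = regular-cong {constP f} {av - constP (X ^A.^ s)} {av - qv ^ s}
      (+-congˡ {av} (-‿cong (sym (qv^≈ s))))
      (regular-constant-term (av - constP (X ^A.^ s)) (∣A.regular-neg {f} {X ^A.^ s} (∣A.regular-^ {f} {X} s h)))

  X-regular-mod-power : ∀ i → ∣A.Regular (A.1# A.- X ^A.^ suc i) X
  X-regular-mod-power i = ∣A.regular-combination {A.1# A.- X ^A.^ suc i} {X} {A.1#} (X ^A.^ i) A.1#
    (solve 2 (λ x y → con (+ 1) := y :* x :+ con (+ 1) :* (con (+ 1) :- x :* y)) A.refl X (X ^A.^ i))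
    (∣A.regular-1 {A.1# A.- X ^A.^ suc i})

  flip-regular : ∀ f k → ∣A.Regular f (X ^A.^ k A.- A.1#) → ∣A.Regular f (A.1# A.- X ^A.^ k)
  flip-regular f k h = ∣A.regular-cong {f} {A.- (X ^A.^ k A.- A.1#)} {A.1# A.- X ^A.^ k}
    (solve 1 (λ y → :- (y :- con (+ 1)) := con (+ 1) :- y) A.refl (X ^A.^ k)) (∣A.regular-neg {f} {X ^A.^ k A.- A.1#} h)

  from-zero : ∀ {s} → Regular (constP A.0#) s → Regular 0# s
  from-zero {s} = regular-modulus {constP A.0#} {0#} {s} zero∷zero

  power-0 : ∀ i → Regular 0# (1# - qv ^ suc i)
  power-0 i = from-zero {1# - qv ^ suc i} (power-regular A.0# (suc i) (flip-regular A.0# (suc i) (ℚ[q]Regularity.regular-Xⁿ-1 i)))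

  q-0 : Regular 0# qv
  q-0 = from-zero {qv} (embed-regular A.0# {X} ℚ[q]Regularity.regular-X)

  module _ (n : ℕ) where
    open Moduli ℚ[q][a]-ring qv av (suc n)

    Φ : Poly2
    Φ = embed₁ (cyclotomic (suc n))

    to-power : ∀ i {s} → Regular (constP (A.1# A.- X ^A.^ suc i)) s → Regular (1# - qv ^ suc i) s
    to-power i {s} = regular-modulus {constP (A.1# A.- X ^A.^ suc i)} {1# - qv ^ suc i} {s} (1-qv^≈ (suc i))

    private
      power-L₁ : ∀ i → Regular (1# - qv ^ suc i) L₁
      power-L₁ i = to-power i {L₁} (1-aq-regular (A.1# A.- X ^A.^ suc i) (suc n))
      power-L₂ : ∀ i → Regular (1# - qv ^ suc i) L₂
      power-L₂ i = to-power i {L₂} (a-q-regular (A.1# A.- X ^A.^ suc i) (X-regular-mod-power i) (suc n))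
      q-L₁ : Regular qv L₁
      q-L₁ = 1-aq-regular X (suc n)

    denominators-L₁ : Denominators L₁
    denominators-L₁ = denominators₁ q-0 power-0 q-L₁ (regular-var {X}) power-L₁ power-L₂ (s≤s z≤n)

    denominators-L₂ : Denominators L₂
    denominators-L₂ = denominators₂ q-0 power-0 q-L₁ (regular-var {X}) power-L₁ power-L₂ (s≤s z≤n)

    power-regular-L₁ : ∀ i → Regular L₁ (1# - qv ^ suc i)
    power-regular-L₁ = power-regular₁ q-0 power-0 q-L₁ (regular-var {X}) power-L₁ power-L₂ (s≤s z≤n)

    power-regular-L₂ : ∀ i → Regular L₂ (1# - qv ^ suc i)
    power-regular-L₂ = power-regular₂ q-0 power-0 q-L₁ (regular-var {X}) power-L₁ power-L₂ (s≤s z≤n)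

    L₁-regular-L₂ : Regular L₂ L₁
    L₁-regular-L₂ = 1-aq-regular₂ q-0 power-0 q-L₁ (regular-var {X}) power-L₁ power-L₂ (s≤s z≤n) (suc n)

    X-regular-mod-Φ : ∣A.Regular (cyclotomic (suc n)) X
    X-regular-mod-Φ = step (ℚ[q]Regularity.Φ-∣-Xⁿ-1 n)
      where
      step : cyclotomic (suc n) ∣A.∣ X ^A.^ suc n A.- A.1# → ∣A.Regular (cyclotomic (suc n)) X
      step (W , h) = ∣A.regular-combination {cyclotomic (suc n)} {X} {A.1#} (X ^A.^ n) (A.- W)
        (A.trans (solve 2 (λ x y → con (+ 1) := y :* x :- (x :* y :- con (+ 1))) A.refl X (X ^A.^ n))
        (A.+-congˡ {X ^A.^ n A.* X} (A.trans (A.-‿cong h) (solve 2 (λ c w → :- (c :* w) := :- w :* c) A.refl (cyclotomic (suc n)) W))))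
        (∣A.regular-1 {cyclotomic (suc n)})

    denominators-Φ : Denominators Φ
    denominators-Φ = record
      { reg-q = embed-regular (cyclotomic (suc n)) {X} X-regular-mod-Φ
      ; reg-a = regular-var {cyclotomic (suc n)}
      ; reg-power = λ i n∤i → power-regular (cyclotomic (suc n)) i (flip-regular (cyclotomic (suc n)) i (ℚ[q]Regularity.regular-Φ-Xⁱ-1 n i n∤i))
      ; reg-1-aq = λ s _ → 1-aq-regular (cyclotomic (suc n)) s
      ; reg-a-q = λ s _ → a-q-regular (cyclotomic (suc n)) X-regular-mod-Φ s
      }

    1-aq-regular-Φ : ∀ s → Regular Φ (1# - av * qv ^ s)
    1-aq-regular-Φ = 1-aq-regular (cyclotomic (suc n))

    a-q-regular-Φ : ∀ s → Regular Φ (av - qv ^ s)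
    a-q-regular-Φ = a-q-regular (cyclotomic (suc n)) X-regular-mod-Φ

    -- Modulus 0 gives the total ring of fractions; it serves to show that the product of the two
    -- denominators is not a zero divisor.
    denominators-0 : Denominators 0#
    denominators-0 = record
      { reg-q = q-0
      ; reg-a = from-zero {av} (regular-var {A.0#})
      ; reg-power = positive-power {0#} power-0
      ; reg-1-aq = λ s _ → from-zero {1# - av * qv ^ s} (1-aq-regular A.0# s)
      ; reg-a-q = λ s _ → from-zero {av - qv ^ s} (a-q-regular A.0# ℚ[q]Regularity.regular-X s)
      }

    Φ-∣-1-qⁿ : Φ ∣ 1# - qv ^ suc n
    Φ-∣-1-qⁿ = step (ℚ[q]Regularity.Φ-∣-Xⁿ-1 n)
      where
      step : cyclotomic (suc n) ∣A.∣ X ^A.^ suc n A.- A.1# → Φ ∣ 1# - qv ^ suc n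
      step (W , h) = constP (A.- W) , trans (sym (1-qv^≈ (suc n))) (trans (∷-cong (A.trans
        (solve 1 (λ y → con (+ 1) :- y := :- (y :- con (+ 1))) A.refl (X ^A.^ suc n))
        (A.trans (A.-‿cong h) (solve 2 (λ c w → :- (c :* w) := c :* :- w) A.refl (cyclotomic (suc n)) W))) refl)
        (sym (constP-* (cyclotomic (suc n)) (constP (A.- W)))))

    Φ-regular : ∀ {L} → (∀ i → Regular L (1# - qv ^ suc i)) → Regular L Φ
    Φ-regular {L} h = step Φ-∣-1-qⁿ
      where
      step : Φ ∣ 1# - qv ^ suc n → Regular L Φ
      step (W , eq) = regular-factor {L} {Φ} {1# - qv ^ suc n} W (trans eq (*-comm Φ W)) (h n)

-- The two sides of the congruence

-- An interface that hides how values in Λ are built. It is a relation because a `Frac` with an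
-- irregular denominator has no value; a quotient asks for an inverse of the value of the divisor.
record Model (Λ : CommutativeRing 0ℓ 0ℓ) : Set₁ where
  open CommutativeRing Λ
  infix 4 _⇝_
  field
    _⇝_ : Frac → Carrier → Set
    ⇝-cong : ∀ {x r s} → r ≈ s → x ⇝ r → x ⇝ s
    ⇝-1 : 1F ⇝ 1#
    ⇝-+ : ∀ {x y r s} → x ⇝ r → y ⇝ s → x +F y ⇝ r + s
    ⇝-* : ∀ {x y r s} → x ⇝ r → y ⇝ s → x *F y ⇝ r * s
    ⇝-- : ∀ {x y r s} → x ⇝ r → y ⇝ s → x -F y ⇝ r - s
    ⇝-÷ : ∀ {x y r s s⁻} → s * s⁻ ≈ 1# → x ⇝ r → y ⇝ s → x ÷F y ⇝ r * s⁻

module Evaluate (Λ : CommutativeRing 0ℓ 0ℓ) (model : Model Λ)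
  (q q⁻ α α⁻ : CommutativeRing.Carrier Λ)
  (qq⁻≈1 : CommutativeRing._≈_ Λ (CommutativeRing._*_ Λ q q⁻) (CommutativeRing.1# Λ))
  (αα⁻≈1 : CommutativeRing._≈_ Λ (CommutativeRing._*_ Λ α α⁻) (CommutativeRing.1# Λ))
  (q⇝ : Model._⇝_ model qF q) (a⇝ : Model._⇝_ model aF α)
  (d : ℕ) (1<d : 1 < d) where
  open CommutativeRing Λ
  open IntegerSolver Λ
  open Units Λ
  open Model model
  open IntegerPowers Λ q q⁻ qq⁻≈1
  open Evaluation d 1<d
  open Quadratic Λ p
  open import Algebra.Properties.Semiring.Exp semiring using (_^_)
  open import Algebra.Properties.CommutativeSemiring.Exp commutativeSemiring using (^-distrib-*)
  open import Relation.Binary.Reasoning.Setoid setoid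

  shifted : Carrier → Carrier → ℕ → Carrier
  shifted x r zero = 1#
  shifted x r (suc k) = shifted x r k * (1# - x * r ^ k)

  ⇝-^ : ∀ {x r} k → x ⇝ r → x ^F k ⇝ r ^ k
  ⇝-^ zero h = ⇝-1
  ⇝-^ (suc k) h = ⇝-* h (⇝-^ k h)

  ⇝-poch : ∀ {x r x′ r′} k → x ⇝ x′ → r ⇝ r′ → poch x r k ⇝ shifted x′ r′ k
  ⇝-poch zero hx hr = ⇝-1
  ⇝-poch (suc k) hx hr = ⇝-* (⇝-poch k hx hr) (⇝-- ⇝-1 (⇝-* hx (⇝-^ k hr)))

  ⇝-sumTo : ∀ {f g} N → (∀ k → k ≤ N → f k ⇝ g k) → sumTo N f ⇝ sum g N
  ⇝-sumTo zero h = h 0 z≤n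
  ⇝-sumTo (suc N) h = ⇝-+ (⇝-sumTo N (λ k k≤N → h k (ℕ.m≤n⇒m≤1+n k≤N))) (h (suc N) ℕ.≤-refl)

  ⇝-Q : ∀ k → qF ^F k ⇝ Z (+ k)
  ⇝-Q k = ⇝-cong (sym (Z-pos k)) (⇝-^ k q⇝)

  q≈Z1 : q ≈ Z (+ 1)
  q≈Z1 = sym (trans (Z-pos 1) (*-identityʳ q))

  [pp]^≈ : ∀ k → (p * p) ^ k ≈ K k * K k
  [pp]^≈ k = ^-distrib-* p p k

  quad≈shift : ∀ x k → 1# - x * (p * p) ^ k ≈ quad x k
  quad≈shift x k = +-congˡ (-‿cong (*-congˡ ([pp]^≈ k)))

  Q2d : qF ^F (2 ℕ.* d) ⇝ p * p
  Q2d = ⇝-cong (sym (Z-≡ (refl ⊛ refl) (≡.cong (λ x → + (d ℕ.+ x)) (≡.sym (ℕ.+-identityʳ d))))) (⇝-Q (2 ℕ.* d))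

  2δ≡ : + (2 ℕ.* d) ≡ + 2 ℤ.* δ
  2δ≡ = ℤ.pos-* 2 d

  shifted-unit : ∀ {x r} k → (∀ i → i < k → Unit (1# - x * r ^ i)) → Unit (shifted x r k)
  shifted-unit zero h = 1# , *-identityˡ 1#
  shifted-unit (suc k) h = unit-* (shifted-unit k (λ i i<k → h i (ℕ.m<n⇒m<1+n i<k))) (h k ℕ.≤-refl)

  shifted≈pochZ : ∀ {x i} k → x ≈ Z i → shifted x (p * p) k ≈ pochZ i (+ 2 ℤ.* δ) k
  shifted≈pochZ zero h = refl
  shifted≈pochZ {x} (suc k) h = *-cong (shifted≈pochZ k h) (trans (quad≈shift x k) (quad≈ k h))

  A b c e fb fc fe : Carrier
  A = Z (+ 1)
  b = Z (δ ℤ.- + 1)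
  c = α * Z (+ 1)
  e = α⁻ * Z (+ 1)
  fb = Z (δ ℤ.+ + 2)
  fc = α * Z (+ 2 ℤ.* δ)
  fe = α⁻ * Z (+ 2 ℤ.* δ)

  Qb : qF ^F (d ℕ.∸ 1) ⇝ b
  Qb = ⇝-cong (reflexive (≡.cong Z (≡.sym eq))) (⇝-Q (d ℕ.∸ 1))
    where
    eq : δ ℤ.- + 1 ≡ + (d ℕ.∸ 1)
    eq = ≡.trans (ℤ.m-n≡m⊖n d 1) (ℤ.⊖-≥ (ℕ.<⇒≤ 1<d))

  aq⇝ : aF *F qF ⇝ c
  aq⇝ = ⇝-* a⇝ (⇝-cong q≈Z1 q⇝)

  q/a⇝ : qF ÷F aF ⇝ e
  q/a⇝ = ⇝-cong (*-comm _ _) (⇝-÷ αα⁻≈1 (⇝-cong q≈Z1 q⇝) a⇝)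

  fc⇝ : aF *F (qF ^F (2 ℕ.* d)) ⇝ fc
  fc⇝ = ⇝-* a⇝ (⇝-cong (reflexive (≡.cong Z 2δ≡)) (⇝-Q (2 ℕ.* d)))

  fe⇝ : (qF ^F (2 ℕ.* d)) ÷F aF ⇝ fe
  fe⇝ = ⇝-cong (*-comm _ _) (⇝-÷ αα⁻≈1 (⇝-cong (reflexive (≡.cong Z 2δ≡)) (⇝-Q (2 ℕ.* d))) a⇝)

  module Sides (1-q-unit : Unit (1# - q)) (m : ℕ)
    (unit-p : ∀ k → k < 2 ℕ.* m → Unit (lin p k))
    (unit-fb : ∀ k → k < 2 ℕ.* m → Unit (quad fb k))
    (unit-fc : ∀ k → k < 2 ℕ.* m → Unit (quad fc k))
    (unit-fe : ∀ k → k < 2 ℕ.* m → Unit (quad fe k)) where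

    M : ℕ
    M = 2 ℕ.* m

    m≤M : m ≤ M
    m≤M = ℕ.m≤m+n m (m ℕ.+ 0)

    [1-q]⁻ : Carrier
    [1-q]⁻ = proj₁ 1-q-unit

    P E : ℕ → Carrier
    P k = shifted A (p * p) k * shifted b p k * shifted c p k * shifted e p k
    E k = shifted p p k * shifted fb (p * p) k * shifted fc (p * p) k * shifted fe (p * p) k

    E-unit : ∀ k → k ≤ M → Unit (E k)
    E-unit k k≤M = unit-* (unit-* (unit-* (shifted-unit k (λ i i<k → unit-p i (ℕ.<-≤-trans i<k k≤M)))
        (quadratic fb unit-fb)) (quadratic fc unit-fc)) (quadratic fe unit-fe)
      where
      quadratic : ∀ x → (∀ k → k < M → Unit (quad x k)) → Unit (shifted x (p * p) k)
      quadratic x h = shifted-unit k (λ i i<k → unit-cong (sym (quad≈shift x i)) (h i (ℕ.<-≤-trans i<k k≤M)))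

    E⁻ : ℕ → Carrier
    E⁻ k with k ℕ.≤? M
    ... | yes k≤M = proj₁ (E-unit k k≤M)
    ... | no _ = 0#

    EE⁻≈1 : ∀ k → k ≤ M → E k * E⁻ k ≈ 1#
    EE⁻≈1 k k≤M with k ℕ.≤? M
    ... | yes k≤M′ = proj₂ (E-unit k k≤M′)
    ... | no k≰M = contradiction k≤M k≰M

    exponent : ℕ → ℕ
    exponent k = (d ℕ.* (k ℕ.* k ℕ.+ k)) ℕ./ 2

    -- The numerator grows by 2d(k + 1), a multiple of 2, so the floor division splits without any
    -- parity argument for the rest.
    exponent-suc : ∀ k → exponent (suc k) ≡ exponent k ℕ.+ d ℕ.* suc k
    exponent-suc k = ≡.trans (≡.cong (ℕ._/ 2) (lemma d k))
      (≡.trans (ℕ.+-distrib-/-∣ʳ (d ℕ.* (k ℕ.* k ℕ.+ k)) (ℕ∣.n∣m*n (d ℕ.* suc k)))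
      (≡.cong (exponent k ℕ.+_) (ℕ.m*n/n≡m (d ℕ.* suc k) 2)))
      where
      lemma : ∀ d k → d ℕ.* (suc k ℕ.* suc k ℕ.+ suc k) ≡ d ℕ.* (k ℕ.* k ℕ.+ k) ℕ.+ d ℕ.* suc k ℕ.* 2
      lemma = solveℕ-∀

    -- The summand without [3dk + 1]; that q-integer supplies the weight and the constant factor
    -- 1/(1 - q).
    τ : ℕ → Carrier
    τ k = P k * E⁻ k * Z (+ exponent k)

    P-suc : ∀ k → P (suc k) ≈ P k * (quad A k * lin b k * lin c k * lin e k)
    P-suc k = trans (*-congʳ (*-congʳ (*-congʳ (*-congˡ (quad≈shift A k)))))
      (solve 8 (λ a b c d w x y z → a :* w :* (b :* x) :* (c :* y) :* (d :* z) := a :* b :* c :* d :* (w :* x :* y :* z)) refl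
        _ _ _ _ _ _ _ _)

    E-suc : ∀ k → E (suc k) ≈ E k * denom fb fc fe k
    E-suc k = trans (*-cong (*-cong (*-congˡ (*-congˡ (quad≈shift fb k))) (*-congˡ (quad≈shift fc k))) (*-congˡ (quad≈shift fe k)))
      (solve 8 (λ a b c d w x y z → a :* w :* (b :* x) :* (c :* y) :* (d :* z) := a :* b :* c :* d :* (w :* x :* y :* z)) refl
        _ _ _ _ _ _ _ _)

    power-suc : ∀ k → Z (+ exponent (suc k)) ≈ Z (+ exponent k) * (p * K k)
    power-suc k = sym (Z-≡ (refl ⊛ K≈ (suc k)) (≡.trans (≡.cong (λ i → + exponent k ℤ.+ i) (≡.sym (ℤ.pos-* d (suc k))))
      (≡.cong +_ (≡.sym (exponent-suc k)))))

    τ-hypergeometric : Hypergeometric (numer A b c e) (denom fb fc fe) M τ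
    τ-hypergeometric = record
      { initial = begin
          1# * 1# * 1# * 1# * E⁻ 0 * Z (+ exponent 0)
            ≈⟨ *-congˡ (trans (reflexive (≡.cong (λ x → Z (+ (x ℕ./ 2))) (ℕ.*-zeroʳ d))) Z-0) ⟩
          1# * 1# * 1# * 1# * E⁻ 0 * 1#
            ≈⟨ *-identityʳ _ ⟩
          E 0 * E⁻ 0
            ≈⟨ EE⁻≈1 0 z≤n ⟩
          1# ∎
      ; ratio = λ k k<M → cancel (E-unit k (ℕ.<⇒≤ k<M)) (begin
          E k * (denom fb fc fe k * τ (suc k))
            ≈⟨ solve 5 (λ E D P F X → E :* (D :* (P :* F :* X)) := E :* D :* F :* (P :* X)) refl _ _ _ _ _ ⟩
          E k * denom fb fc fe k * E⁻ (suc k) * (P (suc k) * Z (+ exponent (suc k)))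
            ≈⟨ *-congʳ (*-congʳ (E-suc k)) ⟨
          E (suc k) * E⁻ (suc k) * (P (suc k) * Z (+ exponent (suc k)))
            ≈⟨ *-cong (EE⁻≈1 (suc k) k<M) (*-cong (P-suc k) (power-suc k)) ⟩
          1# * (P k * (quad A k * lin b k * lin c k * lin e k) * (Z (+ exponent k) * (p * K k)))
            ≈⟨ *-congʳ (EE⁻≈1 k (ℕ.<⇒≤ k<M)) ⟨
          E k * E⁻ k * (P k * (quad A k * lin b k * lin c k * lin e k) * (Z (+ exponent k) * (p * K k)))
            ≈⟨ solve 9 (λ E F P w x y z X pK → E :* F :* (P :* (w :* x :* y :* z) :* (X :* pK))
                 := E :* (pK :* w :* x :* y :* z :* (P :* F :* X))) refl _ _ _ _ _ _ _ _ _ ⟩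
          E k * (numer A b c e k * τ k) ∎)
      }

    weight≈ : ∀ k → 1# - q ^ (3 ℕ.* d ℕ.* k ℕ.+ 1) ≈ weight A k
    weight≈ k = +-congˡ (-‿cong (sym (trans (Z-≡ (refl ⊛ (K≈ k ⊛ (K≈ k ⊛ K≈ k))) (≡.trans (lemma δ (+ k)) eq)) (Z-pos _))))
      where
      lemma : ∀ δ k → + 1 ℤ.+ (δ ℤ.* k ℤ.+ (δ ℤ.* k ℤ.+ δ ℤ.* k)) ≡ + 3 ℤ.* δ ℤ.* k ℤ.+ + 1
      lemma = solve-∀
      eq : + 3 ℤ.* δ ℤ.* + k ℤ.+ + 1 ≡ + (3 ℕ.* d ℕ.* k ℕ.+ 1)
      eq = ≡.cong (ℤ._+ + 1) (≡.sym (≡.trans (ℤ.pos-* (3 ℕ.* d) k) (≡.cong (ℤ._* + k) (ℤ.pos-* 3 d))))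

    ⇝-qint : ∀ k → qint k ⇝ (1# - q ^ k) * [1-q]⁻
    ⇝-qint k = ⇝-÷ (proj₂ 1-q-unit) (⇝-- ⇝-1 (⇝-^ k q⇝)) (⇝-- ⇝-1 q⇝)

    -- Restates the summand local to `lhs4`, with which it agrees by definition.
    term : ℕ → Frac
    term k =
      ((qint (3 ℕ.* d ℕ.* k ℕ.+ 1)
        *F poch qF (qF ^F (2 ℕ.* d)) k
        *F poch (qF ^F (d ℕ.∸ 1)) (qF ^F d) k
        *F poch (aF *F qF) (qF ^F d) k
        *F poch (qF ÷F aF) (qF ^F d) k)
       ÷F (poch (qF ^F d) (qF ^F d) k
        *F poch (qF ^F (d ℕ.+ 2)) (qF ^F (2 ℕ.* d)) k
        *F poch (aF *F (qF ^F (2 ℕ.* d))) (qF ^F (2 ℕ.* d)) k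
        *F poch ((qF ^F (2 ℕ.* d)) ÷F aF) (qF ^F (2 ℕ.* d)) k))
      *F (qF ^F ((d ℕ.* (k ℕ.* k ℕ.+ k)) ℕ./ 2))

    term⇝ : ∀ k → k ≤ M → term k ⇝ [1-q]⁻ * (weight A k * τ k)
    term⇝ k k≤M = ⇝-cong (begin
        (1# - q ^ (3 ℕ.* d ℕ.* k ℕ.+ 1)) * [1-q]⁻ * shifted A (p * p) k * shifted b p k * shifted c p k * shifted e p k * E⁻ k * Z (+ exponent k)
          ≈⟨ *-congʳ (*-congʳ (*-congʳ (*-congʳ (*-congʳ (*-congʳ (*-congʳ (weight≈ k))))))) ⟩
        weight A k * [1-q]⁻ * shifted A (p * p) k * shifted b p k * shifted c p k * shifted e p k * E⁻ k * Z (+ exponent k)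
          ≈⟨ solve 8 (λ w u a b c d F X → w :* u :* a :* b :* c :* d :* F :* X := u :* (w :* (a :* b :* c :* d :* F :* X))) refl _ _ _ _ _ _ _ _ ⟩
        [1-q]⁻ * (weight A k * τ k) ∎)
      (⇝-* (⇝-÷ (EE⁻≈1 k k≤M)
        (⇝-* (⇝-* (⇝-* (⇝-* (⇝-qint (3 ℕ.* d ℕ.* k ℕ.+ 1)) (⇝-poch k (⇝-cong q≈Z1 q⇝) Q2d)) (⇝-poch k Qb (⇝-Q d))) (⇝-poch k aq⇝ (⇝-Q d))) (⇝-poch k q/a⇝ (⇝-Q d)))
        (⇝-* (⇝-* (⇝-* (⇝-poch k (⇝-Q d) (⇝-Q d)) (⇝-poch k (⇝-Q (d ℕ.+ 2)) Q2d)) (⇝-poch k fc⇝ Q2d)) (⇝-poch k fe⇝ Q2d)))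
        (⇝-Q (exponent k)))

    sum⇝ : sumTo M term ⇝ [1-q]⁻ * total A τ M
    sum⇝ = ⇝-cong (sum-* [1-q]⁻ _ M) (⇝-sumTo M term⇝)

    lhs⇝ : .{{nz : NonZero d}} → ∀ n → (n ℕ.∸ 1) ℕ./ d ≡ M → lhs4 d n ⇝ [1-q]⁻ * total A τ M
    lhs⇝ n eq = ≡.subst (λ N → sumTo N term ⇝ [1-q]⁻ * total A τ M) (≡.sym eq) sum⇝

    module Right (n : ℕ) where

      PB-unit : Unit (shifted fb (p * p) m)
      PB-unit = shifted-unit m (λ i i<m → unit-cong (sym (quad≈shift fb i)) (unit-fb i (ℕ.<-≤-trans i<m m≤M)))

      ρ : Carrier
      ρ = shifted p (p * p) m * proj₁ PB-unit * ((1# - q ^ n) * [1-q]⁻) * (1# * Z (ℤ.- + (m ℕ.* (d ℕ.∸ 1))))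

      rhs⇝ : .{{nz : NonZero d}} → (n ℕ.∸ 1) ℕ./ d ℕ./ 2 ≡ m → ((n ℕ.∸ 1) ℕ.* (d ℕ.∸ 1)) ℕ./ d ℕ./ 2 ≡ m ℕ.* (d ℕ.∸ 1) →
        rhs4 d n ⇝ ρ
      rhs⇝ eq₁ eq₂ = ≡.subst₂ (λ m′ k → (poch (qF ^F d) (qF ^F (2 ℕ.* d)) m′ ÷F poch (qF ^F (d ℕ.+ 2)) (qF ^F (2 ℕ.* d)) m′)
          *F qint n *F (1F ÷F (qF ^F k)) ⇝ ρ) (≡.sym eq₁) (≡.sym eq₂)
        (⇝-* (⇝-* (⇝-÷ (proj₂ PB-unit) (⇝-poch m (⇝-Q d) Q2d) (⇝-poch m (⇝-Q (d ℕ.+ 2)) Q2d)) (⇝-qint n))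
          (⇝-÷ (proj₂ (Z-unit (+ (m ℕ.* (d ℕ.∸ 1))))) ⇝-1 (⇝-Q (m ℕ.* (d ℕ.∸ 1)))))

      ρ-vanishes : q ^ n ≈ 1# → ρ ≈ 0#
      ρ-vanishes h = trans (*-congʳ (*-congˡ (*-congʳ (trans (+-congˡ (-‿cong h)) (-‿inverseʳ 1#)))))
        (solve 3 (λ a b c → a :* (con (+ 0) :* b) :* c := con (+ 0)) refl _ _ _)

      ρ-value : n ≡ suc (m ℕ.* (2 ℕ.* d)) → ∀ {T} →
        pochZ (δ ℤ.+ + 2) (+ 2 ℤ.* δ) m * T ≈ Z ((+ 1 ℤ.- δ) ℤ.* + m) * pochZ δ (+ 2 ℤ.* δ) m * (1# - Z (+ 1 ℤ.+ + 2 ℤ.* δ ℤ.* + m)) →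
        [1-q]⁻ * T ≈ ρ
      ρ-value n≡ {T} value = cancel PB-unit (begin
        shifted fb (p * p) m * ([1-q]⁻ * T)
          ≈⟨ solve 3 (λ P u T → P :* (u :* T) := u :* (P :* T)) refl _ _ _ ⟩
        [1-q]⁻ * (shifted fb (p * p) m * T)
          ≈⟨ *-congˡ (trans (*-congʳ (shifted≈pochZ m refl)) value) ⟩
        [1-q]⁻ * (Z ((+ 1 ℤ.- δ) ℤ.* + m) * pochZ δ (+ 2 ℤ.* δ) m * (1# - Z (+ 1 ℤ.+ + 2 ℤ.* δ ℤ.* + m)))
          ≈⟨ *-congˡ (*-cong (*-cong (reflexive (≡.cong Z exp≡)) (sym (shifted≈pochZ m refl))) (+-congˡ (-‿cong (trans (reflexive (≡.cong Z n≡′)) (Z-pos n))))) ⟩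
        [1-q]⁻ * (Z (ℤ.- + (m ℕ.* (d ℕ.∸ 1))) * shifted p (p * p) m * (1# - q ^ n))
          ≈⟨ *-identityˡ _ ⟨
        1# * ([1-q]⁻ * (Z (ℤ.- + (m ℕ.* (d ℕ.∸ 1))) * shifted p (p * p) m * (1# - q ^ n)))
          ≈⟨ *-congʳ (proj₂ PB-unit) ⟨
        shifted fb (p * p) m * proj₁ PB-unit * ([1-q]⁻ * (Z (ℤ.- + (m ℕ.* (d ℕ.∸ 1))) * shifted p (p * p) m * (1# - q ^ n)))
          ≈⟨ solve 6 (λ P F u z S x → P :* F :* (u :* (z :* S :* x)) := P :* (S :* F :* (x :* u) :* (con (+ 1) :* z))) refl _ _ _ _ _ _ ⟩
        shifted fb (p * p) m * ρ ∎)
        where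
        lemma : ∀ δ m → (+ 1 ℤ.- δ) ℤ.* m ≡ ℤ.- (m ℤ.* (δ ℤ.- + 1))
        lemma = solve-∀
        exp≡ : (+ 1 ℤ.- δ) ℤ.* + m ≡ ℤ.- + (m ℕ.* (d ℕ.∸ 1))
        exp≡ = ≡.trans (lemma δ (+ m)) (≡.cong ℤ.-_ (≡.trans (≡.cong (λ i → + m ℤ.* i) (≡.trans (ℤ.m-n≡m⊖n d 1) (ℤ.⊖-≥ (ℕ.<⇒≤ 1<d)))) (≡.sym (ℤ.pos-* m (d ℕ.∸ 1)))))
        n≡′ : + 1 ℤ.+ + 2 ℤ.* δ ℤ.* + m ≡ + n
        n≡′ = ≡.trans (≡.cong (λ i → + 1 ℤ.+ i) (≡.trans (ℤ.*-comm (+ 2 ℤ.* δ) (+ m)) (≡.sym (≡.trans (ℤ.pos-* m (2 ℕ.* d)) (≡.cong (λ i → + m ℤ.* i) 2δ≡))))) (≡.cong +_ (≡.sym n≡))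

    module Cases (n : ℕ) (n≡ : n ≡ suc (m ℕ.* (2 ℕ.* d))) where

      open Right n public

      +n≡ : + n ≡ + 1 ℤ.+ + 2 ℤ.* δ ℤ.* + m
      +n≡ = ≡.trans (≡.cong +_ n≡) (≡.cong (λ i → + 1 ℤ.+ i) (≡.trans (≡.trans (ℤ.pos-* m (2 ℕ.* d)) (≡.cong (λ i → + m ℤ.* i) 2δ≡))
        (ℤ.*-comm (+ m) (+ 2 ℤ.* δ))))

      module Specialised (unit : ∀ i → i ≢ + 0 → Unit (1# - Z i)) where
        open Rahman unit m using (value; γ; ε; φ; ψ)

        evaluate : Hypergeometric (numer A b (Z (γ m)) (Z (ε m))) (denom fb (Z (φ m)) (Z (ψ m))) M τ →
          [1-q]⁻ * total A τ M ≈ ρ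
        evaluate h = ρ-value n≡ (value m ℕ.≤-refl h)

        γ≡ : ℤ.- + n ℤ.+ + 1 ≡ γ m
        γ≡ = ≡.trans (≡.cong (λ i → ℤ.- i ℤ.+ + 1) +n≡) (lemma δ (+ m))
          where
          lemma : ∀ δ m → ℤ.- (+ 1 ℤ.+ + 2 ℤ.* δ ℤ.* m) ℤ.+ + 1 ≡ ℤ.- (+ 2 ℤ.* δ ℤ.* m)
          lemma = solve-∀
        ε≡ : + n ℤ.+ + 1 ≡ ε m
        ε≡ = ≡.trans (≡.cong (λ i → i ℤ.+ + 1) +n≡) (lemma δ (+ m))
          where
          lemma : ∀ δ m → + 1 ℤ.+ + 2 ℤ.* δ ℤ.* m ℤ.+ + 1 ≡ + 2 ℤ.+ + 2 ℤ.* δ ℤ.* m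
          lemma = solve-∀
        φ≡ : + n ℤ.+ + 2 ℤ.* δ ≡ φ m
        φ≡ = ≡.trans (≡.cong (λ i → i ℤ.+ + 2 ℤ.* δ) +n≡) (lemma δ (+ m))
          where
          lemma : ∀ δ m → + 1 ℤ.+ + 2 ℤ.* δ ℤ.* m ℤ.+ + 2 ℤ.* δ ≡ + 2 ℤ.* δ ℤ.+ + 2 ℤ.* δ ℤ.* m ℤ.+ + 1
          lemma = solve-∀
        ψ≡ : ℤ.- + n ℤ.+ + 2 ℤ.* δ ≡ ψ m
        ψ≡ = ≡.trans (≡.cong (λ i → ℤ.- i ℤ.+ + 2 ℤ.* δ) +n≡) (lemma δ (+ m))
          where
          lemma : ∀ δ m → ℤ.- (+ 1 ℤ.+ + 2 ℤ.* δ ℤ.* m) ℤ.+ + 2 ℤ.* δ ≡ + 2 ℤ.* δ ℤ.- + 2 ℤ.* δ ℤ.* m ℤ.- + 1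
          lemma = solve-∀

        inverse : ∀ {x y} → x * y ≈ 1# → ∀ i → x ≈ Z i → y ≈ Z (ℤ.- i)
        inverse {x} {y} xy≈1 i x≈ = cancel (Z-unit i) (trans (*-congʳ (sym x≈)) (trans xy≈1 (sym (proj₂ (Z-unit i)))))

        value-at-q⁻ⁿ : α ≈ Z (ℤ.- + n) → [1-q]⁻ * total A τ M ≈ ρ
        value-at-q⁻ⁿ α≈ = evaluate (hyper-cong
          (numer-cong refl refl (Z-≡ (α≈ ⊛ refl) γ≡) (Z-≡ (α⁻≈ ⊛ refl) ε≡))
          -- Here c = aq is the terminating parameter. As `fc` is Ap²/e and `fe` is Ap²/c, the last
          -- two denominators change places.
          (λ k → trans (denom-cong refl (Z-≡ (α≈ ⊛ refl) ψ≡) (Z-≡ (α⁻≈ ⊛ refl) φ≡) k)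
            (solve 4 (λ l x y z → l :* x :* y :* z := l :* x :* z :* y) refl _ _ _ _))
          τ-hypergeometric)
          where
          α⁻≈ : α⁻ ≈ Z (+ n)
          α⁻≈ = Z-≡ (inverse αα⁻≈1 (ℤ.- + n) α≈) (ℤ.neg-involutive (+ n))

        value-at-qⁿ : α ≈ Z (+ n) → [1-q]⁻ * total A τ M ≈ ρ
        value-at-qⁿ α≈ = evaluate (hyper-cong
          -- Now e = q/a is the terminating parameter, and c and e change places instead.
          (λ k → trans (numer-cong refl refl (Z-≡ (α≈ ⊛ refl) ε≡) (Z-≡ (α⁻≈ ⊛ refl) γ≡) k)
            (solve 5 (λ l x y z w → l :* x :* y :* z :* w := l :* x :* y :* w :* z) refl _ _ _ _ _))
          (denom-cong refl (Z-≡ (α≈ ⊛ refl) φ≡) (Z-≡ (α⁻≈ ⊛ refl) ψ≡))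
          τ-hypergeometric)
          where
          α⁻≈ : α⁻ ≈ Z (ℤ.- + n)
          α⁻≈ = inverse αα⁻≈1 (+ n) α≈

      module RootOfUnity (qⁿ≈1 : q ^ n ≈ 1#)
        (unit-α : ∀ i → Unit (1# - α * Z i))
        (unit-α⁻ : ∀ i → Unit (1# - α⁻ * Z i))
        (unit-e : ∀ j → suc j ≤ m → Unit (1# - Z (δ ℤ.- + 2 ℤ.* δ ℤ.* + suc j ℤ.- + 2))) where
        open Vanishing α α⁻ αα⁻≈1 M m m≤M unit-p unit-fb unit-α unit-α⁻ unit-e using (γ; ε; φ; vanishing)

        periodic : ∀ i → Z (i ℤ.+ + n) ≈ Z i
        periodic i = trans (Z-+ i (+ n)) (trans (*-congˡ (trans (Z-pos n) qⁿ≈1)) (*-identityʳ _))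

        reduce : ∀ i j → j ℤ.+ + n ≡ i → Z i ≈ Z j
        reduce i j ≡.refl = periodic j

        A≈ : A ≈ Z (γ m)
        A≈ = reduce _ _ (≡.trans (≡.cong (λ i → γ m ℤ.+ i) +n≡) (lemma δ (+ m)))
          where
          lemma : ∀ δ m → ℤ.- (+ 2 ℤ.* δ ℤ.* m) ℤ.+ (+ 1 ℤ.+ + 2 ℤ.* δ ℤ.* m) ≡ + 1
          lemma = solve-∀
        b≈ : b ≈ Z (ε m)
        b≈ = reduce _ _ (≡.trans (≡.cong (λ i → ε m ℤ.+ i) +n≡) (lemma δ (+ m)))
          where
          lemma : ∀ δ m → δ ℤ.- + 2 ℤ.* δ ℤ.* m ℤ.- + 2 ℤ.+ (+ 1 ℤ.+ + 2 ℤ.* δ ℤ.* m) ≡ δ ℤ.- + 1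
          lemma = solve-∀
        2δ≈ : Z (+ 2 ℤ.* δ) ≈ Z (φ m)
        2δ≈ = reduce _ _ (≡.trans (≡.cong (λ i → φ m ℤ.+ i) +n≡) (lemma δ (+ m)))
          where
          lemma : ∀ δ m → + 2 ℤ.* δ ℤ.- + 2 ℤ.* δ ℤ.* m ℤ.- + 1 ℤ.+ (+ 1 ℤ.+ + 2 ℤ.* δ ℤ.* m) ≡ + 2 ℤ.* δ
          lemma = solve-∀

        total-vanishes : total A τ M ≈ 0#
        total-vanishes = trans (sum-cong M (λ k _ → *-congʳ (+-congˡ (-‿cong (*-congʳ A≈)))))
          (vanishing m ℕ.≤-refl (hyper-cong
            -- `Vanishing` keeps p/q in the last slot, hence the permutations of the parameters.
            (λ k → trans (numer-cong A≈ b≈ refl refl k)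
              (solve 5 (λ l A b c e → l :* A :* b :* c :* e := l :* A :* c :* e :* b) refl _ _ _ _ _))
            (λ k → trans (denom-cong refl (*-congˡ 2δ≈) (*-congˡ 2δ≈) k)
              (solve 4 (λ l x y z → l :* x :* y :* z := l :* z :* y :* x) refl _ _ _ _))
            τ-hypergeometric))

        both-vanish : [1-q]⁻ * total A τ M ≈ ρ
        both-vanish = trans (*-congˡ total-vanishes) (trans (zeroʳ _) (sym (ρ-vanishes qⁿ≈1)))

-- Exponents that n does not divide

module Exponents (d m : ℕ) (1<d : 1 < d) where

  n : ℕ
  n = suc (m ℕ.* (2 ℕ.* d))

  0<d : 0 < d
  0<d = ℕ.<-trans (s≤s z≤n) 1<d

  d∤1 : ¬ (d ∣ℕ 1)
  d∤1 h = ℕ.<-irrefl ≡.refl (ℕ.<-≤-trans 1<d (ℕ∣.∣⇒≤ h))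

  d∣m2d : d ∣ℕ m ℕ.* (2 ℕ.* d)
  d∣m2d = ℕ∣.∣n⇒∣m*n m (ℕ∣.n∣m*n 2)

  d∤n : ¬ (d ∣ℕ n)
  d∤n h = d∤1 (ℕ∣.∣m+n∣m⇒∣n (≡.subst (d ∣ℕ_) (ℕ.+-comm 1 (m ℕ.* (2 ℕ.* d))) h) d∣m2d)

  -- The number is positive and at most 2dm = n - 1.
  n∤d[1+k] : ∀ k → k < 2 ℕ.* m → ¬ (n ∣ℕ d ℕ.* suc k)
  n∤d[1+k] k k<2m h = ℕ.<-irrefl ≡.refl (ℕ.≤-trans (ℕ∣.∣⇒≤ {{ℕ.>-nonZero (ℕ.*-mono-< {0} {d} {0} {suc k} 0<d (s≤s z≤n))}} h)
    (≡.subst (d ℕ.* suc k ≤_) (lemma d m) (ℕ.*-monoʳ-≤ d k<2m)))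
    where
    lemma : ∀ d m → d ℕ.* (2 ℕ.* m) ≡ m ℕ.* (2 ℕ.* d)
    lemma = solveℕ-∀

  -- The number lies strictly between 0 and 2n, so it could only be n itself; but modulo d it is 2,
  -- whereas n is 1.
  n∤d+2+2dk : ∀ k → k < 2 ℕ.* m → ¬ (n ∣ℕ d ℕ.+ 2 ℕ.+ 2 ℕ.* d ℕ.* k)
  n∤d+2+2dk k k<2m (ℕ∣.divides zero eq) = contradiction (≡.trans (≡.sym (lemma d k)) eq) λ ()
    where
    lemma : ∀ d k → d ℕ.+ 2 ℕ.+ 2 ℕ.* d ℕ.* k ≡ suc (suc (d ℕ.+ 2 ℕ.* d ℕ.* k))
    lemma = solveℕ-∀
  n∤d+2+2dk k k<2m (ℕ∣.divides 1 eq) = d∤1 (ℕ∣.∣m+n∣m⇒∣n (≡.subst (d ∣ℕ_) (ℕ.suc-injective eq′) d∣m2d) (ℕ∣.m∣m*n (1 ℕ.+ 2 ℕ.* k)))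
    where
    lemma : ∀ d k → d ℕ.+ 2 ℕ.+ 2 ℕ.* d ℕ.* k ≡ suc (d ℕ.* (1 ℕ.+ 2 ℕ.* k) ℕ.+ 1)
    lemma = solveℕ-∀
    eq′ : suc (m ℕ.* (2 ℕ.* d)) ≡ suc (d ℕ.* (1 ℕ.+ 2 ℕ.* k) ℕ.+ 1)
    eq′ = ≡.trans (≡.sym (ℕ.+-identityʳ n)) (≡.trans (≡.sym eq) (lemma d k))
  n∤d+2+2dk k k<2m (ℕ∣.divides (suc (suc c)) eq) = ℕ.<-irrefl ≡.refl (begin-strict
    d ℕ.+ 2 ℕ.+ 2 ℕ.* d ℕ.* k             <⟨ ℕ.+-monoˡ-< (2 ℕ.* d ℕ.* k) (ℕ.+-monoˡ-< 2 (ℕ.m<m+n d 0<d)) ⟩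
    d ℕ.+ d ℕ.+ 2 ℕ.+ 2 ℕ.* d ℕ.* k      ≡⟨ lemma₁ d k ⟩
    2 ℕ.+ 2 ℕ.* d ℕ.* suc k               ≤⟨ ℕ.+-monoʳ-≤ 2 (ℕ.*-monoʳ-≤ (2 ℕ.* d) k<2m) ⟩
    2 ℕ.+ 2 ℕ.* d ℕ.* (2 ℕ.* m)      ≡⟨ lemma₂ d m ⟩
    2 ℕ.* n                               ≤⟨ ℕ.*-monoˡ-≤ n (s≤s (s≤s (z≤n {c}))) ⟩
    suc (suc c) ℕ.* n      ≡⟨ eq ⟨
    d ℕ.+ 2 ℕ.+ 2 ℕ.* d ℕ.* k             ∎)
    where
    open ℕ.≤-Reasoning
    lemma₁ : ∀ d k → d ℕ.+ d ℕ.+ 2 ℕ.+ 2 ℕ.* d ℕ.* k ≡ 2 ℕ.+ 2 ℕ.* d ℕ.* suc k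
    lemma₁ = solveℕ-∀
    lemma₂ : ∀ d m → 2 ℕ.+ 2 ℕ.* d ℕ.* (2 ℕ.* m) ≡ 2 ℕ.* suc (m ℕ.* (2 ℕ.* d))
    lemma₂ = solveℕ-∀

  2d[1+k]≢n : ∀ k → 2 ℕ.* d ℕ.* suc k ≢ n
  2d[1+k]≢n k eq = d∤n (≡.subst (d ∣ℕ_) eq (ℕ∣.∣m⇒∣m*n (suc k) (ℕ∣.n∣m*n 2)))

-- N and D play the role of num and den; x ⇝ r says that D x is regular and x has the value r in Λ.
record Interpretation (B : CommutativeRing 0ℓ 0ℓ) (q a L : CommutativeRing.Carrier B)
  (N D : Frac → CommutativeRing.Carrier B) : Set₁ where
  private module B = CommutativeRing B
  open Regularity B
  field
    Λ : CommutativeRing 0ℓ 0ℓ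
  open CommutativeRing Λ
  open Units Λ
  field
    ι : B.Carrier → Carrier
    ι-1 : ι B.1# ≈ 1#
    ι-* : ∀ f g → ι (f B.* g) ≈ ι f * ι g
    ι-- : ∀ f g → ι (f B.- g) ≈ ι f - ι g
    ι-zero : ∀ {f} → L ∣ f → ι f ≈ 0#
    ι-unit : ∀ {f} → Regular L f → Unit (ι f)
    model : Model Λ
  open Model model
  field
    q⇝ : qF ⇝ ι q
    a⇝ : aF ⇝ ι a
    ⇝-regular : ∀ {x r} → x ⇝ r → Regular L (D x)
    ⇝-divides : ∀ {x y r s} → x ⇝ r → y ⇝ s → r ≈ s → L ∣ N x B.* D y B.- N y B.* D x

-- Divisibility of the difference of the two sides by each modulus

module Application (B : CommutativeRing 0ℓ 0ℓ) (q a : CommutativeRing.Carrier B)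
  (N D : Frac → CommutativeRing.Carrier B)
  (d m : ℕ) (1<d : 1 < d) (1<n : 1 < Exponents.n d m 1<d)
  (L : CommutativeRing.Carrier B) (interpretation : Interpretation B q a L N D) where
  open Exponents d m 1<d
  open Moduli B q a n
  private module B = CommutativeRing B
  open Regularity B
  open Interpretation interpretation hiding (Λ)
  private module Λ = CommutativeRing (Interpretation.Λ interpretation)
  open Λ using () renaming (_≈_ to _≃_; Carrier to Fraction)
  localisation : CommutativeRing 0ℓ 0ℓ
  localisation = Interpretation.Λ interpretation
  open Units localisation
  open IntegerSolver localisation
  open import Algebra.Properties.Semiring.Exp B.semiring using () renaming (_^_ to _^ᴮ_)
  open import Algebra.Properties.Semiring.Exp Λ.semiring using (_^_)
  open import Relation.Binary.Reasoning.Setoid Λ.setoid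

  ι-^ : ∀ f k → ι (f ^ᴮ k) ≃ ι f ^ k
  ι-^ f zero = ι-1
  ι-^ f (suc k) = Λ.trans (ι-* f (f ^ᴮ k)) (Λ.*-congˡ (ι-^ f k))

  ι-1- : ∀ g → ι (B.1# B.- g) ≃ Λ.1# Λ.- ι g
  ι-1- g = Λ.trans (ι-- B.1# g) (Λ.+-congʳ ι-1)

  module _ (denominators : Denominators L) where
    open Denominators denominators

    q̂ q̂⁻ α α⁻ : Fraction
    q̂ = ι q
    q̂⁻ = proj₁ (ι-unit reg-q)
    α = ι a
    α⁻ = proj₁ (ι-unit reg-a)

    qq⁻≈1 : q̂ Λ.* q̂⁻ ≃ Λ.1#
    qq⁻≈1 = proj₂ (ι-unit reg-q)

    αα⁻≈1 : α Λ.* α⁻ ≃ Λ.1#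
    αα⁻≈1 = proj₂ (ι-unit reg-a)

    open IntegerPowers localisation q̂ q̂⁻ qq⁻≈1
    open Evaluation d 1<d
    open Quadratic localisation p

    α⁻-unit : Unit α⁻
    α⁻-unit = α , Λ.trans (Λ.*-comm α⁻ α) αα⁻≈1

    ι-power : ∀ k → ι (q ^ᴮ k) ≃ Z (+ k)
    ι-power k = Λ.trans (ι-^ q k) (Λ.sym (Z-pos k))

    unit-1-Z : ∀ k → Regular L (B.1# B.- q ^ᴮ k) → Unit (Λ.1# Λ.- Z (+ k))
    unit-1-Z k h = unit-cong (Λ.trans (ι-1- (q ^ᴮ k)) (Λ.+-congˡ (Λ.-‿cong (ι-power k)))) (ι-unit h)

    unit-1-αZ : ∀ k → Regular L (B.1# B.- a B.* q ^ᴮ k) → Unit (Λ.1# Λ.- α Λ.* Z (+ k))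
    unit-1-αZ k h = unit-cong (Λ.trans (ι-1- (a B.* q ^ᴮ k)) (Λ.+-congˡ (Λ.-‿cong (Λ.trans (ι-* a (q ^ᴮ k)) (Λ.*-congˡ (ι-power k)))))) (ι-unit h)

    unit-α-Z : ∀ k → Regular L (a B.- q ^ᴮ k) → Unit (α Λ.- Z (+ k))
    unit-α-Z k h = unit-cong (Λ.trans (ι-- a (q ^ᴮ k)) (Λ.+-congˡ (Λ.-‿cong (ι-power k)))) (ι-unit h)

    unit-neg : ∀ {x} → Unit x → Unit (Λ.- x)
    unit-neg {x} (y , h) = Λ.- y , Λ.trans (solve 2 (λ x y → :- x :* :- y := x :* y) Λ.refl x y) h

    unit-1-Z⁻ : ∀ i → Unit (Λ.1# Λ.- Z i) → Unit (Λ.1# Λ.- Z (ℤ.- i))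
    unit-1-Z⁻ i h = unit-cong (begin
      Λ.- Z (ℤ.- i) Λ.* (Λ.1# Λ.- Z i)      ≈⟨ solve 2 (λ x y → :- x :* (con (+ 1) :- y) := y :* x :- x) Λ.refl (Z (ℤ.- i)) (Z i) ⟩
      Z i Λ.* Z (ℤ.- i) Λ.- Z (ℤ.- i)      ≈⟨ Λ.+-congʳ (proj₂ (Z-unit i)) ⟩
      Λ.1# Λ.- Z (ℤ.- i)                      ∎) (unit-* (unit-neg (Z-unit (ℤ.- i))) h)

    unit-1-α⁻Z : ∀ k → Regular L (a B.- q ^ᴮ k) → Unit (Λ.1# Λ.- α⁻ Λ.* Z (+ k))
    unit-1-α⁻Z k h = unit-cong (begin
      α⁻ Λ.* (α Λ.- Z (+ k))      ≈⟨ solve 3 (λ x y z → x :* (y :- z) := y :* x :- x :* z) Λ.refl α⁻ α (Z (+ k)) ⟩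
      α Λ.* α⁻ Λ.- α⁻ Λ.* Z (+ k)      ≈⟨ Λ.+-congʳ αα⁻≈1 ⟩
      Λ.1# Λ.- α⁻ Λ.* Z (+ k)                 ∎) (unit-* α⁻-unit (unit-α-Z k h))

    1-q-unit : Unit (Λ.1# Λ.- q̂)
    1-q-unit = unit-cong (Λ.+-congˡ (Λ.-‿cong (Λ.trans (Z-pos 1) (Λ.*-identityʳ q̂))))
      -- n > 1 does not divide 1, so the denominator 1 - q of the q-integers is regular.
      (unit-1-Z 1 (reg-power 1 (λ h → ℕ.<-irrefl ≡.refl (ℕ.<-≤-trans 1<n (ℕ∣.∣⇒≤ h)))))

    unit-p : ∀ k → k < 2 ℕ.* m → Unit (lin p k)
    unit-p k k<2m = unit-cong (Λ.sym (Λ.trans (lin≈ {i = δ} k Λ.refl) (Λ.+-congˡ (Λ.-‿cong (Λ.reflexive (≡.cong Z eq))))))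
      (unit-1-Z (d ℕ.* suc k) (reg-power _ (n∤d[1+k] k k<2m)))
      where
      eq : δ ℤ.+ δ ℤ.* + k ≡ + (d ℕ.* suc k)
      eq = ≡.trans (≡.cong (λ i → δ ℤ.+ i) (≡.sym (ℤ.pos-* d k))) (≡.cong +_ (≡.sym (ℕ.*-suc d k)))

    2δk≡ : ∀ k → + 2 ℤ.* δ ℤ.* + k ≡ + (2 ℕ.* d ℕ.* k)
    2δk≡ k = ≡.sym (≡.trans (ℤ.pos-* (2 ℕ.* d) k) (≡.cong (λ i → i ℤ.* + k) (ℤ.pos-* 2 d)))

    fb-exponent : ∀ k → δ ℤ.+ + 2 ℤ.+ + 2 ℤ.* δ ℤ.* + k ≡ + (d ℕ.+ 2 ℕ.+ 2 ℕ.* d ℕ.* k)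
    fb-exponent k = ≡.cong (λ i → δ ℤ.+ + 2 ℤ.+ i) (2δk≡ k)

    unit-fb′ : ∀ k → k < 2 ℕ.* m → Unit (Λ.1# Λ.- Z (δ ℤ.+ + 2 ℤ.+ + 2 ℤ.* δ ℤ.* + k))
    unit-fb′ k k<2m = unit-cong (Λ.+-congˡ (Λ.-‿cong (Λ.reflexive (≡.cong Z (≡.sym (fb-exponent k))))))
      (unit-1-Z (d ℕ.+ 2 ℕ.+ 2 ℕ.* d ℕ.* k) (reg-power _ (n∤d+2+2dk k k<2m)))

    unit-fb : ∀ k → k < 2 ℕ.* m → Unit (quad (Z (δ ℤ.+ + 2)) k)
    unit-fb k k<2m = unit-cong (Λ.sym (quad≈ {i = δ ℤ.+ + 2} k Λ.refl)) (unit-fb′ k k<2m)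

    quad-scaled : ∀ β k → quad (β Λ.* Z (+ 2 ℤ.* δ)) k ≃ Λ.1# Λ.- β Λ.* Z (+ (2 ℕ.* d ℕ.* suc k))
    quad-scaled β k = Λ.+-congˡ (Λ.-‿cong (Λ.trans (Λ.*-assoc β _ _) (Λ.*-congˡ (Z-≡ (Λ.refl ⊛ KK≈ k) (≡.trans (lemma δ (+ k)) (2δk≡ (suc k)))))))
      where
      lemma : ∀ δ k → + 2 ℤ.* δ ℤ.+ + 2 ℤ.* δ ℤ.* k ≡ + 2 ℤ.* δ ℤ.* (+ 1 ℤ.+ k)
      lemma = solve-∀

    unit-fc : ∀ k → k < 2 ℕ.* m → Unit (quad (α Λ.* Z (+ 2 ℤ.* δ)) k)
    unit-fc k _ = unit-cong (Λ.sym (quad-scaled α k)) (unit-1-αZ (2 ℕ.* d ℕ.* suc k) (reg-1-aq _ (2d[1+k]≢n k)))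

    unit-fe : ∀ k → k < 2 ℕ.* m → Unit (quad (α⁻ Λ.* Z (+ 2 ℤ.* δ)) k)
    unit-fe k _ = unit-cong (Λ.sym (quad-scaled α⁻ k)) (unit-1-α⁻Z (2 ℕ.* d ℕ.* suc k) (reg-a-q _ (2d[1+k]≢n k)))

    module Congruence where
      open Model model
      open Evaluate localisation model q̂ q̂⁻ α α⁻ qq⁻≈1 αα⁻≈1 q⇝ a⇝ d 1<d using (module Sides)
      open Sides 1-q-unit m unit-p unit-fb unit-fc unit-fe
      open Cases n ≡.refl

      left right : Fraction
      left = [1-q]⁻ Λ.* total (Z (+ 1)) τ M
      right = ρ

      instance
        d≢0 : NonZero d
        d≢0 = ℕ.>-nonZero 0<d

      [n-1]/d≡ : m ℕ.* (2 ℕ.* d) ℕ./ d ≡ m ℕ.* 2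
      [n-1]/d≡ = ≡.trans (≡.cong (ℕ._/ d) (≡.sym (ℕ.*-assoc m 2 d))) (ℕ.m*n/n≡m (m ℕ.* 2) d)

      left⇝ : lhs4 d n ⇝ left
      left⇝ = lhs⇝ n (≡.trans [n-1]/d≡ (ℕ.*-comm m 2))

      right⇝ : rhs4 d n ⇝ right
      right⇝ = rhs⇝ (≡.trans (≡.cong (ℕ._/ 2) [n-1]/d≡) (ℕ.m*n/n≡m m 2))
        (≡.trans (≡.cong (λ x → x ℕ./ d ℕ./ 2) (lemma d (d ℕ.∸ 1) m))
          (≡.trans (≡.cong (ℕ._/ 2) (ℕ.m*n/n≡m (m ℕ.* (d ℕ.∸ 1) ℕ.* 2) d)) (ℕ.m*n/n≡m (m ℕ.* (d ℕ.∸ 1)) 2)))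
        where
        lemma : ∀ d d′ m → m ℕ.* (2 ℕ.* d) ℕ.* d′ ≡ m ℕ.* d′ ℕ.* 2 ℕ.* d
        lemma = solveℕ-∀

      denominators-regular : Regular L (D (lhs4 d n) B.* D (rhs4 d n))
      denominators-regular = regular-* (⇝-regular left⇝) (⇝-regular right⇝)

      difference : B.Carrier
      difference = N (lhs4 d n) B.* D (rhs4 d n) B.- N (rhs4 d n) B.* D (lhs4 d n)

      module _ (powers : ∀ i → Regular L (B.1# B.- q ^ᴮ suc i)) where

        unit : ∀ i → i ≢ + 0 → Unit (Λ.1# Λ.- Z i)
        unit (+ zero) i≢0 = contradiction ≡.refl i≢0
        unit (+ suc k) _ = unit-1-Z (suc k) (powers k)
        unit -[1+ k ] _ = unit-1-Z⁻ (+ suc k) (unit-1-Z (suc k) (powers k))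

        open Specialised unit

        -- For moduli under which q is not a root of unity: all 1 - qⁱ with i ≠ 0 are invertible, as
        -- the evaluation at a power of q requires.
        divides-at-qⁿ : L ∣ a B.- q ^ᴮ n → L ∣ difference
        divides-at-qⁿ h = ⇝-divides left⇝ right⇝ (value-at-qⁿ (begin
          α      ≈⟨ solve 2 (λ x y → x := (x :- y) :+ y) Λ.refl α (ι (q ^ᴮ n)) ⟩
          (α Λ.- ι (q ^ᴮ n)) Λ.+ ι (q ^ᴮ n)    ≈⟨ Λ.+-congʳ (Λ.trans (Λ.sym (ι-- a (q ^ᴮ n))) (ι-zero h)) ⟩
          Λ.0# Λ.+ ι (q ^ᴮ n)      ≈⟨ Λ.+-identityˡ _ ⟩
          ι (q ^ᴮ n)      ≈⟨ ι-power n ⟩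
          Z (+ n)                              ∎))

        divides-at-q⁻ⁿ : L ∣ B.1# B.- a B.* q ^ᴮ n → L ∣ difference
        divides-at-q⁻ⁿ h = ⇝-divides left⇝ right⇝ (value-at-q⁻ⁿ (cancel (Z-unit (+ n)) (begin
          Z (+ n) Λ.* α      ≈⟨ Λ.trans (Λ.*-comm _ _) (Λ.*-congˡ (Λ.sym (ι-power n))) ⟩
          α Λ.* ι (q ^ᴮ n)      ≈⟨ ι-* a (q ^ᴮ n) ⟨
          ι (a B.* q ^ᴮ n)      ≈⟨ solve 1 (λ x → x := con (+ 1) :- (con (+ 1) :- x)) Λ.refl (ι (a B.* q ^ᴮ n)) ⟩
          Λ.1# Λ.- (Λ.1# Λ.- ι (a B.* q ^ᴮ n)) ≈⟨ Λ.+-congˡ (Λ.-‿cong (Λ.trans (Λ.sym (ι-1- (a B.* q ^ᴮ n))) (ι-zero h))) ⟩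
          Λ.1# Λ.- Λ.0#      ≈⟨ solve 0 (con (+ 1) :- con (+ 0) := con (+ 1)) Λ.refl ⟩
          Λ.1#      ≈⟨ proj₂ (Z-unit (+ n)) ⟨
          Z (+ n) Λ.* Z (ℤ.- + n)              ∎)))

      module _ (1-aq : ∀ s → Regular L (B.1# B.- a B.* q ^ᴮ s)) (a-q : ∀ s → Regular L (a B.- q ^ᴮ s)) where

        negated : ∀ β k → Unit (Z (+ suc k) Λ.- β) → Unit (Λ.1# Λ.- β Λ.* Z -[1+ k ])
        negated β k h = unit-cong (begin
          Z -[1+ k ] Λ.* (Z (+ suc k) Λ.- β)      ≈⟨ solve 3 (λ x y z → x :* (y :- z) := y :* x :- z :* x) Λ.refl (Z -[1+ k ]) (Z (+ suc k)) β ⟩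
          Z (+ suc k) Λ.* Z -[1+ k ] Λ.- β Λ.* Z -[1+ k ]   ≈⟨ Λ.+-congʳ (proj₂ (Z-unit (+ suc k))) ⟩
          Λ.1# Λ.- β Λ.* Z -[1+ k ]                         ∎) (unit-* (Z-unit -[1+ k ]) h)

        unit-α : ∀ i → Unit (Λ.1# Λ.- α Λ.* Z i)
        unit-α (+ k) = unit-1-αZ k (1-aq k)
        unit-α -[1+ k ] = negated α k (unit-cong (solve 2 (λ x y → :- (x :- y) := y :- x) Λ.refl α (Z (+ suc k)))
          (unit-neg (unit-α-Z (suc k) (a-q (suc k)))))

        unit-α⁻ : ∀ i → Unit (Λ.1# Λ.- α⁻ Λ.* Z i)
        unit-α⁻ (+ k) = unit-1-α⁻Z k (a-q k)
        unit-α⁻ -[1+ k ] = negated α⁻ k (unit-cong (begin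
            Λ.- α⁻ Λ.* (Λ.1# Λ.- α Λ.* Z (+ suc k))      ≈⟨ solve 3 (λ x y z → :- x :* (con (+ 1) :- y :* z) := y :* x :* z :- x) Λ.refl α⁻ α (Z (+ suc k)) ⟩
            α Λ.* α⁻ Λ.* Z (+ suc k) Λ.- α⁻      ≈⟨ Λ.+-congʳ (Λ.trans (Λ.*-congʳ αα⁻≈1) (Λ.*-identityˡ _)) ⟩
            Z (+ suc k) Λ.- α⁻                            ∎)
          (unit-* (unit-neg α⁻-unit) (unit-1-αZ (suc k) (1-aq (suc k)))))

        -- The exponent is -(d + 2 + 2dj), so these are again factors of (q^(d+2); q^(2d)), up to a
        -- power of q and a sign.
        unit-e : ∀ j → suc j ≤ m → Unit (Λ.1# Λ.- Z (δ ℤ.- + 2 ℤ.* δ ℤ.* + suc j ℤ.- + 2))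
        unit-e j j<m = unit-cong (Λ.+-congˡ (Λ.-‿cong (Λ.reflexive (≡.cong Z (lemma δ (+ j))))))
          (unit-1-Z⁻ _ (unit-fb′ j (ℕ.<-≤-trans j<m (ℕ.m≤m+n m (m ℕ.+ 0)))))
          where
          lemma : ∀ δ j → ℤ.- (δ ℤ.+ + 2 ℤ.+ + 2 ℤ.* δ ℤ.* j) ≡ δ ℤ.- + 2 ℤ.* δ ℤ.* (+ 1 ℤ.+ j) ℤ.- + 2
          lemma = solve-∀

        -- Here q is a root of unity but a stays free: the invertible elements are now all 1 - aqⁱ
        -- and 1 - qⁱ/a.
        divides-at-roots : L ∣ B.1# B.- q ^ᴮ n → L ∣ difference
        divides-at-roots h = ⇝-divides left⇝ right⇝ (RootOfUnity.both-vanish (begin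
            q̂ ^ n      ≈⟨ ι-^ q n ⟨
            ι (q ^ᴮ n)      ≈⟨ solve 1 (λ x → x := con (+ 1) :- (con (+ 1) :- x)) Λ.refl (ι (q ^ᴮ n)) ⟩
            Λ.1# Λ.- (Λ.1# Λ.- ι (q ^ᴮ n)) ≈⟨ Λ.+-congˡ (Λ.-‿cong (Λ.trans (Λ.sym (ι-1- (q ^ᴮ n))) (ι-zero h))) ⟩
            Λ.1# Λ.- Λ.0#      ≈⟨ solve 0 (con (+ 1) :- con (+ 0) := con (+ 1)) Λ.refl ⟩
            Λ.1#                           ∎) unit-α unit-α⁻ unit-e)

-- The congruence modulo the product of the three moduli

interpretation : ∀ L → Interpretation ℚ[q][a]-ring qv av L num den
interpretation L = record
  { Λ = localisation
  ; ι = ι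
  ; ι-1 = ≃-refl {ι 1₂}
  ; ι-* = ι-*
  ; ι-- = λ f g → ι-+ f (CommutativeRing.-_ ℚ[q][a]-ring g)
  ; ι-zero = λ {f} → ι-zero {f}
  ; ι-unit = λ {f} → ι-unit {f}
  ; model = record
    { _⇝_ = λ x r → Represents (num x) (den x) r
    ; ⇝-cong = λ {x} {r} {s} → represents-cong {num x} {den x} {r} {s}
    ; ⇝-1 = represents-ι 1₂
    ; ⇝-+ = λ {x} {y} {r} {s} → represents-+ {num x} {den x} {num y} {den y} {r} {s}
    ; ⇝-* = λ {x} {y} {r} {s} → represents-* {num x} {den x} {num y} {den y} {r} {s}
    ; ⇝-- = λ {x} {y} {r} {s} → represents-- {num x} {den x} {num y} {den y} {r} {s}
    ; ⇝-÷ = λ {x} {y} {r} {s} {s⁻} → represents-÷ {num x} {den x} {num y} {den y} {r} {s} {s⁻}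
    }
  ; q⇝ = represents-ι qv
  ; a⇝ = represents-ι av
  ; ⇝-regular = regular-denominator
  ; ⇝-divides = λ {x} {y} {r} {s} → represents-difference {num x} {den x} {num y} {den y} {r} {s}
  }
  where open Localisation ℚ[q][a]-ring L

to≈ : ∀ {f g} → CommutativeRing._≈_ ℚ[q][a]-ring f g → f Defs.≈ g
to≈ h i j = ℚ[q].at (ℚ[q][a].at h i) j

from≈ : ∀ {f g} → f Defs.≈ g → CommutativeRing._≈_ ℚ[q][a]-ring f g
from≈ h = ℚ[q][a].coeffs λ i → ℚ[q].coeffs λ j → h i j

module _ where
  open CommutativeRing ℚ[q][a]-ring using (_≈_; sym; trans; 0#; 1#; _-_; *-assoc; *-congʳ; zeroˡ) renaming (_*_ to _·_)
  open Regularity ℚ[q][a]-ring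

  -- The product of the two denominators serves as V: the equation to be shown is then AD - CB = PU
  -- multiplied by V.
  regular⇒≡F : ∀ x y P → Regular 0# P → Regular 0# (den x · den y) → Regular P (den x · den y) →
    P ∣ (num x · den y) - (num y · den x) → x ≡F y mod P
  regular⇒≡F x y P P-0 V-0 V-P (U , difference≈) = U , V , V≉0 , coprime ,
    to≈ (trans (*-congʳ {V} difference≈) (sym (*-assoc (P · U) (den x) (den y))))
    where
    V : Poly2
    V = den x · den y
    V≉0 : ¬ (V Defs.≈ 0₂)
    V≉0 V≈0 = contradiction (to≈ {1₂} {0₂} 1≈0 0 0) 1≢0
      where
      0∣1 : 0# ∣ 1#
      0∣1 = V-0 1# (0# , trans (*-congʳ {1#} (from≈ {V} {0₂} V≈0)) (trans (zeroˡ 1#) (sym (zeroˡ 0#))))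
      1≈0 : 1# ≈ 0#
      1≈0 = trans (proj₂ 0∣1) (zeroˡ (proj₁ 0∣1))
    coprime : Coprime₂ V P
    coprime h (v , V≈) (p , P≈) = unit (regular⇒coprime {P} {V} P-0 V-P h (v , from≈ V≈) (p , from≈ P≈))
      where
      unit : (∃ λ w → h · w ≈ 1#) → IsUnit₂ h
      unit (w , hw≈1) = w , to≈ hw≈1

module Assembly (d m : ℕ) (1<d : 1 < d) (1<n : 1 < Exponents.n d m 1<d) where
  open Exponents d m 1<d using (n; 0<d)
  open CommutativeRing ℚ[q][a]-ring using (sym; 0#; 1#; _-_; *-identityʳ) renaming (_*_ to _·_)
  module ∣₂ = Regularity ℚ[q][a]-ring
  open ∣₂ using (Regular; _∣_)
  open Algebra.Properties.Semiring.Exp (CommutativeRing.semiring ℚ[q][a]-ring) using (_^_)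
  open Moduli ℚ[q][a]-ring qv av n
  open TwoVariables
  module App L = Application ℚ[q][a]-ring qv av num den d m 1<d 1<n L (interpretation L)

  n′ : ℕ
  n′ = m ℕ.* (2 ℕ.* d)

  instance
    d≢0 : NonZero d
    d≢0 = ℕ.>-nonZero 0<d

  A B C D Δ V Φₙ : Poly2
  A = num (lhs4 d n)
  B = den (lhs4 d n)
  C = num (rhs4 d n)
  D = den (rhs4 d n)
  Δ = (A · D) - (C · B)
  V = B · D
  Φₙ = Φ n′

  Φ∣Δ : Φₙ ∣ Δ
  Φ∣Δ = App.Congruence.divides-at-roots Φₙ (denominators-Φ n′) (1-aq-regular-Φ n′) (a-q-regular-Φ n′) (Φ-∣-1-qⁿ n′)

  L₁∣Δ : L₁ ∣ Δ
  L₁∣Δ = App.Congruence.divides-at-q⁻ⁿ L₁ (denominators-L₁ n′) (power-regular-L₁ n′) (1# , sym (*-identityʳ L₁))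

  L₂∣Δ : L₂ ∣ Δ
  L₂∣Δ = App.Congruence.divides-at-qⁿ L₂ (denominators-L₂ n′) (power-regular-L₂ n′) (1# , sym (*-identityʳ L₂))

  P : Poly2
  P = (Φₙ · L₁) · L₂

  P∣Δ : P ∣ Δ
  P∣Δ = ∣₂.product-divides {Φₙ · L₁} {L₂} {Δ}
    (∣₂.regular-* {L₂} {Φₙ} {L₁} (Φ-regular n′ {L₂} (power-regular-L₂ n′)) (L₁-regular-L₂ n′))
    (∣₂.product-divides {Φₙ} {L₁} {Δ} (Φ-regular n′ {L₁} (power-regular-L₁ n′)) Φ∣Δ L₁∣Δ)
    L₂∣Δ

  Φ-0 : Regular 0# Φₙ
  Φ-0 = Φ-regular n′ {0#} power-0

  L₁-0 : Regular 0# L₁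
  L₁-0 = from-zero {L₁} (1-aq-regular [] n)

  L₂-0 : Regular 0# L₂
  L₂-0 = from-zero {L₂} (a-q-regular [] ℚ[q]Regularity.regular-X n)

  ΦL₁-0 : Regular 0# (Φₙ · L₁)
  ΦL₁-0 = ∣₂.regular-* {0#} {Φₙ} {L₁} Φ-0 L₁-0

  V-0 : Regular 0# V
  V-0 = App.Congruence.denominators-regular 0# (denominators-0 n′)

  V-P : Regular P V
  V-P = ∣₂.regular-product {Φₙ · L₁} {L₂} {V} ΦL₁-0
    (∣₂.regular-product {Φₙ} {L₁} {V} Φ-0
      (App.Congruence.denominators-regular Φₙ (denominators-Φ n′))
      (App.Congruence.denominators-regular L₁ (denominators-L₁ n′)))
    (App.Congruence.denominators-regular L₂ (denominators-L₂ n′))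

  ^₂≡^ : ∀ f k → f ^₂ k ≡ f ^ k
  ^₂≡^ f zero = ≡.refl
  ^₂≡^ f (suc k) = ≡.cong (f ·_) (^₂≡^ f k)

  modulus≡ : modulus4 n ≡ P
  modulus≡ = ≡.cong (λ qⁿ → (Φₙ · (1# - (av · qⁿ))) · (av - qⁿ)) (^₂≡^ qv n)

  P-0 : Regular 0# P
  P-0 = ∣₂.regular-* {0#} {Φₙ · L₁} {L₂} ΦL₁-0 L₂-0

  congruence : lhs4 d n ≡F rhs4 d n mod modulus4 n
  congruence = regular⇒≡F (lhs4 d n) (rhs4 d n) (modulus4 n)
    (≡.subst (λ P → Regular 0# P) (≡.sym modulus≡) P-0)
    V-0
    (≡.subst (λ P → Regular P V) (≡.sym modulus≡) V-P)
    (≡.subst (λ P → P ∣ Δ) (≡.sym modulus≡) P∣Δ)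

open import Data.Nat using (_*_; _∸_)
open import Data.Nat.Divisibility using (_∣_)

theorem4 : (d n : ℕ) .{{_ : NonZero d}} → 1 < d → 1 < n → (2 * d) ∣ (n ∸ 1) →
    lhs4 d n ≡F rhs4 d n mod modulus4 n
theorem4 d (suc n) 1<d 1<n (ℕ∣.divides m ≡.refl) = Assembly.congruence d m 1<d 1<n
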